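{- For $b\geq0$ the formal power series $\hat R^{(b)}(\hat x_b,\hat x_{b+1},\ldots)$ is the unique solution (with zero constant term) to $\hat Z^{(b)}(\hat R^{(b)};\hat x_b,\hat x_{b+1},\ldots)=0$, where $$\hat Z^{(b)}(r;\hat x_b,\hat x_{b+1},\ldots)=J(b;r)-\sum_{\ell=b}^\infty I(b,\ell;r)\,\hat x_\ell.$$
   Context: With $\mathrm{Cat}(\ell)=\frac1{\ell+1}\binom{2\ell}\ell$, let $$Z^{(b)}(r;x_{b+1},\ldots)=r\mathbf 1_{\{b=0\}}-\sum_{\ell=0}^b(-1)^{b-\ell}\binom{b+\ell}{2\ell}\mathrm{Cat}(\ell)r^{b-\ell}-\sum_{j=b+1}^\infty\binom{2j-1}{j+b}x_jr^{b+j},$$ and let $R^{(b)}(x_b,x_{b+1},\ldots)$ be the unique formal power series with constant term $1$ satisfying $Z^{(b)}(R^{(b)};x_{b+1},\ldots)=x_b$. The series $\hat R^{(b)}$ is defined by substitution: $$\hat R^{(b)}(\hat x_b,\hat x_{b+1},\ldots)=R^{(b)}(x_b,x_{b+1},\ldots)-1\Big|_{x_\ell=\sum_{p=\ell}^\infty\hat x_pB^{(b)}_{p,\ell}},\qquad B^{(b)}_{p,\ell}=\mathbf 1_{\{p=\ell=b\}}+(-1)^{p-\ell}\binom{p+\ell-1}{p-\ell}\mathbf 1_{\{p\geq\ell>b\}}.$$ The formal power series $I$ and $J$ in $r$ are $$I(b,\ell;r)=\sum_{p=0}^\infty\frac{r^p}{(p!)^2}\prod_{m=0}^{p-1}(\ell^2-(b-m)^2),\qquad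 J(b;r)=\sum_{p=1}^\infty\frac{(-1)^{p+1}r^p}{p!(p-1)!}\prod_{m=0}^{p-2}(b-m)(b-m-1).$$ -}

module Defs where

open import Algebra.Bundles.Raw using (RawMonoid; RawRing)
import Algebra.Definitions.RawMonoid as RawMonoidDefs
import Algebra.Definitions.RawSemiring as RawSemiringDefs
open import Data.Bool.Base using (if_then_else_)
open import Data.Fin.Base using (toℕ)
open import Data.Integer.Base as ℤ using (ℤ; +_)
open import Data.List.Base using (List; []; _∷_; _∷ʳ_; length; replicate)
open import Data.Nat.Base as ℕ using (ℕ; zero; suc; _∸_; _≤_; _<_; z≤n; s≤s; _!)
open import Data.Nat.Combinatorics using (_C_)
open import Data.Nat.ListAction using (sum)
import Data.Nat.Properties as ℕ
open import Data.Product.Base using (Σ; ∃; _×_; _,_; proj₁; proj₂)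
open import Data.Rational.Base as ℚ using (ℚ; 0ℚ; 1ℚ)
import Data.Rational.Properties as ℚ
open import Function.Base using (_∘_)
open import Level using (0ℓ)
open import Relation.Binary.PropositionalEquality
  using (_≡_; refl; sym; trans; cong; cong₂; subst; module ≡-Reasoning)
open import Relation.Nullary.Decidable using (Dec; yes; no; ⌊_⌋; _×-dec_)

-- The operation is applied over the indices 0, …, n - 1.
fold< : (M : RawMonoid 0ℓ 0ℓ) → ℕ → (ℕ → RawMonoid.Carrier M) → RawMonoid.Carrier M
fold< M n f = RawMonoidDefs.sum M {n} (f ∘ toℕ)

∑ℚ : ℕ → (ℕ → ℚ) → ℚ
∑ℚ = fold< ℚ.+-0-rawMonoid

∏ℤ : ℕ → (ℕ → ℤ) → ℤ
∏ℤ = fold< ℤ.*-1-rawMonoid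

∑ℚ-cong : ∀ n {f g} → (∀ i → f i ≡ g i) → ∑ℚ n f ≡ ∑ℚ n g
∑ℚ-cong zero    h = refl
∑ℚ-cong (suc n) h = cong₂ ℚ._+_ (h 0) (∑ℚ-cong n (h ∘ suc))

∑ℚ-zero : ∀ n {f} → (∀ i → i < n → f i ≡ 0ℚ) → ∑ℚ n f ≡ 0ℚ
∑ℚ-zero zero    h = refl
∑ℚ-zero (suc n) h =
  trans (cong₂ ℚ._+_ (h 0 (s≤s z≤n)) (∑ℚ-zero n (λ i i<n → h (suc i) (s≤s i<n))))
        (ℚ.+-identityˡ 0ℚ)

∑ℚ-truncate : ∀ {N n f} → (∀ i → N ≤ i → f i ≡ 0ℚ) → N ≤ n → ∑ℚ n f ≡ ∑ℚ N f
∑ℚ-truncate {n = n} h z≤n = ∑ℚ-zero n (λ i _ → h i z≤n)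
∑ℚ-truncate {f = f} h (s≤s N≤n) =
  cong (f 0 ℚ.+_) (∑ℚ-truncate (λ i N≤i → h (suc i) (s≤s N≤i)) N≤n)

-- A `Series` is a formal power series over ℚ in the variables v₀, v₁, …, with
-- no finiteness condition on the monomials that occur.
-- The list e₀ ∷ … ∷ eₙ ∷ [] stands for the monomial v₀^e₀ ⋯ vₙ^eₙ.  Trailing
-- zeros do not change the monomial, which is what `pad` accounts for.
Exponents : Set
Exponents = List ℕ

Padded : (Exponents → ℚ) → Set
Padded f = ∀ e → f (e ∷ʳ 0) ≡ f e

record Series : Set where
  field
    coeff : Exponents → ℚ
    pad   : Padded coeff
open Series public

constantTerm : Series → ℚ
constantTerm f = coeff f []

infix 4 _≈_
record _≈_ (f g : Series) : Set where
  constructor mk≈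
  field
    coeff-≡ : ∀ e → coeff f e ≡ coeff g e
open _≈_ public

constCoeff : ℚ → Exponents → ℚ
constCoeff c []          = c
constCoeff c (zero  ∷ e) = constCoeff c e
constCoeff c (suc _ ∷ e) = 0ℚ

constCoeff-pad : ∀ c → Padded (constCoeff c)
constCoeff-pad c []          = refl
constCoeff-pad c (zero  ∷ e) = constCoeff-pad c e
constCoeff-pad c (suc _ ∷ e) = refl

varCoeff : ℕ → Exponents → ℚ
varCoeff i       []                = 0ℚ
varCoeff zero    (zero ∷ e)        = 0ℚ
varCoeff zero    (suc zero ∷ e)    = constCoeff 1ℚ e
varCoeff zero    (suc (suc _) ∷ e) = 0ℚ
varCoeff (suc i) (zero ∷ e)        = varCoeff i e
varCoeff (suc i) (suc _ ∷ e)       = 0ℚ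

varCoeff-pad : ∀ i → Padded (varCoeff i)
varCoeff-pad zero    []                = refl
varCoeff-pad (suc i) []                = refl
varCoeff-pad zero    (zero ∷ e)        = refl
varCoeff-pad zero    (suc zero ∷ e)    = constCoeff-pad 1ℚ e
varCoeff-pad zero    (suc (suc _) ∷ e) = refl
varCoeff-pad (suc i) (zero ∷ e)        = varCoeff-pad i e
varCoeff-pad (suc i) (suc _ ∷ e)       = refl

-- The Cauchy product ∑_{u + v = e} f(u) g(v), one variable at a time.
cauchy : (f g : Exponents → ℚ) → Exponents → ℚ
cauchy f g []      = f [] ℚ.* g []
cauchy f g (n ∷ e) = ∑ℚ (suc n) (λ i → cauchy (f ∘ (i ∷_)) (g ∘ ((n ∸ i) ∷_)) e)

cauchy-pad : ∀ {f g} → Padded f → Padded g → Padded (cauchy f g)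
cauchy-pad pf pg []      = trans (ℚ.+-identityʳ _) (cong₂ ℚ._*_ (pf []) (pg []))
cauchy-pad pf pg (n ∷ e) =
  ∑ℚ-cong (suc n) (λ i → cauchy-pad (pf ∘ (i ∷_)) (pg ∘ ((n ∸ i) ∷_)) e)

const : ℚ → Series
const c = record { coeff = constCoeff c ; pad = constCoeff-pad c }

var : ℕ → Series
var i = record { coeff = varCoeff i ; pad = varCoeff-pad i }

infixl 6 _+_ _-_
infixl 7 _*_ _•_
infix  8 -_

_+_ : Series → Series → Series
f + g = record
  { coeff = λ e → coeff f e ℚ.+ coeff g e
  ; pad   = λ e → cong₂ ℚ._+_ (pad f e) (pad g e)
  }

-_ : Series → Series
- f = record { coeff = λ e → ℚ.- coeff f e ; pad = λ e → cong ℚ.-_ (pad f e) }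

_-_ : Series → Series → Series
f - g = f + (- g)

_*_ : Series → Series → Series
f * g = record { coeff = cauchy (coeff f) (coeff g) ; pad = cauchy-pad (pad f) (pad g) }

_•_ : ℚ → Series → Series
c • f = record { coeff = λ e → c ℚ.* coeff f e ; pad = λ e → cong (c ℚ.*_) (pad f e) }

rawRing : RawRing 0ℓ 0ℓ
rawRing = record
  { Carrier = Series
  ; _≈_     = _≈_
  ; _+_     = _+_
  ; _*_     = _*_
  ; -_      = -_
  ; 0#      = const 0ℚ
  ; 1#      = const 1ℚ
  }

open RawSemiringDefs (RawRing.rawSemiring rawRing) public using (_^_)

∑ : ℕ → (ℕ → Series) → Series
∑ = fold< (RawRing.+-rawMonoid rawRing)

coeff-∑ : ∀ n F e → coeff (∑ n F) e ≡ ∑ℚ n (λ i → coeff (F i) e)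
coeff-∑ zero    F e = go e
  where
  go : ∀ e → constCoeff 0ℚ e ≡ 0ℚ
  go []          = refl
  go (zero  ∷ e) = go e
  go (suc _ ∷ e) = refl
coeff-∑ (suc n) F e = cong (coeff (F 0) e ℚ.+_) (coeff-∑ n (F ∘ suc) e)

-- Every coefficient is eventually constant.
Convergent : (ℕ → Series) → Set
Convergent s = ∀ e → ∃ λ N → ∀ n → N ≤ n → coeff (s n) e ≡ coeff (s N) e

lim : (s : ℕ → Series) → Convergent s → Series
lim s h = record { coeff = λ e → coeff (s (proj₁ (h e))) e ; pad = lim-pad }
  where
  lim-pad : Padded (λ e → coeff (s (proj₁ (h e))) e)
  lim-pad e = let M , M-const = h (e ∷ʳ 0) ; N , N-const = h e in
    trans (sym (M-const (M ℕ.⊔ N) (ℕ.m≤m⊔n M N)))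
      (trans (pad (s (M ℕ.⊔ N)) e) (N-const (M ℕ.⊔ N) (ℕ.m≤n⊔m M N)))

Summable : (ℕ → Series) → Set
Summable F = ∀ e → ∃ λ N → ∀ i → N ≤ i → coeff (F i) e ≡ 0ℚ

summable⇒convergent : ∀ F → Summable F → Convergent (λ n → ∑ n F)
summable⇒convergent F h e = let N , zeros = h e in N , λ n N≤n →
  trans (coeff-∑ n F e) (trans (∑ℚ-truncate zeros N≤n) (sym (coeff-∑ N F e)))

∑∞ : (F : ℕ → Series) → Summable F → Series
∑∞ F h = lim (λ n → ∑ n F) (summable⇒convergent F h)

cauchy-zero : ∀ f g e →
  (∀ u v → length u ≡ length e → length v ≡ length e → sum u ℕ.+ sum v ≡ sum e →
    f u ℚ.* g v ≡ 0ℚ) →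
  cauchy f g e ≡ 0ℚ
cauchy-zero f g []      h = h [] [] refl refl refl
cauchy-zero f g (n ∷ e) h = ∑ℚ-zero (suc n) λ { i (s≤s i≤n) →
  cauchy-zero (f ∘ (i ∷_)) (g ∘ ((n ∸ i) ∷_)) e λ u v |u| |v| Σ≡ →
    h (i ∷ u) (n ∸ i ∷ v) (cong suc |u|) (cong suc |v|) (begin
      (i ℕ.+ sum u) ℕ.+ ((n ∸ i) ℕ.+ sum v)  ≡⟨ ℕ.+-assoc i (sum u) _ ⟩
      i ℕ.+ (sum u ℕ.+ ((n ∸ i) ℕ.+ sum v))  ≡⟨ cong (i ℕ.+_) (ℕ.+-comm (sum u) _) ⟩
      i ℕ.+ (((n ∸ i) ℕ.+ sum v) ℕ.+ sum u)  ≡⟨ cong (i ℕ.+_) (ℕ.+-assoc (n ∸ i) (sum v) (sum u)) ⟩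
      i ℕ.+ ((n ∸ i) ℕ.+ (sum v ℕ.+ sum u))  ≡⟨ ℕ.+-assoc i (n ∸ i) _ ⟨
      (i ℕ.+ (n ∸ i)) ℕ.+ (sum v ℕ.+ sum u)  ≡⟨ cong₂ ℕ._+_ (ℕ.m+[n∸m]≡n i≤n) (ℕ.+-comm (sum v) (sum u)) ⟩
      n ℕ.+ (sum u ℕ.+ sum v)                ≡⟨ cong (n ℕ.+_) Σ≡ ⟩
      n ℕ.+ sum e                            ∎) }
  where open ≡-Reasoning

zeroˡ : ∀ {p} q → p ≡ 0ℚ → p ℚ.* q ≡ 0ℚ
zeroˡ q refl = ℚ.*-zeroˡ q

zeroʳ : ∀ p {q} → q ≡ 0ℚ → p ℚ.* q ≡ 0ℚ
zeroʳ p refl = ℚ.*-zeroʳ p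

VanishesAtLength : ℕ → Series → Set
VanishesAtLength n f = ∀ e → length e ≡ n → coeff f e ≡ 0ℚ

*-vanishesˡ : ∀ {n} f g → VanishesAtLength n f → VanishesAtLength n (f * g)
*-vanishesˡ f g h e |e| = cauchy-zero (coeff f) (coeff g) e λ u v |u| _ _ → zeroˡ (coeff g v) (h u (trans |u| |e|))

*-vanishesʳ : ∀ {n} f g → VanishesAtLength n g → VanishesAtLength n (f * g)
*-vanishesʳ f g h e |e| = cauchy-zero (coeff f) (coeff g) e λ u v _ |v| _ → zeroʳ (coeff f u) (h v (trans |v| |e|))

var-vanishes : ∀ {n i} → n ≤ i → VanishesAtLength n (var i)
var-vanishes         _         []          _    = refl
var-vanishes {i = suc i} (s≤s n≤i) (zero  ∷ e) refl = var-vanishes n≤i e refl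
var-vanishes {i = suc i} _         (suc _ ∷ e) _    = refl

OrderAtLeast : ℕ → Series → Set
OrderAtLeast k f = ∀ e → sum e < k → coeff f e ≡ 0ℚ

*-order : ∀ {j k} f g → OrderAtLeast j f → OrderAtLeast k g → OrderAtLeast (j ℕ.+ k) (f * g)
*-order {j} {k} f g hf hg e e<j+k = cauchy-zero (coeff f) (coeff g) e go
  where
  go : ∀ u v → length u ≡ length e → length v ≡ length e → sum u ℕ.+ sum v ≡ sum e →
       coeff f u ℚ.* coeff g v ≡ 0ℚ
  go u v _ _ Σ≡ with sum u ℕ.<? j
  ... | yes u<j = zeroˡ (coeff g v) (hf u u<j)
  ... | no  u≮j = zeroʳ (coeff f u) (hg v (ℕ.≰⇒> λ k≤v →
    ℕ.<⇒≱ e<j+k (ℕ.≤-trans (ℕ.+-mono-≤ (ℕ.≮⇒≥ u≮j) k≤v) (ℕ.≤-reflexive Σ≡))))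

^-order : ∀ f → OrderAtLeast 1 f → ∀ k → OrderAtLeast k (f ^ k)
^-order f h zero    e ()
^-order f h (suc k) = *-order f (f ^ k) h (^-order f h k)

order-1 : ∀ f → constantTerm f ≡ 0ℚ → OrderAtLeast 1 f
order-1 f f₀ e (s≤s Σ≤0) =
  trans (cong (coeff f) (zeros e (ℕ.n≤0⇒n≡0 Σ≤0))) (at-zeros (length e))
  where
  zeros : ∀ e → sum e ≡ 0 → e ≡ replicate (length e) 0
  zeros []         _ = refl
  zeros (zero ∷ e) p = cong (0 ∷_) (zeros e p)

  snoc : ∀ n → replicate (suc n) 0 ≡ replicate n 0 ∷ʳ 0
  snoc zero    = refl
  snoc (suc n) = cong (0 ∷_) (snoc n)

  at-zeros : ∀ n → coeff f (replicate n 0) ≡ 0ℚ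
  at-zeros zero    = f₀
  at-zeros (suc n) = trans (cong (coeff f) (snoc n)) (trans (pad f _) (at-zeros n))

-- ∑ₚ a(p) rᵖ at r = f; this converges because f has no constant term.
evalAt : (a : ℕ → ℚ) (f : Series) → constantTerm f ≡ 0ℚ → Series
evalAt a f f₀ = ∑∞ (λ p → a p • f ^ p) λ e →
  suc (sum e) , λ p e<p → zeroʳ (a p) (^-order f (order-1 f f₀) p e e<p)

monomial : (ℕ → Series) → Exponents → Series
monomial X []      = const 1ℚ
monomial X (k ∷ m) = X 0 ^ k * monomial (X ∘ suc) m

-- Sum over all exponent lists of length l with entries < d.  As l and d grow,
-- these exhaust the monomials, each of which occurs at most once.
box : (M : RawMonoid 0ℓ 0ℓ) (l d : ℕ) → (Exponents → RawMonoid.Carrier M) → RawMonoid.Carrier M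
box M zero    d F = F []
box M (suc l) d F = fold< M d (λ k → box M l d (F ∘ (k ∷_)))

substUpTo : Series → (ℕ → Series) → ℕ → Series
substUpTo f X n =
  box (RawRing.+-rawMonoid rawRing) n n (λ m → coeff f m • monomial X m)

-- Every monomial of X i involves a variable of index at least i.
Triangular : (ℕ → Series) → Set
Triangular X = ∀ i n → n ≤ i → VanishesAtLength n (X i)

boxℚ : (l d : ℕ) → (Exponents → ℚ) → ℚ
boxℚ = box ℚ.+-0-rawMonoid

coeff-box : ∀ l d F e →
  coeff (box (RawRing.+-rawMonoid rawRing) l d F) e ≡ boxℚ l d (λ m → coeff (F m) e)
coeff-box zero    d F e = refl
coeff-box (suc l) d F e =
  trans (coeff-∑ d (λ k → box (RawRing.+-rawMonoid rawRing) l d (F ∘ (k ∷_))) e) (∑ℚ-cong d (λ k → coeff-box l d (F ∘ (k ∷_)) e))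

box-zero : ∀ l d {G} → (∀ m → G m ≡ 0ℚ) → boxℚ l d G ≡ 0ℚ
box-zero zero    d h = h []
box-zero (suc l) d h = ∑ℚ-zero d (λ k _ → box-zero l d (h ∘ (k ∷_)))

box-narrow : ∀ l {D d G} → D ≤ d → (∀ m → D ≤ sum m → G m ≡ 0ℚ) →
             boxℚ l d G ≡ boxℚ l D G
box-narrow zero    D≤d h = refl
box-narrow (suc l) {D} {d} D≤d h = trans
  (∑ℚ-cong d (λ k → box-narrow l D≤d (λ m D≤m → h (k ∷ m) (ℕ.≤-trans D≤m (ℕ.m≤n+m _ k)))))
  (∑ℚ-truncate (λ k D≤k → box-zero l D (λ m → h (k ∷ m) (ℕ.≤-trans D≤k (ℕ.m≤m+n k _)))) D≤d)

box-shorten : ∀ l D {G} → (∀ m → G (m ∷ʳ 0) ≡ G m) →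
              (∀ m k → length m ≡ l → G (m ∷ʳ suc k) ≡ 0ℚ) →
              boxℚ (suc l) (suc D) G ≡ boxℚ l (suc D) G
box-shorten zero    D pd h = trans
  (cong₂ ℚ._+_ (pd []) (∑ℚ-zero D (λ k _ → h [] k refl))) (ℚ.+-identityʳ _)
box-shorten (suc l) D pd h = ∑ℚ-cong (suc D) (λ k →
  box-shorten l D (pd ∘ (k ∷_)) (λ m j |m| → h (k ∷ m) j (cong suc |m|)))

box-shorten* : ∀ L n D {G} → (∀ m → G (m ∷ʳ 0) ≡ G m) →
               (∀ m k → L ≤ length m → G (m ∷ʳ suc k) ≡ 0ℚ) →
               boxℚ (n ℕ.+ L) (suc D) G ≡ boxℚ L (suc D) G
box-shorten* L zero    D pd h = refl
box-shorten* L (suc n) D pd h = trans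
  (box-shorten (n ℕ.+ L) D pd (λ m k |m| → h m k (subst (L ≤_) (sym |m|) (ℕ.m≤n+m L n))))
  (box-shorten* L n D pd h)

cauchy-cong : ∀ f {g g'} e → (∀ e → g e ≡ g' e) → cauchy f g e ≡ cauchy f g' e
cauchy-cong f []      h = cong (f [] ℚ.*_) (h [])
cauchy-cong f (n ∷ e) h = ∑ℚ-cong (suc n) (λ i → cauchy-cong (f ∘ (i ∷_)) e (h ∘ ((n ∸ i) ∷_)))

cauchy-identityˡ : ∀ g e → cauchy (constCoeff 1ℚ) g e ≡ g e
cauchy-identityˡ g []      = ℚ.*-identityˡ (g [])
cauchy-identityˡ g (n ∷ e) = trans
  (cong₂ ℚ._+_ (cauchy-identityˡ (g ∘ (n ∷_)) e)
               (∑ℚ-zero n (λ i _ →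
                 cauchy-zero (λ _ → 0ℚ) (g ∘ ((n ∸ suc i) ∷_)) e
                   (λ _ v _ _ _ → ℚ.*-zeroˡ (g ((n ∸ suc i) ∷ v))))))
  (ℚ.+-identityʳ _)

monomial-pad : ∀ X m e → coeff (monomial X (m ∷ʳ 0)) e ≡ coeff (monomial X m) e
monomial-pad X []      e = cauchy-identityˡ _ e
monomial-pad X (k ∷ m) e = cauchy-cong (coeff (X 0 ^ k)) e (monomial-pad (X ∘ suc) m)

monomial-order : ∀ X → (∀ i → OrderAtLeast 1 (X i)) → ∀ m → OrderAtLeast (sum m) (monomial X m)
monomial-order X h []      e ()
monomial-order X h (k ∷ m) =
  *-order (X 0 ^ k) (monomial (X ∘ suc) m)
    (^-order (X 0) (h 0) k) (monomial-order (X ∘ suc) (h ∘ suc) m)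

monomial-vanishes : ∀ {n} X m k → VanishesAtLength n (X (length m)) →
                    VanishesAtLength n (monomial X (m ∷ʳ suc k))
monomial-vanishes X []      k h =
  *-vanishesˡ (X 0 ^ suc k) (const 1ℚ) (*-vanishesˡ (X 0) (X 0 ^ k) h)
monomial-vanishes X (j ∷ m) k h =
  *-vanishesʳ (X 0 ^ j) (monomial (X ∘ suc) (m ∷ʳ suc k)) (monomial-vanishes (X ∘ suc) m k h)

substUpTo-convergent : ∀ f X → Triangular X → Convergent (substUpTo f X)
substUpTo-convergent f X tri e = N , λ n N≤n → trans (stable n N≤n) (sym (stable N ℕ.≤-refl))
  where
  L D N : ℕ
  L = length e
  D = sum e
  N = L ℕ.⊔ suc D

  G : Exponents → ℚ
  G m = coeff f m ℚ.* coeff (monomial X m) e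

  G-pad : ∀ m → G (m ∷ʳ 0) ≡ G m
  G-pad m = cong₂ ℚ._*_ (pad f m) (monomial-pad X m e)

  G-long : ∀ m k → L ≤ length m → G (m ∷ʳ suc k) ≡ 0ℚ
  G-long m k L≤m = zeroʳ (coeff f (m ∷ʳ suc k))
    (monomial-vanishes X m k (tri (length m) L L≤m) e refl)

  G-high : ∀ m → D < sum m → G m ≡ 0ℚ
  G-high m D<m = zeroʳ (coeff f m)
    (monomial-order X (λ i → order-1 (X i) (tri i 0 z≤n [] refl)) m e D<m)

  stable : ∀ n → N ≤ n → coeff (substUpTo f X n) e ≡ boxℚ L (suc D) G
  stable n N≤n = begin
    coeff (substUpTo f X n) e          ≡⟨ coeff-box n n (λ m → coeff f m • monomial X m) e ⟩
    boxℚ n n G                         ≡⟨ box-narrow n (ℕ.≤-trans (ℕ.m≤n⊔m L (suc D)) N≤n) G-high ⟩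
    boxℚ n (suc D) G                   ≡⟨ cong (λ l → boxℚ l (suc D) G) (ℕ.m∸n+n≡m (ℕ.≤-trans (ℕ.m≤m⊔n L (suc D)) N≤n)) ⟨
    boxℚ ((n ∸ L) ℕ.+ L) (suc D) G     ≡⟨ box-shorten* L (n ∸ L) D G-pad G-long ⟩
    boxℚ L (suc D) G                   ∎
    where open ≡-Reasoning

-- The series f with X i substituted for vᵢ, for all i at once.
substitute : (f : Series) (X : ℕ → Series) → Triangular X → Series
substitute f X tri = lim (substUpTo f X) (substUpTo-convergent f X tri)

infixr 8 _^ℚ_
_^ℚ_ : ℚ → ℕ → ℚ
_^ℚ_ = RawSemiringDefs._^_ ℚ.+-*-rawSemiring

fromℕ : ℕ → ℚ
fromℕ n = + n ℚ./ 1

sign : ℕ → ℚ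
sign n = (ℚ.- 1ℚ) ^ℚ n

𝟙 : ∀ {A : Set} → Dec A → ℚ
𝟙 d = if ⌊ d ⌋ then 1ℚ else 0ℚ

Cat : ℕ → ℚ
Cat ℓ = + ((2 ℕ.* ℓ) C ℓ) ℚ./ suc ℓ

-- For fixed b the variables are x_b, x_{b+1}, …, so x_j (j ≥ b) is v_{j-b}.
-- The same encoding serves for the hatted variables.
x : (b j : ℕ) → Series
x b j = var (j ∸ b)

x-vanishes : ∀ b i {n} → n ≤ i → VanishesAtLength n (x b (b ℕ.+ i))
x-vanishes b i {n} n≤i = var-vanishes (subst (n ≤_) (sym (ℕ.m+n∸m≡n b i)) n≤i)

Z-term : (b : ℕ) (r : Series) (j : ℕ) → Series
Z-term b r j = fromℕ ((2 ℕ.* j ∸ 1) C (j ℕ.+ b)) • (x b j * r ^ (b ℕ.+ j))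

Z-summable : ∀ b r → Summable (λ i → Z-term b r (b ℕ.+ suc i))
Z-summable b r e = length e , λ i |e|≤i → let j = b ℕ.+ suc i in
  zeroʳ (fromℕ ((2 ℕ.* j ∸ 1) C (j ℕ.+ b)))
    (*-vanishesˡ (x b j) (r ^ (b ℕ.+ j)) (x-vanishes b (suc i) (ℕ.m≤n⇒m≤1+n |e|≤i)) e refl)

Z : ℕ → Series → Series
Z b r =
  𝟙 (b ℕ.≟ 0) • r
  - ∑ (suc b) (λ ℓ →
      (sign (b ∸ ℓ) ℚ.* fromℕ ((b ℕ.+ ℓ) C (2 ℕ.* ℓ)) ℚ.* Cat ℓ) • r ^ (b ∸ ℓ))
  - ∑∞ (λ i → Z-term b r (b ℕ.+ suc i)) (Z-summable b r)

-- R⁽ᵇ⁾ is the only series with this property.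
record IsR (b : ℕ) (R : Series) : Set where
  field
    constantTerm-1 : constantTerm R ≡ 1ℚ
    equation       : Z b R ≈ x b b

B : (b p ℓ : ℕ) → ℚ
B b p ℓ =
  𝟙 ((p ℕ.≟ ℓ) ×-dec (ℓ ℕ.≟ b))
  ℚ.+ sign (p ∸ ℓ) ℚ.* fromℕ ((p ℕ.+ ℓ ∸ 1) C (p ∸ ℓ))
      ℚ.* 𝟙 ((ℓ ℕ.≤? p) ×-dec (b ℕ.<? ℓ))

-- The sum over p ≥ ℓ for ℓ = b + i; the index p is ℓ + k.
X-term : (b i k : ℕ) → Series
X-term b i k = let ℓ = b ℕ.+ i ; p = ℓ ℕ.+ k in B b p ℓ • x b p

X-term-vanishes : ∀ b i k {n} → n ≤ i ℕ.+ k → VanishesAtLength n (X-term b i k)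
X-term-vanishes b i k n≤i+k e |e| = zeroʳ (B b (b ℕ.+ i ℕ.+ k) (b ℕ.+ i))
  (subst (λ p → coeff (x b p) e ≡ 0ℚ) (sym (ℕ.+-assoc b i k)) (x-vanishes b (i ℕ.+ k) n≤i+k e |e|))

X-summable : ∀ b i → Summable (X-term b i)
X-summable b i e = length e , λ k |e|≤k →
  X-term-vanishes b i k (ℕ.≤-trans |e|≤k (ℕ.m≤n+m k i)) e refl

X : (b i : ℕ) → Series
X b i = ∑∞ (X-term b i) (X-summable b i)

X-triangular : ∀ b → Triangular (X b)
X-triangular b i n n≤i e |e| = trans (coeff-∑ (length e) (X-term b i) e)
  (∑ℚ-zero (length e) (λ k _ → X-term-vanishes b i k (ℕ.≤-trans n≤i (ℕ.m≤m+n i k)) e |e|))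

-- X b i is the series that replaces x_{b+i}; the argument R stands for R⁽ᵇ⁾.
hat : ℕ → Series → Series
hat b R = substitute R (X b) (X-triangular b) - const 1ℚ

-- I and J are given by their coefficients as power series in r.
I : (b ℓ : ℕ) → ℕ → ℚ
I b ℓ p =
  (∏ℤ p (λ m → (+ ℓ) ℤ.^ 2 ℤ.- (+ b ℤ.- + m) ℤ.^ 2) ℚ./ (p ! ℕ.* p !))
    {{ℕ._!*_!≢0 p p}}

J : (b : ℕ) → ℕ → ℚ
J b zero      = 0ℚ
J b p@(suc q) = sign (p ℕ.+ 1) ℚ.*
  ((∏ℤ q (λ m → (+ b ℤ.- + m) ℤ.* (+ b ℤ.- + m ℤ.- + 1)) ℚ./ (p ! ℕ.* q !))
    {{ℕ._!*_!≢0 p q}})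

Ẑ-term : (b : ℕ) (r : Series) → constantTerm r ≡ 0ℚ → (ℓ : ℕ) → Series
Ẑ-term b r r₀ ℓ = evalAt (I b ℓ) r r₀ * x b ℓ

Ẑ-summable : ∀ b r r₀ → Summable (λ i → Ẑ-term b r r₀ (b ℕ.+ i))
Ẑ-summable b r r₀ e = length e , λ i |e|≤i →
  *-vanishesʳ (evalAt (I b (b ℕ.+ i)) r r₀) (x b (b ℕ.+ i)) (x-vanishes b i |e|≤i) e refl

Ẑ : (b : ℕ) (r : Series) → constantTerm r ≡ 0ℚ → Series
Ẑ b r r₀ = evalAt (J b) r r₀ - ∑∞ (λ i → Ẑ-term b r r₀ (b ℕ.+ i)) (Ẑ-summable b r r₀)

IsSolution : ℕ → Series → Set
IsSolution b r = Σ (constantTerm r ≡ 0ℚ) λ r₀ → Ẑ b r r₀ ≈ const 0ℚ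

IsUnique : (Series → Set) → Series → Set
IsUnique P r = P r × (∀ s → P s → s ≈ r)

{-# OPTIONS --safe #-}
-- Substituting x = x̂ B turns Z(R) = x_b into an equation in h = R − 1 that is
-- linear in the x̂_p, so it suffices to expand every power of 1 + h in powers of
-- h.  The coefficient of x̂_p is then a combination of powers of 1 + r, and
-- I(b, p; r) is a ₂F₁.  Both satisfy one hypergeometric equation, that is, a
-- two-term recurrence on the coefficients of r^q, and they have the same leading
-- coefficient; the same argument gives J.  Infinite sums, the evaluation of power
-- series and the substitution are all handled modulo the variables v_L, v_{L+1}, …
-- and modulo total degree D, where they become finite.  Uniqueness is an induction
-- on D, because J has linear coefficient 1 and every other term of Ẑ gains one
-- degree.

module Submission where

open import Defs
import Algebra.Definitions.RawSemiring as RawSemiringDefinitions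
import Algebra.Properties.Semiring.Sum as SemiringSum
import Algebra.Solver.Ring.NaturalCoefficients.Default as SemiringSolver
open import Algebra.Bundles using (CommutativeRing; Semiring)
open import Algebra.Bundles.Raw using (RawRing)
open import Data.Fin.Base using (toℕ)
open import Data.Integer.Base as ℤ using (ℤ; +_)
import Data.Integer.Properties as ℤ
open import Data.List.Base using ([]; _∷_; length)
open import Data.Nat.Base as ℕ using (ℕ; zero; suc; _∸_; _≤_; _<_; z≤n; s≤s; _!)
open import Data.Nat.Combinatorics using (_C_; k>n⇒nCk≡0; nC1≡n; nCn≡1; nCk+nC[k+1]≡[n+1]C[k+1])
open import Data.Nat.ListAction using (sum)
import Data.Nat.Properties as ℕ
import Data.Nat.Tactic.RingSolver as ℕSolver
open import Data.Product.Base using (_,_; proj₁; proj₂)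
open import Data.Rational.Base as ℚ using (ℚ; 0ℚ; 1ℚ)
import Data.Rational.Properties as ℚ
open import Data.Rational.Unnormalised.Base as ℚᵘ using (mkℚᵘ; *≡*)
import Data.Rational.Unnormalised.Properties as ℚᵘ
open import Data.Sum.Base using (_⊎_; inj₁; inj₂)
open import Function.Base using (_∘_)
open import Level using (0ℓ)
open import Relation.Binary.PropositionalEquality
  using (_≡_; refl; sym; trans; cong; cong₂; subst; module ≡-Reasoning)
import Relation.Binary.Reasoning.Setoid as SetoidReasoning
open import Relation.Nullary using (¬_)
open import Relation.Nullary.Decidable using (Dec; yes; no; _×-dec_; dec⇒maybe)
open import Relation.Nullary.Negation using (contradiction)
open import Tactic.RingSolver using (solve-∀)
open import Tactic.RingSolver.Core.AlmostCommutativeRing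
  using (AlmostCommutativeRing; fromCommutativeRing)

module FiniteSums (A : CommutativeRing 0ℓ 0ℓ) where
  open CommutativeRing A
    renaming (_+_ to _⊕_; _*_ to _⊛_; -_ to ⊖_; _-_ to _⊝_; _≈_ to _≋_; refl to ≋-refl; sym to ≋-sym; trans to ≋-trans)
  open SemiringSum semiring using (∑-distrib-+; ∑-comm; *-distribˡ-sum; *-distribʳ-sum)
  open SetoidReasoning setoid

  sum< : ℕ → (ℕ → Carrier) → Carrier
  sum< = fold< +-rawMonoid

  sum<-cong : ∀ n {f g} → (∀ i → i < n → f i ≋ g i) → sum< n f ≋ sum< n g
  sum<-cong zero    h = ≋-refl
  sum<-cong (suc n) h = +-cong (h 0 (s≤s z≤n)) (sum<-cong n (λ i i<n → h (suc i) (s≤s i<n)))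

  sum<-zero : ∀ n {f} → (∀ i → i < n → f i ≋ 0#) → sum< n f ≋ 0#
  sum<-zero zero    h = ≋-refl
  sum<-zero (suc n) h = ≋-trans
    (+-cong (h 0 (s≤s z≤n)) (sum<-zero n (λ i i<n → h (suc i) (s≤s i<n)))) (+-identityˡ 0#)

  sum<-+ : ∀ n f g → sum< n (λ i → f i ⊕ g i) ≋ sum< n f ⊕ sum< n g
  sum<-+ n f g = ∑-distrib-+ {n} (f ∘ toℕ) (g ∘ toℕ)

  sum<-*ˡ : ∀ n x f → x ⊛ sum< n f ≋ sum< n (λ i → x ⊛ f i)
  sum<-*ˡ n x f = *-distribˡ-sum {n} x (f ∘ toℕ)

  sum<-*ʳ : ∀ n x f → sum< n f ⊛ x ≋ sum< n (λ i → f i ⊛ x)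
  sum<-*ʳ n x f = *-distribʳ-sum {n} x (f ∘ toℕ)

  sum<-comm : ∀ m n (f : ℕ → ℕ → Carrier) →
              sum< m (λ i → sum< n (f i)) ≋ sum< n (λ j → sum< m (λ i → f i j))
  sum<-comm m n f = ∑-comm {m} {n} (λ i j → f (toℕ i) (toℕ j))

  sum<-append : ∀ m n f → sum< (m ℕ.+ n) f ≋ sum< m f ⊕ sum< n (λ i → f (m ℕ.+ i))
  sum<-append zero    n f = ≋-sym (+-identityˡ _)
  sum<-append (suc m) n f = ≋-trans (+-congˡ (sum<-append m n (f ∘ suc))) (≋-sym (+-assoc _ _ _))

  sum<-last : ∀ n f → sum< (suc n) f ≋ sum< n f ⊕ f n
  sum<-last zero    f = ≋-trans (+-identityʳ (f 0)) (≋-sym (+-identityˡ (f 0)))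
  sum<-last (suc n) f = ≋-trans (+-congˡ (sum<-last n (f ∘ suc))) (≋-sym (+-assoc _ _ _))

  sum<-telescope : ∀ n (f : ℕ → Carrier) → sum< n (λ i → f (suc i) ⊝ f i) ≋ f n ⊝ f 0
  sum<-telescope zero    f = ≋-sym (-‿inverseʳ (f 0))
  sum<-telescope (suc n) f = begin
    (f 1 ⊝ f 0) ⊕ sum< n (λ i → f (suc (suc i)) ⊝ f (suc i))  ≈⟨ +-congˡ (sum<-telescope n (f ∘ suc)) ⟩
    (f 1 ⊝ f 0) ⊕ (f (suc n) ⊝ f 1)  ≈⟨ +-comm _ _ ⟩
    (f (suc n) ⊝ f 1) ⊕ (f 1 ⊝ f 0)  ≈⟨ +-assoc _ _ _ ⟩
    f (suc n) ⊕ (⊖ f 1 ⊕ (f 1 ⊝ f 0))  ≈⟨ +-congˡ (+-assoc _ _ _) ⟨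
    f (suc n) ⊕ ((⊖ f 1 ⊕ f 1) ⊝ f 0)  ≈⟨ +-congˡ (+-congʳ (-‿inverseˡ (f 1))) ⟩
    f (suc n) ⊕ (0# ⊝ f 0)             ≈⟨ +-congˡ (+-identityˡ _) ⟩
    f (suc n) ⊝ f 0                    ∎

  sum<-truncate : ∀ {m n} f → m ≤ n → (∀ i → m ≤ i → i < n → f i ≋ 0#) → sum< n f ≋ sum< m f
  sum<-truncate {n = n} f z≤n       h = sum<-zero n (λ i → h i z≤n)
  sum<-truncate         f (s≤s m≤n) h =
    +-congˡ (sum<-truncate (f ∘ suc) m≤n (λ i m≤i i<n → h (suc i) (s≤s m≤i) (s≤s i<n)))

-- Rational arithmetic and binomial coefficients

ℚ-ring : AlmostCommutativeRing 0ℓ 0ℓ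
ℚ-ring = fromCommutativeRing ℚ.+-*-commutativeRing (λ x → dec⇒maybe (0ℚ ℚ.≟ x))

fromℤ : ℤ → ℚ
fromℤ z = z ℚ./ 1

toℚᵘ-fromℤ : ∀ z → ℚ.toℚᵘ (fromℤ z) ℚᵘ.≃ mkℚᵘ z 0
toℚᵘ-fromℤ z = ℚ.toℚᵘ-fromℚᵘ (mkℚᵘ z 0)

fromℤ-+ : ∀ y z → fromℤ (y ℤ.+ z) ≡ fromℤ y ℚ.+ fromℤ z
fromℤ-+ y z = ℚ.toℚᵘ-injective (begin
  ℚ.toℚᵘ (fromℤ (y ℤ.+ z))                   ≈⟨ toℚᵘ-fromℤ (y ℤ.+ z) ⟩
  mkℚᵘ (y ℤ.+ z) 0
    ≈⟨ *≡* (cong (ℤ._* + 1) (cong₂ ℤ._+_ (ℤ.*-identityʳ y) (ℤ.*-identityʳ z))) ⟨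
  mkℚᵘ y 0 ℚᵘ.+ mkℚᵘ z 0                     ≈⟨ ℚᵘ.+-cong (toℚᵘ-fromℤ y) (toℚᵘ-fromℤ z) ⟨
  ℚ.toℚᵘ (fromℤ y) ℚᵘ.+ ℚ.toℚᵘ (fromℤ z)     ≈⟨ ℚ.toℚᵘ-homo-+ (fromℤ y) (fromℤ z) ⟨
  ℚ.toℚᵘ (fromℤ y ℚ.+ fromℤ z)               ∎)
  where open ℚᵘ.≃-Reasoning

fromℤ-* : ∀ y z → fromℤ (y ℤ.* z) ≡ fromℤ y ℚ.* fromℤ z
fromℤ-* y z = ℚ.toℚᵘ-injective (begin
  ℚ.toℚᵘ (fromℤ (y ℤ.* z))                   ≈⟨ toℚᵘ-fromℤ (y ℤ.* z) ⟩
  mkℚᵘ y 0 ℚᵘ.* mkℚᵘ z 0                     ≈⟨ ℚᵘ.*-cong (toℚᵘ-fromℤ y) (toℚᵘ-fromℤ z) ⟨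
  ℚ.toℚᵘ (fromℤ y) ℚᵘ.* ℚ.toℚᵘ (fromℤ z)     ≈⟨ ℚ.toℚᵘ-homo-* (fromℤ y) (fromℤ z) ⟨
  ℚ.toℚᵘ (fromℤ y ℚ.* fromℤ z)               ∎)
  where open ℚᵘ.≃-Reasoning

fromℤ-neg : ∀ z → fromℤ (ℤ.- z) ≡ ℚ.- fromℤ z
fromℤ-neg z = ℚ.toℚᵘ-injective (begin
  ℚ.toℚᵘ (fromℤ (ℤ.- z))   ≈⟨ toℚᵘ-fromℤ (ℤ.- z) ⟩
  ℚᵘ.- mkℚᵘ z 0            ≈⟨ ℚᵘ.-‿cong (toℚᵘ-fromℤ z) ⟨
  ℚᵘ.- ℚ.toℚᵘ (fromℤ z)    ≈⟨ ℚ.toℚᵘ-homo‿- (fromℤ z) ⟨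
  ℚ.toℚᵘ (ℚ.- fromℤ z)     ∎)
  where open ℚᵘ.≃-Reasoning

fromℤ-- : ∀ y z → fromℤ (y ℤ.- z) ≡ fromℤ y ℚ.- fromℤ z
fromℤ-- y z = trans (fromℤ-+ y (ℤ.- z)) (cong (fromℤ y ℚ.+_) (fromℤ-neg z))

fromℕ-+ : ∀ m n → fromℕ (m ℕ.+ n) ≡ fromℕ m ℚ.+ fromℕ n
fromℕ-+ m n = fromℤ-+ (+ m) (+ n)

fromℕ-* : ∀ m n → fromℕ (m ℕ.* n) ≡ fromℕ m ℚ.* fromℕ n
fromℕ-* m n = trans (cong fromℤ (ℤ.pos-* m n)) (fromℤ-* (+ m) (+ n))

fromℕ-suc : ∀ n → fromℕ (suc n) ≡ 1ℚ ℚ.+ fromℕ n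
fromℕ-suc n = fromℕ-+ 1 n

fromℕ-∸ : ∀ {m n} → n ≤ m → fromℕ (m ∸ n) ≡ fromℕ m ℚ.- fromℕ n
fromℕ-∸ {m} {n} n≤m = trans (cong fromℤ (sym (trans (ℤ.m-n≡m⊖n m n) (ℤ.⊖-≥ n≤m)))) (fromℤ-- (+ m) (+ n))

fromℕ-nonZero : ∀ n .{{_ : ℕ.NonZero n}} → ℚ.NonZero (fromℕ n)
fromℕ-nonZero n@(suc _) = ℚ.pos⇒nonZero (fromℕ n) {{ℚ.normalize-pos n 1}}

*-cancelˡ : ∀ p {q r} .{{_ : ℚ.NonZero p}} → p ℚ.* q ≡ p ℚ.* r → q ≡ r
*-cancelˡ p {q} {r} eq = begin
  q                        ≡⟨ undo q ⟨
  ℚ.1/ p ℚ.* (p ℚ.* q)     ≡⟨ cong (ℚ.1/ p ℚ.*_) eq ⟩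
  ℚ.1/ p ℚ.* (p ℚ.* r)     ≡⟨ undo r ⟩
  r                        ∎
  where
  open ≡-Reasoning
  undo : ∀ s → ℚ.1/ p ℚ.* (p ℚ.* s) ≡ s
  undo s = trans (sym (ℚ.*-assoc (ℚ.1/ p) p s)) (trans (cong (ℚ._* s) (ℚ.*-inverseˡ p)) (ℚ.*-identityˡ s))

fromℕ-cancelˡ : ∀ n .{{_ : ℕ.NonZero n}} {q r} → fromℕ n ℚ.* q ≡ fromℕ n ℚ.* r → q ≡ r
fromℕ-cancelˡ n = *-cancelˡ (fromℕ n) {{fromℕ-nonZero n}}

*-/-cancel : ∀ z n .{{_ : ℕ.NonZero n}} → fromℕ n ℚ.* (z ℚ./ n) ≡ fromℤ z
*-/-cancel z n@(suc n-1) = ℚ.toℚᵘ-injective (begin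
  ℚ.toℚᵘ (fromℕ n ℚ.* (z ℚ./ n))                 ≈⟨ ℚ.toℚᵘ-homo-* (fromℕ n) (z ℚ./ n) ⟩
  ℚ.toℚᵘ (fromℕ n) ℚᵘ.* ℚ.toℚᵘ (z ℚ./ n)         ≈⟨ ℚᵘ.*-cong (toℚᵘ-fromℤ (+ n)) (ℚ.toℚᵘ-fromℚᵘ (mkℚᵘ z n-1)) ⟩
  mkℚᵘ (+ n) 0 ℚᵘ.* mkℚᵘ z n-1                   ≈⟨ *≡* cross ⟩
  mkℚᵘ z 0                                       ≈⟨ toℚᵘ-fromℤ z ⟨
  ℚ.toℚᵘ (fromℤ z)                               ∎)
  where
  open ℚᵘ.≃-Reasoning
  cross : (+ n ℤ.* z) ℤ.* + 1 ≡ z ℤ.* + (1 ℕ.* n)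
  cross = trans (ℤ.*-identityʳ _) (trans (ℤ.*-comm (+ n) z) (cong (λ m → z ℤ.* + m) (sym (ℕ.*-identityˡ n))))

[k+1]*[n+1]C[k+1]≡[n+1]*nCk : ∀ n k → suc k ℕ.* (suc n C suc k) ≡ suc n ℕ.* (n C k)
[k+1]*[n+1]C[k+1]≡[n+1]*nCk zero    zero    = refl
[k+1]*[n+1]C[k+1]≡[n+1]*nCk zero    (suc k)
  rewrite k>n⇒nCk≡0 {1} {suc (suc k)} (s≤s (s≤s z≤n)) | k>n⇒nCk≡0 {0} {suc k} (s≤s z≤n) = ℕ.*-zeroʳ (suc (suc k))
[k+1]*[n+1]C[k+1]≡[n+1]*nCk (suc n) zero    =
  trans (ℕ.*-identityˡ _) (trans (nC1≡n (suc (suc n))) (sym (ℕ.*-identityʳ _)))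
[k+1]*[n+1]C[k+1]≡[n+1]*nCk (suc n) (suc k) = begin
  suc (suc k) ℕ.* (suc (suc n) C suc (suc k))
    ≡⟨ cong (suc (suc k) ℕ.*_) (nCk+nC[k+1]≡[n+1]C[k+1] (suc n) (suc k)) ⟨
  suc (suc k) ℕ.* (c ℕ.+ d)
    ≡⟨ expand k c d ⟩
  c ℕ.+ (suc k ℕ.* c ℕ.+ suc (suc k) ℕ.* d)
    ≡⟨ cong (c ℕ.+_) (cong₂ ℕ._+_ ([k+1]*[n+1]C[k+1]≡[n+1]*nCk n k) ([k+1]*[n+1]C[k+1]≡[n+1]*nCk n (suc k))) ⟩
  c ℕ.+ (suc n ℕ.* (n C k) ℕ.+ suc n ℕ.* (n C suc k))
    ≡⟨ cong (c ℕ.+_) (ℕ.*-distribˡ-+ (suc n) (n C k) (n C suc k)) ⟨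
  c ℕ.+ suc n ℕ.* (n C k ℕ.+ n C suc k)
    ≡⟨ cong (λ m → c ℕ.+ suc n ℕ.* m) (nCk+nC[k+1]≡[n+1]C[k+1] n k) ⟩
  suc (suc n) ℕ.* c ∎
  where
  open ≡-Reasoning
  c d : ℕ
  c = suc n C suc k
  d = suc n C suc (suc k)
  expand : ∀ k c d → suc (suc k) ℕ.* (c ℕ.+ d) ≡ c ℕ.+ (suc k ℕ.* c ℕ.+ suc (suc k) ℕ.* d)
  expand = ℕSolver.solve-∀

infix 9 _Cℚ_
_Cℚ_ : ℕ → ℕ → ℚ
n Cℚ k = fromℕ (n C k)

Cℚ-zero : ∀ {n k} → n < k → n Cℚ k ≡ 0ℚ
Cℚ-zero n<k = cong fromℕ (k>n⇒nCk≡0 n<k)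

Cℚ-diagonal : ∀ n → n Cℚ n ≡ 1ℚ
Cℚ-diagonal n = cong fromℕ (nCn≡1 n)

Cℚ-pascal : ∀ n k → suc n Cℚ suc k ≡ n Cℚ k ℚ.+ n Cℚ suc k
Cℚ-pascal n k = trans (cong fromℕ (sym (nCk+nC[k+1]≡[n+1]C[k+1] n k))) (fromℕ-+ (n C k) (n C suc k))

Cℚ-absorb : ∀ n k → fromℕ (suc k) ℚ.* suc n Cℚ suc k ≡ fromℕ (suc n) ℚ.* n Cℚ k
Cℚ-absorb n k = trans (sym (fromℕ-* (suc k) (suc n C suc k)))
  (trans (cong fromℕ ([k+1]*[n+1]C[k+1]≡[n+1]*nCk n k)) (fromℕ-* (suc n) (n C k)))

Cℚ-raise : ∀ n k → fromℕ (suc k) ℚ.* n Cℚ suc k ≡ (fromℕ n ℚ.- fromℕ k) ℚ.* n Cℚ k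
Cℚ-raise n k = begin
  fromℕ (suc k) ℚ.* d                                                    ≡⟨ split (fromℕ (suc k)) c d ⟩
  fromℕ (suc k) ℚ.* (c ℚ.+ d) ℚ.- fromℕ (suc k) ℚ.* c
    ≡⟨ cong (λ q → fromℕ (suc k) ℚ.* q ℚ.- fromℕ (suc k) ℚ.* c) (Cℚ-pascal n k) ⟨
  fromℕ (suc k) ℚ.* suc n Cℚ suc k ℚ.- fromℕ (suc k) ℚ.* c
    ≡⟨ cong (ℚ._- fromℕ (suc k) ℚ.* c) (Cℚ-absorb n k) ⟩
  fromℕ (suc n) ℚ.* c ℚ.- fromℕ (suc k) ℚ.* c
    ≡⟨ cong₂ (λ p q → p ℚ.* c ℚ.- q ℚ.* c) (fromℕ-suc n) (fromℕ-suc k) ⟩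
  (1ℚ ℚ.+ fromℕ n) ℚ.* c ℚ.- (1ℚ ℚ.+ fromℕ k) ℚ.* c                      ≡⟨ collect (fromℕ n) (fromℕ k) c ⟩
  (fromℕ n ℚ.- fromℕ k) ℚ.* c                                            ∎
  where
  open ≡-Reasoning
  c d : ℚ
  c = n Cℚ k
  d = n Cℚ suc k
  split : ∀ s c d → s ℚ.* d ≡ s ℚ.* (c ℚ.+ d) ℚ.- s ℚ.* c
  split = solve-∀ ℚ-ring
  collect : ∀ n k c → (1ℚ ℚ.+ n) ℚ.* c ℚ.- (1ℚ ℚ.+ k) ℚ.* c ≡ (n ℚ.- k) ℚ.* c
  collect = solve-∀ ℚ-ring

Cℚ-lower : ∀ n k → fromℕ n ℚ.* (n ∸ 1) Cℚ k ≡ (fromℕ n ℚ.- fromℕ k) ℚ.* n Cℚ k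
Cℚ-lower zero    zero    = refl
Cℚ-lower zero    (suc k) rewrite k>n⇒nCk≡0 {0} {suc k} (s≤s z≤n) = sym (ℚ.*-zeroʳ (fromℕ 0 ℚ.- fromℕ (suc k)))
Cℚ-lower (suc n) zero    = cong (ℚ._* 1ℚ) (sym (ℚ.+-identityʳ (fromℕ (suc n))))
Cℚ-lower (suc n) (suc k) = begin
  fromℕ (suc n) ℚ.* d                                              ≡⟨ split (fromℕ (suc n)) c d ⟩
  fromℕ (suc n) ℚ.* (c ℚ.+ d) ℚ.- fromℕ (suc n) ℚ.* c
    ≡⟨ cong₂ (λ p q → fromℕ (suc n) ℚ.* p ℚ.- q) (sym (Cℚ-pascal n k)) (sym (Cℚ-absorb n k)) ⟩
  fromℕ (suc n) ℚ.* e ℚ.- fromℕ (suc k) ℚ.* e                      ≡⟨ collect (fromℕ (suc n)) (fromℕ (suc k)) e ⟩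
  (fromℕ (suc n) ℚ.- fromℕ (suc k)) ℚ.* e                          ∎
  where
  open ≡-Reasoning
  c d e : ℚ
  c = n Cℚ k
  d = n Cℚ suc k
  e = suc n Cℚ suc k
  split : ∀ s c d → s ℚ.* d ≡ s ℚ.* (c ℚ.+ d) ℚ.- s ℚ.* c
  split = solve-∀ ℚ-ring
  collect : ∀ n k c → n ℚ.* c ℚ.- k ℚ.* c ≡ (n ℚ.- k) ℚ.* c
  collect = solve-∀ ℚ-ring

-- The polynomial identities behind I and J

module ℚ∑ = FiniteSums ℚ.+-*-commutativeRing

∏ℤ-last : ∀ n f → ∏ℤ (suc n) f ≡ ∏ℤ n f ℤ.* f n
∏ℤ-last zero    f = ℤ.*-comm (f 0) (+ 1)
∏ℤ-last (suc n) f = trans (cong (f 0 ℤ.*_) (∏ℤ-last n (f ∘ suc))) (sym (ℤ.*-assoc (f 0) _ _))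

𝟙-yes : ∀ {A : Set} (d : Dec A) → A → 𝟙 d ≡ 1ℚ
𝟙-yes (yes _) _ = refl
𝟙-yes (no ¬a) a = contradiction a ¬a

𝟙-no : ∀ {A : Set} (d : Dec A) → ¬ A → 𝟙 d ≡ 0ℚ
𝟙-no (yes a) ¬a = contradiction a ¬a
𝟙-no (no _)  _  = refl

descend : ∀ n (u v : ℕ → ℚ) (w : ℕ → ℕ) (z : ℕ → ℚ) →
          (∀ q → q < n → 0 < w q) →
          (∀ q → q < n → z q ℚ.* u (suc q) ≡ fromℕ (w q) ℚ.* u q) →
          (∀ q → q < n → z q ℚ.* v (suc q) ≡ fromℕ (w q) ℚ.* v q) →
          u n ≡ v n → ∀ q → q ≤ n → u q ≡ v q
descend zero    u v w z w>0 hu hv top zero z≤n = top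
descend (suc n) u v w z w>0 hu hv top      = go
  where
  rest : ∀ q → q ≤ n → u (suc q) ≡ v (suc q)
  rest = descend n (u ∘ suc) (v ∘ suc) (w ∘ suc) (z ∘ suc) (λ q → w>0 (suc q) ∘ s≤s)
                 (λ q → hu (suc q) ∘ s≤s) (λ q → hv (suc q) ∘ s≤s) top
  go : ∀ q → q ≤ suc n → u q ≡ v q
  go (suc q) (s≤s q≤n) = rest q q≤n
  go zero    z≤n       = fromℕ-cancelˡ (w 0) {{ℕ.>-nonZero (w>0 0 (s≤s z≤n))}}
    (trans (sym (hu 0 (s≤s z≤n))) (trans (cong (z 0 ℚ.*_) (rest 0 z≤n)) (hv 0 (s≤s z≤n))))

I-raise : ∀ b s q → (fromℕ (suc q) ℚ.* fromℕ (suc q)) ℚ.* I b (b ℕ.+ suc s) (suc q) ≡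
          (fromℕ (suc (s ℕ.+ q)) ℚ.* (fromℕ (b ℕ.+ (b ℕ.+ suc s)) ℚ.- fromℕ q)) ℚ.* I b (b ℕ.+ suc s) q
I-raise b s q = fromℕ-cancelˡ (q ! ℕ.* q !) {{ℕ._!*_!≢0 q q}} (begin
  fromℕ (q ! ℕ.* q !) ℚ.* ((S ℚ.* S) ℚ.* I′)        ≡⟨ cong (ℚ._* ((S ℚ.* S) ℚ.* I′)) (fromℕ-* (q !) (q !)) ⟩
  (F ℚ.* F) ℚ.* ((S ℚ.* S) ℚ.* I′)                  ≡⟨ regroup F S I′ ⟩
  ((S ℚ.* F) ℚ.* (S ℚ.* F)) ℚ.* I′
    ≡⟨ cong (ℚ._* I′) (trans (fromℕ-* (suc q !) (suc q !)) (cong (λ x → x ℚ.* x) (fromℕ-* (suc q) (q !)))) ⟨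
  fromℕ (suc q ! ℕ.* suc q !) ℚ.* I′
    ≡⟨ *-/-cancel (∏ℤ (suc q) t) (suc q ! ℕ.* suc q !) {{ℕ._!*_!≢0 (suc q) (suc q)}} ⟩
  fromℤ (∏ℤ (suc q) t)                              ≡⟨ cong fromℤ (∏ℤ-last q t) ⟩
  fromℤ (∏ℤ q t ℤ.* t q)                            ≡⟨ fromℤ-* (∏ℤ q t) (t q) ⟩
  fromℤ (∏ℤ q t) ℚ.* fromℤ (t q)
    ≡⟨ cong₂ ℚ._*_ (sym (*-/-cancel (∏ℤ q t) (q ! ℕ.* q !) {{ℕ._!*_!≢0 q q}})) factor ⟩
  (fromℕ (q ! ℕ.* q !) ℚ.* I₀) ℚ.* W                ≡⟨ swap (fromℕ (q ! ℕ.* q !)) I₀ W ⟩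
  fromℕ (q ! ℕ.* q !) ℚ.* (W ℚ.* I₀)                ∎)
  where
  open ≡-Reasoning
  S F I′ I₀ W : ℚ
  S = fromℕ (suc q)
  F = fromℕ (q !)
  I′ = I b (b ℕ.+ suc s) (suc q)
  I₀ = I b (b ℕ.+ suc s) q
  W = fromℕ (suc (s ℕ.+ q)) ℚ.* (fromℕ (b ℕ.+ (b ℕ.+ suc s)) ℚ.- fromℕ q)
  t : ℕ → ℤ
  t m = (+ (b ℕ.+ suc s)) ℤ.^ 2 ℤ.- (+ b ℤ.- + m) ℤ.^ 2
  square : ∀ z → fromℤ (z ℤ.^ 2) ≡ fromℤ z ℚ.* fromℤ z
  square z = trans (cong (λ y → fromℤ (z ℤ.* y)) (ℤ.*-identityʳ z)) (fromℤ-* z z)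
  regroup : ∀ f s i → (f ℚ.* f) ℚ.* ((s ℚ.* s) ℚ.* i) ≡ ((s ℚ.* f) ℚ.* (s ℚ.* f)) ℚ.* i
  regroup = solve-∀ ℚ-ring
  swap : ∀ f i w → (f ℚ.* i) ℚ.* w ≡ f ℚ.* (w ℚ.* i)
  swap = solve-∀ ℚ-ring
  expand : ∀ b s q → (b ℚ.+ (1ℚ ℚ.+ s)) ℚ.* (b ℚ.+ (1ℚ ℚ.+ s)) ℚ.- (b ℚ.- q) ℚ.* (b ℚ.- q) ≡
           (1ℚ ℚ.+ (s ℚ.+ q)) ℚ.* ((b ℚ.+ (b ℚ.+ (1ℚ ℚ.+ s))) ℚ.- q)
  expand = solve-∀ ℚ-ring
  ℓ-cast : fromℕ (b ℕ.+ suc s) ≡ fromℕ b ℚ.+ (1ℚ ℚ.+ fromℕ s)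
  ℓ-cast = trans (fromℕ-+ b (suc s)) (cong (fromℕ b ℚ.+_) (fromℕ-suc s))
  factor : fromℤ (t q) ≡ W
  factor = begin
    fromℤ (t q)
      ≡⟨ fromℤ-- ((+ (b ℕ.+ suc s)) ℤ.^ 2) ((+ b ℤ.- + q) ℤ.^ 2) ⟩
    fromℤ ((+ (b ℕ.+ suc s)) ℤ.^ 2) ℚ.- fromℤ ((+ b ℤ.- + q) ℤ.^ 2)
      ≡⟨ cong₂ ℚ._-_ (trans (square (+ (b ℕ.+ suc s))) (cong (λ x → x ℚ.* x) ℓ-cast))
                     (trans (square (+ b ℤ.- + q)) (cong (λ x → x ℚ.* x) (fromℤ-- (+ b) (+ q)))) ⟩
    _
      ≡⟨ expand (fromℕ b) (fromℕ s) (fromℕ q) ⟩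
    (1ℚ ℚ.+ (fromℕ s ℚ.+ fromℕ q)) ℚ.* ((fromℕ b ℚ.+ (fromℕ b ℚ.+ (1ℚ ℚ.+ fromℕ s))) ℚ.- fromℕ q)
      ≡⟨ cong₂ (λ x y → x ℚ.* (y ℚ.- fromℕ q))
               (trans (fromℕ-suc (s ℕ.+ q)) (cong (1ℚ ℚ.+_) (fromℕ-+ s q)))
               (trans (fromℕ-+ b (b ℕ.+ suc s)) (cong (fromℕ b ℚ.+_) ℓ-cast)) ⟨
    W ∎

I-binomial : ∀ b s q → I b (b ℕ.+ suc s) q ≡ (s ℕ.+ q) Cℚ q ℚ.* (b ℕ.+ (b ℕ.+ suc s)) Cℚ q
I-binomial b s zero    = refl
I-binomial b s (suc q) = fromℕ-cancelˡ (suc q) (fromℕ-cancelˡ (suc q) (begin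
  S ℚ.* (S ℚ.* I b (b ℕ.+ suc s) (suc q))                   ≡⟨ ℚ.*-assoc S S _ ⟨
  (S ℚ.* S) ℚ.* I b (b ℕ.+ suc s) (suc q)                   ≡⟨ I-raise b s q ⟩
  (fromℕ (suc (s ℕ.+ q)) ℚ.* D) ℚ.* I b (b ℕ.+ suc s) q
    ≡⟨ cong ((fromℕ (suc (s ℕ.+ q)) ℚ.* D) ℚ.*_) (I-binomial b s q) ⟩
  (fromℕ (suc (s ℕ.+ q)) ℚ.* D) ℚ.* ((s ℕ.+ q) Cℚ q ℚ.* Q Cℚ q)
    ≡⟨ regroup (fromℕ (suc (s ℕ.+ q))) D _ _ ⟩
  (fromℕ (suc (s ℕ.+ q)) ℚ.* (s ℕ.+ q) Cℚ q) ℚ.* (D ℚ.* Q Cℚ q)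
    ≡⟨ cong₂ ℚ._*_ (Cℚ-absorb (s ℕ.+ q) q) (Cℚ-raise Q q) ⟨
  (S ℚ.* suc (s ℕ.+ q) Cℚ suc q) ℚ.* (S ℚ.* Q Cℚ suc q)
    ≡⟨ cong (λ m → (S ℚ.* m Cℚ suc q) ℚ.* (S ℚ.* Q Cℚ suc q)) (ℕ.+-suc s q) ⟨
  (S ℚ.* (s ℕ.+ suc q) Cℚ suc q) ℚ.* (S ℚ.* Q Cℚ suc q)
    ≡⟨ regroup′ S _ _ ⟩
  S ℚ.* (S ℚ.* ((s ℕ.+ suc q) Cℚ suc q ℚ.* Q Cℚ suc q))     ∎))
  where
  open ≡-Reasoning
  Q : ℕ
  Q = b ℕ.+ (b ℕ.+ suc s)
  S D : ℚ
  S = fromℕ (suc q)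
  D = fromℕ Q ℚ.- fromℕ q
  regroup : ∀ x d c e → (x ℚ.* d) ℚ.* (c ℚ.* e) ≡ (x ℚ.* c) ℚ.* (d ℚ.* e)
  regroup = solve-∀ ℚ-ring
  regroup′ : ∀ s c d → (s ℚ.* c) ℚ.* (s ℚ.* d) ≡ s ℚ.* (s ℚ.* (c ℚ.* d))
  regroup′ = solve-∀ ℚ-ring

B-below : ∀ b s i → s < i → B b (b ℕ.+ s) (b ℕ.+ i) ≡ 0ℚ
B-below b s i s<i = begin
  B b (b ℕ.+ s) (b ℕ.+ i)  ≡⟨ cong₂ (λ x y → x ℚ.+ K ℚ.* y)
    (𝟙-no ((b ℕ.+ s ℕ.≟ b ℕ.+ i) ×-dec (b ℕ.+ i ℕ.≟ b)) (λ { (p≡ℓ , _) → ℕ.<⇒≢ p<ℓ p≡ℓ }))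
    (𝟙-no ((b ℕ.+ i ℕ.≤? b ℕ.+ s) ×-dec (b ℕ.<? b ℕ.+ i)) (λ { (ℓ≤p , _) → ℕ.<⇒≱ p<ℓ ℓ≤p })) ⟩
  0ℚ ℚ.+ K ℚ.* 0ℚ          ≡⟨ trans (ℚ.+-identityˡ (K ℚ.* 0ℚ)) (ℚ.*-zeroʳ K) ⟩
  0ℚ                       ∎
  where
  open ≡-Reasoning
  K : ℚ
  K = sign (b ℕ.+ s ∸ (b ℕ.+ i)) ℚ.* fromℕ ((b ℕ.+ s ℕ.+ (b ℕ.+ i) ∸ 1) C (b ℕ.+ s ∸ (b ℕ.+ i)))
  p<ℓ : b ℕ.+ s < b ℕ.+ i
  p<ℓ = ℕ.+-monoʳ-< b s<i

B-base : ∀ b s → B b (b ℕ.+ suc s) b ≡ 0ℚ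
B-base b s = begin
  B b (b ℕ.+ suc s) b      ≡⟨ cong₂ (λ x y → x ℚ.+ K ℚ.* y)
    (𝟙-no ((b ℕ.+ suc s ℕ.≟ b) ×-dec (b ℕ.≟ b)) (λ { (p≡ℓ , _) → ℕ.m+1+n≢m b p≡ℓ }))
    (𝟙-no ((b ℕ.≤? b ℕ.+ suc s) ×-dec (b ℕ.<? b)) (λ { (_ , b<b) → ℕ.<-irrefl refl b<b })) ⟩
  0ℚ ℚ.+ K ℚ.* 0ℚ          ≡⟨ trans (ℚ.+-identityˡ (K ℚ.* 0ℚ)) (ℚ.*-zeroʳ K) ⟩
  0ℚ                       ∎
  where
  open ≡-Reasoning
  K : ℚ
  K = sign (b ℕ.+ suc s ∸ b) ℚ.* fromℕ ((b ℕ.+ suc s ℕ.+ b ∸ 1) C (b ℕ.+ suc s ∸ b))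

B-corner : ∀ b → B b b b ≡ 1ℚ
B-corner b = begin
  B b b b                  ≡⟨ cong₂ (λ x y → x ℚ.+ K ℚ.* y)
    (𝟙-yes ((b ℕ.≟ b) ×-dec (b ℕ.≟ b)) (refl , refl))
    (𝟙-no ((b ℕ.≤? b) ×-dec (b ℕ.<? b)) (λ { (_ , b<b) → ℕ.<-irrefl refl b<b })) ⟩
  1ℚ ℚ.+ K ℚ.* 0ℚ          ≡⟨ trans (cong (1ℚ ℚ.+_) (ℚ.*-zeroʳ K)) (ℚ.+-identityʳ 1ℚ) ⟩
  1ℚ                       ∎
  where
  open ≡-Reasoning
  K : ℚ
  K = sign (b ∸ b) ℚ.* fromℕ ((b ℕ.+ b ∸ 1) C (b ∸ b))

B-above : ∀ b i t → let m = b ℕ.+ i in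
          B b (b ℕ.+ suc (i ℕ.+ t)) (b ℕ.+ suc i) ≡ sign t ℚ.* (suc (m ℕ.+ m) ℕ.+ t) Cℚ t
B-above b i t = begin
  B b p ℓ
    ≡⟨ cong₂ (λ x y → x ℚ.+ sign (p ∸ ℓ) ℚ.* (p ℕ.+ ℓ ∸ 1) Cℚ (p ∸ ℓ) ℚ.* y)
        (𝟙-no ((p ℕ.≟ ℓ) ×-dec (ℓ ℕ.≟ b)) (λ { (_ , ℓ≡b) → ℕ.m+1+n≢m b ℓ≡b }))
        (𝟙-yes ((ℓ ℕ.≤? p) ×-dec (b ℕ.<? ℓ)) (ℕ.+-monoʳ-≤ b (s≤s (ℕ.m≤m+n i t)) , ℕ.m<m+n b (s≤s z≤n))) ⟩
  0ℚ ℚ.+ sign (p ∸ ℓ) ℚ.* (p ℕ.+ ℓ ∸ 1) Cℚ (p ∸ ℓ) ℚ.* 1ℚ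
    ≡⟨ trans (ℚ.+-identityˡ _) (ℚ.*-identityʳ _) ⟩
  sign (p ∸ ℓ) ℚ.* (p ℕ.+ ℓ ∸ 1) Cℚ (p ∸ ℓ)
    ≡⟨ cong₂ (λ x y → sign x ℚ.* y Cℚ x)
         (trans (ℕ.[m+n]∸[m+o]≡n∸o b (suc (i ℕ.+ t)) (suc i)) (ℕ.m+n∸m≡n i t))
         (cong (_∸ 1) (top b i t)) ⟩
  sign t ℚ.* (suc (m ℕ.+ m) ℕ.+ t) Cℚ t ∎
  where
  open ≡-Reasoning
  m p ℓ : ℕ
  m = b ℕ.+ i
  p = b ℕ.+ suc (i ℕ.+ t)
  ℓ = b ℕ.+ suc i
  top : ∀ b i t → (b ℕ.+ suc (i ℕ.+ t)) ℕ.+ (b ℕ.+ suc i) ≡ suc (suc ((b ℕ.+ i) ℕ.+ (b ℕ.+ i)) ℕ.+ t)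
  top = ℕSolver.solve-∀

B-raise : ∀ b i t → let M = suc (suc ((b ℕ.+ i) ℕ.+ (b ℕ.+ i))) ; p = b ℕ.+ suc (i ℕ.+ suc t) in
  (fromℕ (suc M) ℚ.* fromℕ M) ℚ.* B b p (b ℕ.+ suc (suc i))
  ≡ ℚ.- (fromℕ (suc t) ℚ.* fromℕ (suc (M ℕ.+ t))) ℚ.* B b p (b ℕ.+ suc i)
B-raise b i t = begin
  (fromℕ (suc M) ℚ.* fromℕ M) ℚ.* B b p (b ℕ.+ suc (suc i))
    ≡⟨ cong ((fromℕ (suc M) ℚ.* fromℕ M) ℚ.*_) lower-B ⟩
  (fromℕ (suc M) ℚ.* fromℕ M) ℚ.* (sign t ℚ.* suc (M ℕ.+ t) Cℚ t)
    ≡⟨ regroup (fromℕ (suc M)) (fromℕ M) (sign t) _ ⟩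
  (sign t ℚ.* fromℕ M) ℚ.* (fromℕ (suc M) ℚ.* suc (M ℕ.+ t) Cℚ t)
    ≡⟨ cong₂ (λ x y → (sign t ℚ.* x) ℚ.* (y ℚ.* suc (M ℕ.+ t) Cℚ t)) (remove M t) (remove (suc M) t) ⟩
  (sign t ℚ.* (fromℕ (M ℕ.+ t) ℚ.- fromℕ t)) ℚ.* ((fromℕ (suc (M ℕ.+ t)) ℚ.- fromℕ t) ℚ.* suc (M ℕ.+ t) Cℚ t)
    ≡⟨ cong ((sign t ℚ.* (fromℕ (M ℕ.+ t) ℚ.- fromℕ t)) ℚ.*_) (Cℚ-lower (suc (M ℕ.+ t)) t) ⟨
  (sign t ℚ.* (fromℕ (M ℕ.+ t) ℚ.- fromℕ t)) ℚ.* (fromℕ (suc (M ℕ.+ t)) ℚ.* (M ℕ.+ t) Cℚ t)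
    ≡⟨ regroup′ (sign t) (fromℕ (M ℕ.+ t) ℚ.- fromℕ t) (fromℕ (suc (M ℕ.+ t))) _ ⟩
  (sign t ℚ.* fromℕ (suc (M ℕ.+ t))) ℚ.* ((fromℕ (M ℕ.+ t) ℚ.- fromℕ t) ℚ.* (M ℕ.+ t) Cℚ t)
    ≡⟨ cong ((sign t ℚ.* fromℕ (suc (M ℕ.+ t))) ℚ.*_) (Cℚ-raise (M ℕ.+ t) t) ⟨
  (sign t ℚ.* fromℕ (suc (M ℕ.+ t))) ℚ.* (fromℕ (suc t) ℚ.* (M ℕ.+ t) Cℚ suc t)
    ≡⟨ regroup″ (sign t) (fromℕ (suc (M ℕ.+ t))) (fromℕ (suc t)) _ ⟩
  W ℚ.* (sign (suc t) ℚ.* (M ℕ.+ t) Cℚ suc t)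
    ≡⟨ cong (λ n → W ℚ.* (sign (suc t) ℚ.* n Cℚ suc t)) (ℕ.+-suc (suc ((b ℕ.+ i) ℕ.+ (b ℕ.+ i))) t) ⟨
  W ℚ.* (sign (suc t) ℚ.* (suc ((b ℕ.+ i) ℕ.+ (b ℕ.+ i)) ℕ.+ suc t) Cℚ suc t)
    ≡⟨ cong (W ℚ.*_) (B-above b i (suc t)) ⟨
  W ℚ.* B b p (b ℕ.+ suc i) ∎
  where
  open ≡-Reasoning
  M p : ℕ
  M = suc (suc ((b ℕ.+ i) ℕ.+ (b ℕ.+ i)))
  p = b ℕ.+ suc (i ℕ.+ suc t)
  W : ℚ
  W = ℚ.- (fromℕ (suc t) ℚ.* fromℕ (suc (M ℕ.+ t)))
  top : ∀ b i t → suc ((b ℕ.+ suc i) ℕ.+ (b ℕ.+ suc i)) ℕ.+ t ≡ suc (suc (suc ((b ℕ.+ i) ℕ.+ (b ℕ.+ i))) ℕ.+ t)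
  top = ℕSolver.solve-∀
  lower-B : B b p (b ℕ.+ suc (suc i)) ≡ sign t ℚ.* suc (M ℕ.+ t) Cℚ t
  lower-B = trans (cong (λ n → B b (b ℕ.+ suc n) (b ℕ.+ suc (suc i))) (ℕ.+-suc i t))
    (trans (B-above b (suc i) t) (cong (λ n → sign t ℚ.* n Cℚ t) (top b i t)))
  cancel : ∀ x y → x ≡ x ℚ.+ y ℚ.- y
  cancel = solve-∀ ℚ-ring
  remove : ∀ m n → fromℕ m ≡ fromℕ (m ℕ.+ n) ℚ.- fromℕ n
  remove m n = trans (cancel (fromℕ m) (fromℕ n)) (cong (ℚ._- fromℕ n) (sym (fromℕ-+ m n)))
  regroup : ∀ g h s c → (g ℚ.* h) ℚ.* (s ℚ.* c) ≡ (s ℚ.* h) ℚ.* (g ℚ.* c)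
  regroup = solve-∀ ℚ-ring
  regroup′ : ∀ s d g c → (s ℚ.* d) ℚ.* (g ℚ.* c) ≡ (s ℚ.* g) ℚ.* (d ℚ.* c)
  regroup′ = solve-∀ ℚ-ring
  regroup″ : ∀ s g t c → (s ℚ.* g) ℚ.* (t ℚ.* c) ≡ ℚ.- (t ℚ.* g) ℚ.* ((ℚ.- 1ℚ ℚ.* s) ℚ.* c)
  regroup″ = solve-∀ ℚ-ring

-- The coefficient of x_j in Z, for j = b + 1 + i.
Z-coeff : (b i : ℕ) → ℚ
Z-coeff b i = let j = b ℕ.+ suc i in (2 ℕ.* j ∸ 1) Cℚ (j ℕ.+ b)

Z-coeff-raise : ∀ b i → let M = suc (suc ((b ℕ.+ i) ℕ.+ (b ℕ.+ i))) in
  (fromℕ (suc (b ℕ.+ (b ℕ.+ suc i))) ℚ.* fromℕ (suc i)) ℚ.* Z-coeff b (suc i)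
  ≡ (fromℕ (suc M) ℚ.* fromℕ M) ℚ.* Z-coeff b i
Z-coeff-raise b i = begin
  (fromℕ (suc (b ℕ.+ (b ℕ.+ suc i))) ℚ.* fromℕ (suc i)) ℚ.* Z-coeff b (suc i)
    ≡⟨ cong ((fromℕ (suc K) ℚ.* fromℕ (suc i)) ℚ.*_) (cong₂ _Cℚ_ (cong (_∸ 1) (top b i)) (bottom b i)) ⟩
  (fromℕ (suc K) ℚ.* fromℕ (suc i)) ℚ.* suc M Cℚ suc K
    ≡⟨ regroup (fromℕ (suc K)) (fromℕ (suc i)) _ ⟩
  fromℕ (suc i) ℚ.* (fromℕ (suc K) ℚ.* suc M Cℚ suc K)
    ≡⟨ cong (fromℕ (suc i) ℚ.*_) (Cℚ-absorb M K) ⟩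
  fromℕ (suc i) ℚ.* (fromℕ (suc M) ℚ.* M Cℚ K)
    ≡⟨ regroup′ (fromℕ (suc i)) (fromℕ (suc M)) _ ⟩
  fromℕ (suc M) ℚ.* (fromℕ (suc i) ℚ.* M Cℚ K)
    ≡⟨ cong (λ x → fromℕ (suc M) ℚ.* (x ℚ.* M Cℚ K)) i+1 ⟩
  fromℕ (suc M) ℚ.* ((fromℕ M ℚ.- fromℕ K) ℚ.* M Cℚ K)
    ≡⟨ cong (fromℕ (suc M) ℚ.*_) (Cℚ-lower M K) ⟨
  fromℕ (suc M) ℚ.* (fromℕ M ℚ.* (M ∸ 1) Cℚ K)
    ≡⟨ ℚ.*-assoc (fromℕ (suc M)) (fromℕ M) _ ⟨
  (fromℕ (suc M) ℚ.* fromℕ M) ℚ.* (M ∸ 1) Cℚ K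
    ≡⟨ cong ((fromℕ (suc M) ℚ.* fromℕ M) ℚ.*_) (cong₂ _Cℚ_ (cong (_∸ 1) (top₁ b i)) (ℕ.+-comm (b ℕ.+ suc i) b)) ⟨
  (fromℕ (suc M) ℚ.* fromℕ M) ℚ.* Z-coeff b i ∎
  where
  open ≡-Reasoning
  M K : ℕ
  M = suc (suc ((b ℕ.+ i) ℕ.+ (b ℕ.+ i)))
  K = b ℕ.+ (b ℕ.+ suc i)
  regroup : ∀ k i c → (k ℚ.* i) ℚ.* c ≡ i ℚ.* (k ℚ.* c)
  regroup = solve-∀ ℚ-ring
  regroup′ : ∀ i m c → i ℚ.* (m ℚ.* c) ≡ m ℚ.* (i ℚ.* c)
  regroup′ = solve-∀ ℚ-ring
  cancel : ∀ x y → x ≡ (x ℚ.+ y) ℚ.- y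
  cancel = solve-∀ ℚ-ring
  top : ∀ b i → 2 ℕ.* (b ℕ.+ suc (suc i)) ≡ suc (suc (suc (suc ((b ℕ.+ i) ℕ.+ (b ℕ.+ i)))))
  top = ℕSolver.solve-∀
  top₁ : ∀ b i → 2 ℕ.* (b ℕ.+ suc i) ≡ suc (suc ((b ℕ.+ i) ℕ.+ (b ℕ.+ i)))
  top₁ = ℕSolver.solve-∀
  bottom : ∀ b i → (b ℕ.+ suc (suc i)) ℕ.+ b ≡ suc (b ℕ.+ (b ℕ.+ suc i))
  bottom = ℕSolver.solve-∀
  difference : ∀ b i → suc i ℕ.+ (b ℕ.+ (b ℕ.+ suc i)) ≡ suc (suc ((b ℕ.+ i) ℕ.+ (b ℕ.+ i)))
  difference = ℕSolver.solve-∀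
  i+1 : fromℕ (suc i) ≡ fromℕ M ℚ.- fromℕ K
  i+1 = trans (cancel (fromℕ (suc i)) (fromℕ K))
    (cong (ℚ._- fromℕ K) (trans (sym (fromℕ-+ (suc i) K)) (cong fromℕ (difference b i))))

Z-coeff*B-raise-+ : ∀ b i t → let s = i ℕ.+ t ; ℓ = fromℕ (b ℕ.+ suc i) ; p = fromℕ (b ℕ.+ suc s) in
  (fromℕ (suc (b ℕ.+ (b ℕ.+ suc i))) ℚ.* fromℕ (suc i)) ℚ.* (Z-coeff b (suc i) ℚ.* B b (b ℕ.+ suc s) (b ℕ.+ suc (suc i)))
  ≡ (ℓ ℚ.* ℓ ℚ.- p ℚ.* p) ℚ.* (Z-coeff b i ℚ.* B b (b ℕ.+ suc s) (b ℕ.+ suc i))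
Z-coeff*B-raise-+ b i zero = begin
  N ℚ.* (Z-coeff b (suc i) ℚ.* B b p (b ℕ.+ suc (suc i)))  ≡⟨ cong (λ x → N ℚ.* (Z-coeff b (suc i) ℚ.* x))
                                                               (B-below b (suc (i ℕ.+ 0)) (suc (suc i)) (s≤s (s≤s (ℕ.≤-reflexive (ℕ.+-identityʳ i))))) ⟩
  N ℚ.* (Z-coeff b (suc i) ℚ.* 0ℚ)                         ≡⟨ vanish N (Z-coeff b (suc i)) (fromℕ ℓ) _ ⟩
  (fromℕ ℓ ℚ.* fromℕ ℓ ℚ.- fromℕ ℓ ℚ.* fromℕ ℓ) ℚ.* c
    ≡⟨ cong (λ x → (fromℕ ℓ ℚ.* fromℕ ℓ ℚ.- fromℕ x ℚ.* fromℕ x) ℚ.* c)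
                                                               (cong (λ n → b ℕ.+ suc n) (ℕ.+-identityʳ i)) ⟨
  (fromℕ ℓ ℚ.* fromℕ ℓ ℚ.- fromℕ p ℚ.* fromℕ p) ℚ.* c      ∎
  where
  open ≡-Reasoning
  ℓ p : ℕ
  ℓ = b ℕ.+ suc i
  p = b ℕ.+ suc (i ℕ.+ 0)
  N c : ℚ
  N = fromℕ (suc (b ℕ.+ (b ℕ.+ suc i))) ℚ.* fromℕ (suc i)
  c = Z-coeff b i ℚ.* B b p ℓ
  vanish : ∀ n z l c → n ℚ.* (z ℚ.* 0ℚ) ≡ (l ℚ.* l ℚ.- l ℚ.* l) ℚ.* c
  vanish = solve-∀ ℚ-ring
Z-coeff*B-raise-+ b i (suc t) = begin
  N ℚ.* (Z-coeff b (suc i) ℚ.* B₁)                  ≡⟨ ℚ.*-assoc N (Z-coeff b (suc i)) B₁ ⟨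
  (N ℚ.* Z-coeff b (suc i)) ℚ.* B₁                  ≡⟨ cong (ℚ._* B₁) (Z-coeff-raise b i) ⟩
  (H ℚ.* Z-coeff b i) ℚ.* B₁                        ≡⟨ regroup H (Z-coeff b i) B₁ ⟩
  Z-coeff b i ℚ.* (H ℚ.* B₁)                        ≡⟨ cong (Z-coeff b i ℚ.*_) (B-raise b i t) ⟩
  Z-coeff b i ℚ.* (W ℚ.* B₀)                        ≡⟨ cong (λ w → Z-coeff b i ℚ.* (w ℚ.* B₀)) factor ⟩
  Z-coeff b i ℚ.* (D ℚ.* B₀)                        ≡⟨ regroup′ (Z-coeff b i) D B₀ ⟩
  D ℚ.* (Z-coeff b i ℚ.* B₀)                        ∎
  where
  open ≡-Reasoning
  M ℓ p : ℕ
  M = suc (suc ((b ℕ.+ i) ℕ.+ (b ℕ.+ i)))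
  ℓ = b ℕ.+ suc i
  p = b ℕ.+ suc (i ℕ.+ suc t)
  N H W D B₀ B₁ : ℚ
  N = fromℕ (suc (b ℕ.+ (b ℕ.+ suc i))) ℚ.* fromℕ (suc i)
  H = fromℕ (suc M) ℚ.* fromℕ M
  W = ℚ.- (fromℕ (suc t) ℚ.* fromℕ (suc (M ℕ.+ t)))
  D = fromℕ ℓ ℚ.* fromℕ ℓ ℚ.- fromℕ p ℚ.* fromℕ p
  B₀ = B b p (b ℕ.+ suc i)
  B₁ = B b p (b ℕ.+ suc (suc i))
  regroup : ∀ h z b → (h ℚ.* z) ℚ.* b ≡ z ℚ.* (h ℚ.* b)
  regroup = solve-∀ ℚ-ring
  regroup′ : ∀ z d b → z ℚ.* (d ℚ.* b) ≡ d ℚ.* (z ℚ.* b)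
  regroup′ = solve-∀ ℚ-ring
  p-split : ∀ b i t → b ℕ.+ suc (i ℕ.+ suc t) ≡ (b ℕ.+ suc i) ℕ.+ suc t
  p-split = ℕSolver.solve-∀
  sum-split : ∀ b i t → suc (suc (suc ((b ℕ.+ i) ℕ.+ (b ℕ.+ i))) ℕ.+ t) ≡ ((b ℕ.+ suc i) ℕ.+ (b ℕ.+ suc i)) ℕ.+ suc t
  sum-split = ℕSolver.solve-∀
  squares : ∀ l t → ℚ.- (t ℚ.* ((l ℚ.+ l) ℚ.+ t)) ≡ l ℚ.* l ℚ.- (l ℚ.+ t) ℚ.* (l ℚ.+ t)
  squares = solve-∀ ℚ-ring
  factor : W ≡ D
  factor = begin
    W
      ≡⟨ cong (λ x → ℚ.- (fromℕ (suc t) ℚ.* x)) (trans (cong fromℕ (sum-split b i t))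
           (trans (fromℕ-+ (ℓ ℕ.+ ℓ) (suc t)) (cong (ℚ._+ fromℕ (suc t)) (fromℕ-+ ℓ ℓ)))) ⟩
    ℚ.- (fromℕ (suc t) ℚ.* ((fromℕ ℓ ℚ.+ fromℕ ℓ) ℚ.+ fromℕ (suc t)))
      ≡⟨ squares (fromℕ ℓ) (fromℕ (suc t)) ⟩
    fromℕ ℓ ℚ.* fromℕ ℓ ℚ.- (fromℕ ℓ ℚ.+ fromℕ (suc t)) ℚ.* (fromℕ ℓ ℚ.+ fromℕ (suc t))
      ≡⟨ cong (λ x → fromℕ ℓ ℚ.* fromℕ ℓ ℚ.- x ℚ.* x) (trans (cong fromℕ (p-split b i t)) (fromℕ-+ ℓ (suc t))) ⟨
    D ∎


Z-coeff*B-raise : ∀ b s i → i ≤ s → let ℓ = fromℕ (b ℕ.+ suc i) ; p = fromℕ (b ℕ.+ suc s) in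
  (fromℕ (suc (b ℕ.+ (b ℕ.+ suc i))) ℚ.* fromℕ (suc i)) ℚ.* (Z-coeff b (suc i) ℚ.* B b (b ℕ.+ suc s) (b ℕ.+ suc (suc i)))
  ≡ (ℓ ℚ.* ℓ ℚ.- p ℚ.* p) ℚ.* (Z-coeff b i ℚ.* B b (b ℕ.+ suc s) (b ℕ.+ suc i))
Z-coeff*B-raise b s i i≤s = subst
  (λ s → let ℓ = fromℕ (b ℕ.+ suc i) ; p = fromℕ (b ℕ.+ suc s) in
    (fromℕ (suc (b ℕ.+ (b ℕ.+ suc i))) ℚ.* fromℕ (suc i)) ℚ.* (Z-coeff b (suc i) ℚ.* B b (b ℕ.+ suc s) (b ℕ.+ suc (suc i)))
    ≡ (ℓ ℚ.* ℓ ℚ.- p ℚ.* p) ℚ.* (Z-coeff b i ℚ.* B b (b ℕ.+ suc s) (b ℕ.+ suc i)))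
  (ℕ.m+[n∸m]≡n i≤s) (Z-coeff*B-raise-+ b i (s ∸ i))

connection : (b s q : ℕ) → ℚ
connection b s q = ∑ℚ (suc s) (λ i → (Z-coeff b i ℚ.* B b (b ℕ.+ suc s) (b ℕ.+ suc i)) ℚ.* (b ℕ.+ (b ℕ.+ suc i)) Cℚ q)

-- The hypergeometric operator maps each (1 + r)^k to a combination of (1 + r)^k
-- and (1 + r)^(k-1), so its action on the sum telescopes.
connection-raise : ∀ b s q →
  (fromℕ (suc q) ℚ.* fromℕ (suc q)) ℚ.* connection b s (suc q) ≡
  (fromℕ (suc (s ℕ.+ q)) ℚ.* (fromℕ (b ℕ.+ (b ℕ.+ suc s)) ℚ.- fromℕ q)) ℚ.* connection b s q
connection-raise b s q = begin
  SS ℚ.* connection b s (suc q)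
    ≡⟨ ℚ∑.sum<-*ˡ (suc s) SS (λ i → c i ℚ.* k i Cℚ suc q) ⟩
  ∑ℚ (suc s) (λ i → SS ℚ.* (c i ℚ.* k i Cℚ suc q))
    ≡⟨ ℚ∑.sum<-cong (suc s) {λ i → SS ℚ.* (c i ℚ.* k i Cℚ suc q)} {λ i → (u (suc i) ℚ.- u i) ℚ.+ W ℚ.* (c i ℚ.* k i Cℚ q)} (λ { i (s≤s i≤s) → term i i≤s }) ⟩
  ∑ℚ (suc s) (λ i → (u (suc i) ℚ.- u i) ℚ.+ W ℚ.* (c i ℚ.* k i Cℚ q))
    ≡⟨ ℚ∑.sum<-+ (suc s) (λ i → u (suc i) ℚ.- u i) (λ i → W ℚ.* (c i ℚ.* k i Cℚ q)) ⟩
  ∑ℚ (suc s) (λ i → u (suc i) ℚ.- u i) ℚ.+ ∑ℚ (suc s) (λ i → W ℚ.* (c i ℚ.* k i Cℚ q))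
    ≡⟨ cong₂ ℚ._+_ (ℚ∑.sum<-telescope (suc s) u) (sym (ℚ∑.sum<-*ˡ (suc s) W (λ i → c i ℚ.* k i Cℚ q))) ⟩
  (u (suc s) ℚ.- u 0) ℚ.+ W ℚ.* connection b s q
    ≡⟨ cong (ℚ._+ W ℚ.* connection b s q) (cong₂ ℚ._-_ top bottom) ⟩
  (0ℚ ℚ.- 0ℚ) ℚ.+ W ℚ.* connection b s q
    ≡⟨ ℚ.+-identityˡ (W ℚ.* connection b s q) ⟩
  W ℚ.* connection b s q ∎
  where
  open ≡-Reasoning
  SS W : ℚ
  SS = fromℕ (suc q) ℚ.* fromℕ (suc q)
  W = fromℕ (suc (s ℕ.+ q)) ℚ.* (fromℕ (b ℕ.+ (b ℕ.+ suc s)) ℚ.- fromℕ q)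
  c u : ℕ → ℚ
  k : ℕ → ℕ
  c i = Z-coeff b i ℚ.* B b (b ℕ.+ suc s) (b ℕ.+ suc i)
  k i = b ℕ.+ (b ℕ.+ suc i)
  u i = ((fromℕ (k i) ℚ.* fromℕ i) ℚ.* c i) ℚ.* (k i ∸ 1) Cℚ q

  bottom : u 0 ≡ 0ℚ
  bottom = annihilate (fromℕ (k 0)) (c 0) _
    where
    annihilate : ∀ x y z → ((x ℚ.* 0ℚ) ℚ.* y) ℚ.* z ≡ 0ℚ
    annihilate = solve-∀ ℚ-ring
  top : u (suc s) ≡ 0ℚ
  top = trans (cong (λ x → ((fromℕ (k (suc s)) ℚ.* fromℕ (suc s)) ℚ.* (Z-coeff b (suc s) ℚ.* x)) ℚ.* (k (suc s) ∸ 1) Cℚ q)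
                    (B-below b (suc s) (suc (suc s)) ℕ.≤-refl))
              (annihilate (fromℕ (k (suc s)) ℚ.* fromℕ (suc s)) (Z-coeff b (suc s)) _)
    where
    annihilate : ∀ x y z → (x ℚ.* (y ℚ.* 0ℚ)) ℚ.* z ≡ 0ℚ
    annihilate = solve-∀ ℚ-ring

  k-suc : ∀ i → k (suc i) ≡ suc (k i)
  k-suc i = trans (cong (b ℕ.+_) (ℕ.+-suc b (suc i))) (ℕ.+-suc b (b ℕ.+ suc i))

  ℓ-cast : ∀ i → fromℕ (b ℕ.+ suc i) ≡ fromℕ b ℚ.+ (1ℚ ℚ.+ fromℕ i)
  ℓ-cast i = trans (fromℕ-+ b (suc i)) (cong (fromℕ b ℚ.+_) (fromℕ-suc i))

  k-cast : ∀ i → fromℕ (k i) ≡ fromℕ b ℚ.+ (fromℕ b ℚ.+ (1ℚ ℚ.+ fromℕ i))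
  k-cast i = trans (fromℕ-+ b (b ℕ.+ suc i)) (cong (fromℕ b ℚ.+_) (ℓ-cast i))

  D : ℕ → ℚ
  D i = fromℕ (b ℕ.+ suc i) ℚ.* fromℕ (b ℕ.+ suc i) ℚ.- fromℕ (b ℕ.+ suc s) ℚ.* fromℕ (b ℕ.+ suc s)

  operator : ∀ i → fromℕ (suc q) ℚ.* (fromℕ (k i) ℚ.- fromℕ q) ≡ (D i ℚ.- fromℕ i ℚ.* (fromℕ (k i) ℚ.- fromℕ q)) ℚ.+ W
  operator i = begin
    fromℕ (suc q) ℚ.* (fromℕ (k i) ℚ.- fromℕ q)
      ≡⟨ cong₂ (λ x y → x ℚ.* (y ℚ.- fromℕ q)) (fromℕ-suc q) (k-cast i) ⟩
    _ ≡⟨ identity (fromℕ b) (fromℕ s) (fromℕ q) (fromℕ i) ⟩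
    _
      ≡⟨ cong₂ ℚ._+_ (cong₂ (λ x y → x ℚ.- fromℕ i ℚ.* (y ℚ.- fromℕ q)) (cong₂ (λ x y → x ℚ.* x ℚ.- y ℚ.* y) (ℓ-cast i) (ℓ-cast s)) (k-cast i))
                     (cong₂ (λ x y → x ℚ.* (y ℚ.- fromℕ q)) (trans (fromℕ-suc (s ℕ.+ q)) (cong (1ℚ ℚ.+_) (fromℕ-+ s q))) (k-cast s)) ⟨
    (D i ℚ.- fromℕ i ℚ.* (fromℕ (k i) ℚ.- fromℕ q)) ℚ.+ W ∎
    where
    identity : ∀ b s q i →
      (1ℚ ℚ.+ q) ℚ.* ((b ℚ.+ (b ℚ.+ (1ℚ ℚ.+ i))) ℚ.- q) ≡
      (((b ℚ.+ (1ℚ ℚ.+ i)) ℚ.* (b ℚ.+ (1ℚ ℚ.+ i)) ℚ.- (b ℚ.+ (1ℚ ℚ.+ s)) ℚ.* (b ℚ.+ (1ℚ ℚ.+ s)))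
        ℚ.- i ℚ.* ((b ℚ.+ (b ℚ.+ (1ℚ ℚ.+ i))) ℚ.- q))
      ℚ.+ (1ℚ ℚ.+ (s ℚ.+ q)) ℚ.* ((b ℚ.+ (b ℚ.+ (1ℚ ℚ.+ s))) ℚ.- q)
    identity = solve-∀ ℚ-ring

  term : ∀ i → i ≤ s → SS ℚ.* (c i ℚ.* k i Cℚ suc q) ≡ (u (suc i) ℚ.- u i) ℚ.+ W ℚ.* (c i ℚ.* k i Cℚ q)
  term i i≤s = begin
    SS ℚ.* (c i ℚ.* k i Cℚ suc q)
      ≡⟨ regroup (fromℕ (suc q)) (c i) _ ⟩
    fromℕ (suc q) ℚ.* (c i ℚ.* (fromℕ (suc q) ℚ.* k i Cℚ suc q))
      ≡⟨ cong (λ x → fromℕ (suc q) ℚ.* (c i ℚ.* x)) (Cℚ-raise (k i) q) ⟩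
    fromℕ (suc q) ℚ.* (c i ℚ.* (E ℚ.* k i Cℚ q))
      ≡⟨ regroup′ (fromℕ (suc q)) (c i) E _ ⟩
    (fromℕ (suc q) ℚ.* E) ℚ.* (c i ℚ.* k i Cℚ q)
      ≡⟨ cong (ℚ._* (c i ℚ.* k i Cℚ q)) (operator i) ⟩
    ((D i ℚ.- fromℕ i ℚ.* E) ℚ.+ W) ℚ.* (c i ℚ.* k i Cℚ q)
      ≡⟨ regroup″ (D i) (fromℕ i) E W (c i) _ ⟩
    ((D i ℚ.* c i) ℚ.* k i Cℚ q ℚ.- (fromℕ i ℚ.* c i) ℚ.* (E ℚ.* k i Cℚ q)) ℚ.+ W ℚ.* (c i ℚ.* k i Cℚ q)
      ≡⟨ cong₂ (λ x y → (x ℚ.* k i Cℚ q ℚ.- (fromℕ i ℚ.* c i) ℚ.* y) ℚ.+ W ℚ.* (c i ℚ.* k i Cℚ q))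
               (sym (Z-coeff*B-raise b s i i≤s)) (sym (Cℚ-lower (k i) q)) ⟩
    (((fromℕ (suc (k i)) ℚ.* fromℕ (suc i)) ℚ.* c (suc i)) ℚ.* k i Cℚ q ℚ.- (fromℕ i ℚ.* c i) ℚ.* (fromℕ (k i) ℚ.* (k i ∸ 1) Cℚ q))
      ℚ.+ W ℚ.* (c i ℚ.* k i Cℚ q)
      ≡⟨ cong₂ (λ x y → (x ℚ.- y) ℚ.+ W ℚ.* (c i ℚ.* k i Cℚ q))
               (cong (λ m → ((fromℕ m ℚ.* fromℕ (suc i)) ℚ.* c (suc i)) ℚ.* (m ∸ 1) Cℚ q) (sym (k-suc i)))
               (regroup‴ (fromℕ i) (c i) (fromℕ (k i)) _) ⟩
    (u (suc i) ℚ.- u i) ℚ.+ W ℚ.* (c i ℚ.* k i Cℚ q) ∎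
    where
    E : ℚ
    E = fromℕ (k i) ℚ.- fromℕ q
    regroup : ∀ s c d → (s ℚ.* s) ℚ.* (c ℚ.* d) ≡ s ℚ.* (c ℚ.* (s ℚ.* d))
    regroup = solve-∀ ℚ-ring
    regroup′ : ∀ s c e d → s ℚ.* (c ℚ.* (e ℚ.* d)) ≡ (s ℚ.* e) ℚ.* (c ℚ.* d)
    regroup′ = solve-∀ ℚ-ring
    regroup″ : ∀ d i e w c z → ((d ℚ.- i ℚ.* e) ℚ.+ w) ℚ.* (c ℚ.* z) ≡
               ((d ℚ.* c) ℚ.* z ℚ.- (i ℚ.* c) ℚ.* (e ℚ.* z)) ℚ.+ w ℚ.* (c ℚ.* z)
    regroup″ = solve-∀ ℚ-ring
    regroup‴ : ∀ i c k z → (i ℚ.* c) ℚ.* (k ℚ.* z) ≡ ((k ℚ.* i) ℚ.* c) ℚ.* z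
    regroup‴ = solve-∀ ℚ-ring

connection-top : ∀ b s → let Q = b ℕ.+ (b ℕ.+ suc s) in connection b s Q ≡ (s ℕ.+ Q) Cℚ Q
connection-top b s = begin
  connection b s Q
    ≡⟨ ℚ∑.sum<-last s (λ i → c i ℚ.* (b ℕ.+ (b ℕ.+ suc i)) Cℚ Q) ⟩
  ∑ℚ s (λ i → c i ℚ.* (b ℕ.+ (b ℕ.+ suc i)) Cℚ Q) ℚ.+ c s ℚ.* Q Cℚ Q
    ≡⟨ cong₂ ℚ._+_ (ℚ∑.sum<-zero s {λ i → c i ℚ.* (b ℕ.+ (b ℕ.+ suc i)) Cℚ Q} (λ i i<s → trans (cong (c i ℚ.*_) (Cℚ-zero (k<Q i<s))) (ℚ.*-zeroʳ (c i))))
                   (cong (c s ℚ.*_) (Cℚ-diagonal Q)) ⟩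
  0ℚ ℚ.+ c s ℚ.* 1ℚ
    ≡⟨ trans (ℚ.+-identityˡ _) (ℚ.*-identityʳ _) ⟩
  Z-coeff b s ℚ.* B b (b ℕ.+ suc s) (b ℕ.+ suc s)
    ≡⟨ cong (Z-coeff b s ℚ.*_) (trans (cong (λ n → B b (b ℕ.+ suc n) (b ℕ.+ suc s)) (sym (ℕ.+-identityʳ s))) (B-above b s 0)) ⟩
  Z-coeff b s ℚ.* 1ℚ
    ≡⟨ ℚ.*-identityʳ _ ⟩
  Z-coeff b s
    ≡⟨ cong₂ _Cℚ_ (cong (_∸ 1) (top b s)) (ℕ.+-comm (b ℕ.+ suc s) b) ⟩
  (s ℕ.+ Q) Cℚ Q ∎
  where
  open ≡-Reasoning
  Q : ℕ
  Q = b ℕ.+ (b ℕ.+ suc s)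
  c : ℕ → ℚ
  c i = Z-coeff b i ℚ.* B b (b ℕ.+ suc s) (b ℕ.+ suc i)
  k<Q : ∀ {i} → i < s → b ℕ.+ (b ℕ.+ suc i) < Q
  k<Q i<s = ℕ.+-monoʳ-< b (ℕ.+-monoʳ-< b (s≤s i<s))
  top : ∀ b s → 2 ℕ.* (b ℕ.+ suc s) ≡ suc (s ℕ.+ (b ℕ.+ (b ℕ.+ suc s)))
  top = ℕSolver.solve-∀

I-expansion : ∀ b s q → connection b s q ≡ I b (b ℕ.+ suc s) q
I-expansion b s q = by-cases (q ℕ.≤? Q)
  where
  Q : ℕ
  Q = b ℕ.+ (b ℕ.+ suc s)
  w : ℕ → ℕ
  w q = suc (s ℕ.+ q) ℕ.* (Q ∸ q)
  w-cast : ∀ q → q < Q → fromℕ (suc (s ℕ.+ q)) ℚ.* (fromℕ Q ℚ.- fromℕ q) ≡ fromℕ (w q)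
  w-cast q q<Q = sym (trans (fromℕ-* (suc (s ℕ.+ q)) (Q ∸ q)) (cong (fromℕ (suc (s ℕ.+ q)) ℚ.*_) (fromℕ-∸ (ℕ.<⇒≤ q<Q))))
  c : ℕ → ℚ
  c i = Z-coeff b i ℚ.* B b (b ℕ.+ suc s) (b ℕ.+ suc i)
  connection-zero : Q < q → connection b s q ≡ 0ℚ
  connection-zero Q<q = ℚ∑.sum<-zero (suc s) {λ i → c i ℚ.* (b ℕ.+ (b ℕ.+ suc i)) Cℚ q} (λ { i (s≤s i≤s) →
    zeroʳ (c i) (Cℚ-zero (ℕ.≤-<-trans (ℕ.+-monoʳ-≤ b (ℕ.+-monoʳ-≤ b (s≤s i≤s))) Q<q)) })
  I-zero : Q < q → I b (b ℕ.+ suc s) q ≡ 0ℚ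
  I-zero Q<q = trans (I-binomial b s q) (zeroʳ ((s ℕ.+ q) Cℚ q) (Cℚ-zero Q<q))
  I-top : I b (b ℕ.+ suc s) Q ≡ (s ℕ.+ Q) Cℚ Q
  I-top = trans (I-binomial b s Q)
    (trans (cong ((s ℕ.+ Q) Cℚ Q ℚ.*_) (Cℚ-diagonal Q)) (ℚ.*-identityʳ ((s ℕ.+ Q) Cℚ Q)))
  by-cases : Dec (q ≤ Q) → connection b s q ≡ I b (b ℕ.+ suc s) q
  by-cases (no q≰Q)  = trans (connection-zero (ℕ.≰⇒> q≰Q)) (sym (I-zero (ℕ.≰⇒> q≰Q)))
  by-cases (yes q≤Q) = descend Q (connection b s) (I b (b ℕ.+ suc s)) w (λ q → fromℕ (suc q) ℚ.* fromℕ (suc q))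
    (λ q q<Q → ℕ.*-mono-≤ {1} {suc (s ℕ.+ q)} {1} (s≤s z≤n) (ℕ.m<n⇒0<n∸m q<Q))
    (λ q q<Q → trans (connection-raise b s q) (cong (ℚ._* connection b s q) (w-cast q q<Q)))
    (λ q q<Q → trans (I-raise b s q) (cong (ℚ._* I b (b ℕ.+ suc s) q) (w-cast q q<Q)))
    (trans (connection-top b s) (sym I-top)) q q≤Q

J-raise : ∀ b q → (fromℕ (suc q) ℚ.* fromℕ (suc (suc q))) ℚ.* J b (suc (suc q)) ≡
          (ℚ.- ((fromℕ b ℚ.- fromℕ q) ℚ.* (fromℕ b ℚ.- fromℕ q ℚ.- 1ℚ))) ℚ.* J b (suc q)
J-raise b q = fromℕ-cancelˡ (suc q ! ℕ.* q !) {{ℕ._!*_!≢0 (suc q) q}} (begin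
  fromℕ (suc q ! ℕ.* q !) ℚ.* ((S ℚ.* SS) ℚ.* (sign (suc (suc q) ℕ.+ 1) ℚ.* F₁))
    ≡⟨ cong (ℚ._* ((S ℚ.* SS) ℚ.* (sign (suc (suc q) ℕ.+ 1) ℚ.* F₁))) (fromℕ-* (suc q !) (q !)) ⟩
  (fromℕ (suc q !) ℚ.* fromℕ (q !)) ℚ.* ((S ℚ.* SS) ℚ.* ((ℚ.- 1ℚ ℚ.* σ) ℚ.* F₁))
    ≡⟨ regroup (fromℕ (suc q !)) (fromℕ (q !)) S SS σ F₁ ⟩
  (ℚ.- 1ℚ ℚ.* σ) ℚ.* (((SS ℚ.* fromℕ (suc q !)) ℚ.* (S ℚ.* fromℕ (q !))) ℚ.* F₁)
    ≡⟨ cong (λ x → (ℚ.- 1ℚ ℚ.* σ) ℚ.* (x ℚ.* F₁)) (trans (fromℕ-* (suc (suc q) !) (suc q !))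
         (cong₂ ℚ._*_ (fromℕ-* (suc (suc q)) (suc q !)) (fromℕ-* (suc q) (q !)))) ⟨
  (ℚ.- 1ℚ ℚ.* σ) ℚ.* (fromℕ (suc (suc q) ! ℕ.* suc q !) ℚ.* F₁)
    ≡⟨ cong ((ℚ.- 1ℚ ℚ.* σ) ℚ.*_) (*-/-cancel (∏ℤ (suc q) t) (suc (suc q) ! ℕ.* suc q !) {{ℕ._!*_!≢0 (suc (suc q)) (suc q)}}) ⟩
  (ℚ.- 1ℚ ℚ.* σ) ℚ.* fromℤ (∏ℤ (suc q) t)
    ≡⟨ cong ((ℚ.- 1ℚ ℚ.* σ) ℚ.*_) (trans (cong fromℤ (∏ℤ-last q t)) (fromℤ-* (∏ℤ q t) (t q))) ⟩
  (ℚ.- 1ℚ ℚ.* σ) ℚ.* (fromℤ (∏ℤ q t) ℚ.* fromℤ (t q))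
    ≡⟨ cong₂ (λ x y → (ℚ.- 1ℚ ℚ.* σ) ℚ.* (x ℚ.* y)) (sym (*-/-cancel (∏ℤ q t) (suc q ! ℕ.* q !) {{ℕ._!*_!≢0 (suc q) q}})) factor ⟩
  (ℚ.- 1ℚ ℚ.* σ) ℚ.* ((fromℕ (suc q ! ℕ.* q !) ℚ.* F₀) ℚ.* W)
    ≡⟨ regroup′ σ (fromℕ (suc q ! ℕ.* q !)) F₀ W ⟩
  fromℕ (suc q ! ℕ.* q !) ℚ.* ((ℚ.- W) ℚ.* (σ ℚ.* F₀)) ∎)
  where
  open ≡-Reasoning
  t : ℕ → ℤ
  t m = (+ b ℤ.- + m) ℤ.* (+ b ℤ.- + m ℤ.- + 1)
  S SS σ W F₀ F₁ : ℚ
  S = fromℕ (suc q)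
  SS = fromℕ (suc (suc q))
  σ = sign (suc q ℕ.+ 1)
  W = (fromℕ b ℚ.- fromℕ q) ℚ.* (fromℕ b ℚ.- fromℕ q ℚ.- 1ℚ)
  F₀ = (∏ℤ q t ℚ./ (suc q ! ℕ.* q !)) {{ℕ._!*_!≢0 (suc q) q}}
  F₁ = (∏ℤ (suc q) t ℚ./ (suc (suc q) ! ℕ.* suc q !)) {{ℕ._!*_!≢0 (suc (suc q)) (suc q)}}
  factor : fromℤ (t q) ≡ W
  factor = trans (fromℤ-* (+ b ℤ.- + q) (+ b ℤ.- + q ℤ.- + 1))
    (cong₂ ℚ._*_ (fromℤ-- (+ b) (+ q)) (trans (fromℤ-- (+ b ℤ.- + q) (+ 1)) (cong (ℚ._- 1ℚ) (fromℤ-- (+ b) (+ q)))))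
  regroup : ∀ f g s u σ x → (f ℚ.* g) ℚ.* ((s ℚ.* u) ℚ.* ((ℚ.- 1ℚ ℚ.* σ) ℚ.* x)) ≡
            (ℚ.- 1ℚ ℚ.* σ) ℚ.* (((u ℚ.* f) ℚ.* (s ℚ.* g)) ℚ.* x)
  regroup = solve-∀ ℚ-ring
  regroup′ : ∀ σ d f w → (ℚ.- 1ℚ ℚ.* σ) ℚ.* ((d ℚ.* f) ℚ.* w) ≡ d ℚ.* ((ℚ.- w) ℚ.* (σ ℚ.* f))
  regroup′ = solve-∀ ℚ-ring

-- Up to sign, J b p is the Narayana number N(b, p).
J-binomial : ∀ b q → fromℕ b ℚ.* J b (suc q) ≡ sign (suc q ℕ.+ 1) ℚ.* (b Cℚ suc q ℚ.* b Cℚ q)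
J-binomial b zero    = begin
  fromℕ b ℚ.* 1ℚ                 ≡⟨ units (fromℕ b) ⟩
  1ℚ ℚ.* (fromℕ b ℚ.* 1ℚ)        ≡⟨ cong (λ n → 1ℚ ℚ.* (fromℕ n ℚ.* 1ℚ)) (nC1≡n b) ⟨
  1ℚ ℚ.* (b Cℚ 1 ℚ.* b Cℚ 0)     ∎
  where
  open ≡-Reasoning
  units : ∀ x → x ℚ.* 1ℚ ≡ 1ℚ ℚ.* (x ℚ.* 1ℚ)
  units = solve-∀ ℚ-ring
J-binomial b (suc q) = fromℕ-cancelˡ (suc q) (fromℕ-cancelˡ (suc (suc q)) (begin
  SS ℚ.* (S ℚ.* (β ℚ.* J b (suc (suc q))))
    ≡⟨ regroup SS S β _ ⟩
  β ℚ.* ((S ℚ.* SS) ℚ.* J b (suc (suc q)))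
    ≡⟨ cong (β ℚ.*_) (J-raise b q) ⟩
  β ℚ.* ((ℚ.- (D ℚ.* (D ℚ.- 1ℚ))) ℚ.* J b (suc q))
    ≡⟨ regroup′ β D _ ⟩
  (ℚ.- (D ℚ.* (D ℚ.- 1ℚ))) ℚ.* (β ℚ.* J b (suc q))
    ≡⟨ cong ((ℚ.- (D ℚ.* (D ℚ.- 1ℚ))) ℚ.*_) (J-binomial b q) ⟩
  (ℚ.- (D ℚ.* (D ℚ.- 1ℚ))) ℚ.* (σ ℚ.* (b Cℚ suc q ℚ.* b Cℚ q))
    ≡⟨ regroup″ D σ _ _ ⟩
  (ℚ.- 1ℚ ℚ.* σ) ℚ.* (((D ℚ.- 1ℚ) ℚ.* b Cℚ suc q) ℚ.* (D ℚ.* b Cℚ q))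
    ≡⟨ cong₂ (λ x y → (ℚ.- 1ℚ ℚ.* σ) ℚ.* ((x ℚ.* b Cℚ suc q) ℚ.* y)) shift (sym (Cℚ-raise b q)) ⟩
  (ℚ.- 1ℚ ℚ.* σ) ℚ.* (((β ℚ.- S) ℚ.* b Cℚ suc q) ℚ.* (S ℚ.* b Cℚ suc q))
    ≡⟨ cong (λ x → (ℚ.- 1ℚ ℚ.* σ) ℚ.* (x ℚ.* (S ℚ.* b Cℚ suc q))) (Cℚ-raise b (suc q)) ⟨
  (ℚ.- 1ℚ ℚ.* σ) ℚ.* ((SS ℚ.* b Cℚ suc (suc q)) ℚ.* (S ℚ.* b Cℚ suc q))
    ≡⟨ regroup‴ (ℚ.- 1ℚ ℚ.* σ) SS S _ _ ⟩
  SS ℚ.* (S ℚ.* (sign (suc (suc q) ℕ.+ 1) ℚ.* (b Cℚ suc (suc q) ℚ.* b Cℚ suc q))) ∎))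
  where
  open ≡-Reasoning
  S SS β σ D : ℚ
  S = fromℕ (suc q)
  SS = fromℕ (suc (suc q))
  β = fromℕ b
  σ = sign (suc q ℕ.+ 1)
  D = fromℕ b ℚ.- fromℕ q
  shift : D ℚ.- 1ℚ ≡ β ℚ.- S
  shift = trans (subtract β (fromℕ q)) (cong (λ x → β ℚ.- x) (sym (fromℕ-suc q)))
    where
    subtract : ∀ b q → b ℚ.- q ℚ.- 1ℚ ≡ b ℚ.- (1ℚ ℚ.+ q)
    subtract = solve-∀ ℚ-ring
  regroup : ∀ u s b j → u ℚ.* (s ℚ.* (b ℚ.* j)) ≡ b ℚ.* ((s ℚ.* u) ℚ.* j)
  regroup = solve-∀ ℚ-ring
  regroup′ : ∀ b d j → b ℚ.* ((ℚ.- (d ℚ.* (d ℚ.- 1ℚ))) ℚ.* j) ≡ (ℚ.- (d ℚ.* (d ℚ.- 1ℚ))) ℚ.* (b ℚ.* j)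
  regroup′ = solve-∀ ℚ-ring
  regroup″ : ∀ d s x y → (ℚ.- (d ℚ.* (d ℚ.- 1ℚ))) ℚ.* (s ℚ.* (x ℚ.* y)) ≡
             (ℚ.- 1ℚ ℚ.* s) ℚ.* (((d ℚ.- 1ℚ) ℚ.* x) ℚ.* (d ℚ.* y))
  regroup″ = solve-∀ ℚ-ring
  regroup‴ : ∀ z u s x y → z ℚ.* ((u ℚ.* x) ℚ.* (s ℚ.* y)) ≡ u ℚ.* (s ℚ.* (z ℚ.* (x ℚ.* y)))
  regroup‴ = solve-∀ ℚ-ring

J-diagonal : ∀ n → J (suc n) (suc n) ≡ ℚ.- sign (suc n)
J-diagonal n = fromℕ-cancelˡ (suc n) (begin
  fromℕ (suc n) ℚ.* J (suc n) (suc n)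
    ≡⟨ J-binomial (suc n) n ⟩
  sign (suc n ℕ.+ 1) ℚ.* (suc n Cℚ suc n ℚ.* suc n Cℚ n)
    ≡⟨ cong₂ (λ m c → sign m ℚ.* (c ℚ.* suc n Cℚ n)) (ℕ.+-comm (suc n) 1) (Cℚ-diagonal (suc n)) ⟩
  (ℚ.- 1ℚ ℚ.* sign (suc n)) ℚ.* (1ℚ ℚ.* suc n Cℚ n)
    ≡⟨ cong (λ x → (ℚ.- 1ℚ ℚ.* sign (suc n)) ℚ.* (1ℚ ℚ.* x)) subdiagonal ⟩
  (ℚ.- 1ℚ ℚ.* sign (suc n)) ℚ.* (1ℚ ℚ.* fromℕ (suc n))
    ≡⟨ regroup (sign (suc n)) (fromℕ (suc n)) ⟩
  fromℕ (suc n) ℚ.* ℚ.- sign (suc n) ∎)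
  where
  open ≡-Reasoning
  regroup : ∀ s x → (ℚ.- 1ℚ ℚ.* s) ℚ.* (1ℚ ℚ.* x) ≡ x ℚ.* (ℚ.- s)
  regroup = solve-∀ ℚ-ring
  difference : ∀ x c → c ≡ ((1ℚ ℚ.+ x) ℚ.- x) ℚ.* c
  difference = solve-∀ ℚ-ring
  subdiagonal : suc n Cℚ n ≡ fromℕ (suc n)
  subdiagonal = begin
    suc n Cℚ n                                          ≡⟨ difference (fromℕ n) _ ⟩
    ((1ℚ ℚ.+ fromℕ n) ℚ.- fromℕ n) ℚ.* suc n Cℚ n       ≡⟨ cong (λ x → (x ℚ.- fromℕ n) ℚ.* suc n Cℚ n) (fromℕ-suc n) ⟨
    (fromℕ (suc n) ℚ.- fromℕ n) ℚ.* suc n Cℚ n          ≡⟨ Cℚ-raise (suc n) n ⟨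
    fromℕ (suc n) ℚ.* suc n Cℚ suc n                    ≡⟨ cong (fromℕ (suc n) ℚ.*_) (Cℚ-diagonal (suc n)) ⟩
    fromℕ (suc n) ℚ.* 1ℚ                                ≡⟨ ℚ.*-identityʳ (fromℕ (suc n)) ⟩
    fromℕ (suc n)                                       ∎

Catalan-coeff : (b ℓ : ℕ) → ℚ
Catalan-coeff b ℓ = sign (b ∸ ℓ) ℚ.* fromℕ ((b ℕ.+ ℓ) C (2 ℕ.* ℓ)) ℚ.* Cat ℓ

C*Cat-raise : ∀ b ℓ → (fromℕ (suc ℓ) ℚ.* fromℕ (suc (suc ℓ))) ℚ.* ((b ℕ.+ suc ℓ) Cℚ (2 ℕ.* suc ℓ) ℚ.* Cat (suc ℓ)) ≡
              (fromℕ (suc (b ℕ.+ ℓ)) ℚ.* (fromℕ b ℚ.- fromℕ ℓ)) ℚ.* ((b ℕ.+ ℓ) Cℚ (2 ℕ.* ℓ) ℚ.* Cat ℓ)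
C*Cat-raise b ℓ = fromℕ-cancelˡ (suc ℓ) (begin
  L ℚ.* ((L ℚ.* LL) ℚ.* ((b ℕ.+ suc ℓ) Cℚ (2 ℕ.* suc ℓ) ℚ.* Cat (suc ℓ)))
    ≡⟨ cong₂ (λ m n → L ℚ.* ((L ℚ.* LL) ℚ.* (m Cℚ n ℚ.* Cat (suc ℓ)))) (ℕ.+-suc b ℓ) (double ℓ) ⟩
  L ℚ.* ((L ℚ.* LL) ℚ.* (suc (b ℕ.+ ℓ) Cℚ suc (suc N) ℚ.* Cat (suc ℓ)))
    ≡⟨ regroup L LL (suc (b ℕ.+ ℓ) Cℚ suc (suc N)) (Cat (suc ℓ)) ⟩
  (suc (b ℕ.+ ℓ) Cℚ suc (suc N)) ℚ.* (L ℚ.* (L ℚ.* (LL ℚ.* Cat (suc ℓ))))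
    ≡⟨ cong (λ x → suc (b ℕ.+ ℓ) Cℚ suc (suc N) ℚ.* (L ℚ.* (L ℚ.* x))) (*-/-cancel (+ ((2 ℕ.* suc ℓ) C suc ℓ)) (suc (suc ℓ))) ⟩
  (suc (b ℕ.+ ℓ) Cℚ suc (suc N)) ℚ.* (L ℚ.* (L ℚ.* (2 ℕ.* suc ℓ) Cℚ suc ℓ))
    ≡⟨ cong (λ n → suc (b ℕ.+ ℓ) Cℚ suc (suc N) ℚ.* (L ℚ.* (L ℚ.* n Cℚ suc ℓ))) (double ℓ) ⟩
  (suc (b ℕ.+ ℓ) Cℚ suc (suc N)) ℚ.* (L ℚ.* (L ℚ.* suc (suc N) Cℚ suc ℓ))
    ≡⟨ cong (λ x → suc (b ℕ.+ ℓ) Cℚ suc (suc N) ℚ.* x) central ⟩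
  (suc (b ℕ.+ ℓ) Cℚ suc (suc N)) ℚ.* (N₂ ℚ.* (N₁ ℚ.* N Cℚ ℓ))
    ≡⟨ regroup′ (suc (b ℕ.+ ℓ) Cℚ suc (suc N)) N₂ N₁ (N Cℚ ℓ) ⟩
  (N₁ ℚ.* (N₂ ℚ.* suc (b ℕ.+ ℓ) Cℚ suc (suc N))) ℚ.* N Cℚ ℓ
    ≡⟨ cong (λ x → (N₁ ℚ.* x) ℚ.* N Cℚ ℓ) (Cℚ-absorb (b ℕ.+ ℓ) (suc N)) ⟩
  (N₁ ℚ.* (fromℕ (suc (b ℕ.+ ℓ)) ℚ.* (b ℕ.+ ℓ) Cℚ suc N)) ℚ.* N Cℚ ℓ
    ≡⟨ regroup″ N₁ (fromℕ (suc (b ℕ.+ ℓ))) _ (N Cℚ ℓ) ⟩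
  (fromℕ (suc (b ℕ.+ ℓ)) ℚ.* (N₁ ℚ.* (b ℕ.+ ℓ) Cℚ suc N)) ℚ.* N Cℚ ℓ
    ≡⟨ cong (λ x → (fromℕ (suc (b ℕ.+ ℓ)) ℚ.* x) ℚ.* N Cℚ ℓ) (trans (Cℚ-raise (b ℕ.+ ℓ) N) (cong (ℚ._* (b ℕ.+ ℓ) Cℚ N) b-ℓ)) ⟩
  (fromℕ (suc (b ℕ.+ ℓ)) ℚ.* ((fromℕ b ℚ.- fromℕ ℓ) ℚ.* (b ℕ.+ ℓ) Cℚ N)) ℚ.* N Cℚ ℓ
    ≡⟨ cong ((fromℕ (suc (b ℕ.+ ℓ)) ℚ.* ((fromℕ b ℚ.- fromℕ ℓ) ℚ.* (b ℕ.+ ℓ) Cℚ N)) ℚ.*_) (*-/-cancel (+ (N C ℓ)) (suc ℓ)) ⟨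
  (fromℕ (suc (b ℕ.+ ℓ)) ℚ.* ((fromℕ b ℚ.- fromℕ ℓ) ℚ.* (b ℕ.+ ℓ) Cℚ N)) ℚ.* (L ℚ.* Cat ℓ)
    ≡⟨ regroup‴ (fromℕ (suc (b ℕ.+ ℓ))) (fromℕ b ℚ.- fromℕ ℓ) _ L (Cat ℓ) ⟩
  L ℚ.* ((fromℕ (suc (b ℕ.+ ℓ)) ℚ.* (fromℕ b ℚ.- fromℕ ℓ)) ℚ.* ((b ℕ.+ ℓ) Cℚ N ℚ.* Cat ℓ)) ∎)
  where
  open ≡-Reasoning
  N : ℕ
  N = 2 ℕ.* ℓ
  L LL N₁ N₂ : ℚ
  L = fromℕ (suc ℓ)
  LL = fromℕ (suc (suc ℓ))
  N₁ = fromℕ (suc N)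
  N₂ = fromℕ (suc (suc N))
  double : ∀ ℓ → 2 ℕ.* suc ℓ ≡ suc (suc (2 ℕ.* ℓ))
  double = ℕSolver.solve-∀
  half : ∀ ℓ → suc ℓ ℕ.+ ℓ ≡ suc (2 ℕ.* ℓ)
  half = ℕSolver.solve-∀
  cancel : ∀ x y → x ≡ (x ℚ.+ y) ℚ.- y
  cancel = solve-∀ ℚ-ring
  suc-ℓ : L ≡ N₁ ℚ.- fromℕ ℓ
  suc-ℓ = trans (cancel L (fromℕ ℓ)) (cong (ℚ._- fromℕ ℓ) (trans (sym (fromℕ-+ (suc ℓ) ℓ)) (cong fromℕ (half ℓ))))
  central : L ℚ.* (L ℚ.* suc (suc N) Cℚ suc ℓ) ≡ N₂ ℚ.* (N₁ ℚ.* N Cℚ ℓ)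
  central = begin
    L ℚ.* (L ℚ.* suc (suc N) Cℚ suc ℓ)                  ≡⟨ cong (L ℚ.*_) (Cℚ-absorb (suc N) ℓ) ⟩
    L ℚ.* (N₂ ℚ.* suc N Cℚ ℓ)                           ≡⟨ swap L N₂ _ ⟩
    N₂ ℚ.* (L ℚ.* suc N Cℚ ℓ)                           ≡⟨ cong (λ x → N₂ ℚ.* (x ℚ.* suc N Cℚ ℓ)) suc-ℓ ⟩
    N₂ ℚ.* ((N₁ ℚ.- fromℕ ℓ) ℚ.* suc N Cℚ ℓ)            ≡⟨ cong (N₂ ℚ.*_) (Cℚ-lower (suc N) ℓ) ⟨
    N₂ ℚ.* (N₁ ℚ.* N Cℚ ℓ)                              ∎
    where
    swap : ∀ x y z → x ℚ.* (y ℚ.* z) ≡ y ℚ.* (x ℚ.* z)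
    swap = solve-∀ ℚ-ring
  b-ℓ : fromℕ (b ℕ.+ ℓ) ℚ.- fromℕ N ≡ fromℕ b ℚ.- fromℕ ℓ
  b-ℓ = trans (cong₂ ℚ._-_ (fromℕ-+ b ℓ) (fromℕ-* 2 ℓ)) (identity (fromℕ b) (fromℕ ℓ))
    where
    identity : ∀ b l → (b ℚ.+ l) ℚ.- (1ℚ ℚ.+ 1ℚ) ℚ.* l ≡ b ℚ.- l
    identity = solve-∀ ℚ-ring
  regroup : ∀ l u c k → l ℚ.* ((l ℚ.* u) ℚ.* (c ℚ.* k)) ≡ c ℚ.* (l ℚ.* (l ℚ.* (u ℚ.* k)))
  regroup = solve-∀ ℚ-ring
  regroup′ : ∀ c m n d → c ℚ.* (m ℚ.* (n ℚ.* d)) ≡ (n ℚ.* (m ℚ.* c)) ℚ.* d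
  regroup′ = solve-∀ ℚ-ring
  regroup″ : ∀ n m c d → (n ℚ.* (m ℚ.* c)) ℚ.* d ≡ (m ℚ.* (n ℚ.* c)) ℚ.* d
  regroup″ = solve-∀ ℚ-ring
  regroup‴ : ∀ m e c l k → (m ℚ.* (e ℚ.* c)) ℚ.* (l ℚ.* k) ≡ l ℚ.* ((m ℚ.* e) ℚ.* (c ℚ.* k))
  regroup‴ = solve-∀ ℚ-ring

Catalan-coeff-raise : ∀ b ℓ → ℓ ≤ b →
  (fromℕ (suc ℓ) ℚ.* fromℕ (suc (suc ℓ))) ℚ.* Catalan-coeff b (suc ℓ) ≡
  ℚ.- ((fromℕ (suc (b ℕ.+ ℓ)) ℚ.* (fromℕ b ℚ.- fromℕ ℓ)) ℚ.* Catalan-coeff b ℓ)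
Catalan-coeff-raise b ℓ ℓ≤b = by-cases (ℕ.m≤n⇒m<n∨m≡n ℓ≤b)
  where
  open ≡-Reasoning
  L E c₀ c₁ : ℚ
  L = fromℕ (suc ℓ) ℚ.* fromℕ (suc (suc ℓ))
  E = fromℕ (suc (b ℕ.+ ℓ)) ℚ.* (fromℕ b ℚ.- fromℕ ℓ)
  c₀ = (b ℕ.+ ℓ) Cℚ (2 ℕ.* ℓ) ℚ.* Cat ℓ
  c₁ = (b ℕ.+ suc ℓ) Cℚ (2 ℕ.* suc ℓ) ℚ.* Cat (suc ℓ)
  regroup : ∀ l s c k → l ℚ.* (s ℚ.* c ℚ.* k) ≡ s ℚ.* (l ℚ.* (c ℚ.* k))
  regroup = solve-∀ ℚ-ring
  regroup′ : ∀ s e c k → s ℚ.* (e ℚ.* (c ℚ.* k)) ≡ ℚ.- (e ℚ.* ((ℚ.- 1ℚ ℚ.* s) ℚ.* c ℚ.* k))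
  regroup′ = solve-∀ ℚ-ring
  vanish : ∀ l s k m x d → l ℚ.* (s ℚ.* 0ℚ ℚ.* k) ≡ ℚ.- ((m ℚ.* (x ℚ.- x)) ℚ.* d)
  vanish = solve-∀ ℚ-ring
  by-cases : ℓ < b ⊎ ℓ ≡ b → L ℚ.* Catalan-coeff b (suc ℓ) ≡ ℚ.- (E ℚ.* Catalan-coeff b ℓ)
  by-cases (inj₁ ℓ<b)  = begin
    L ℚ.* Catalan-coeff b (suc ℓ)
      ≡⟨ regroup L (sign (b ∸ suc ℓ)) ((b ℕ.+ suc ℓ) Cℚ (2 ℕ.* suc ℓ)) (Cat (suc ℓ)) ⟩
    sign (b ∸ suc ℓ) ℚ.* (L ℚ.* c₁)
      ≡⟨ cong (sign (b ∸ suc ℓ) ℚ.*_) (C*Cat-raise b ℓ) ⟩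
    sign (b ∸ suc ℓ) ℚ.* (E ℚ.* c₀)
      ≡⟨ regroup′ (sign (b ∸ suc ℓ)) E ((b ℕ.+ ℓ) Cℚ (2 ℕ.* ℓ)) (Cat ℓ) ⟩
    ℚ.- (E ℚ.* (sign (suc (b ∸ suc ℓ)) ℚ.* (b ℕ.+ ℓ) Cℚ (2 ℕ.* ℓ) ℚ.* Cat ℓ))
      ≡⟨ cong (λ n → ℚ.- (E ℚ.* (sign n ℚ.* (b ℕ.+ ℓ) Cℚ (2 ℕ.* ℓ) ℚ.* Cat ℓ))) (ℕ.+-∸-assoc 1 ℓ<b) ⟨
    ℚ.- (E ℚ.* Catalan-coeff b ℓ) ∎
  by-cases (inj₂ refl) = begin
    L ℚ.* Catalan-coeff b (suc b)
      ≡⟨ cong (λ x → L ℚ.* (sign (b ∸ suc b) ℚ.* x ℚ.* Cat (suc b))) (Cℚ-zero (ℕ.≤-reflexive (double b))) ⟩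
    L ℚ.* (sign (b ∸ suc b) ℚ.* 0ℚ ℚ.* Cat (suc b))
      ≡⟨ vanish L (sign (b ∸ suc b)) (Cat (suc b)) (fromℕ (suc (b ℕ.+ b))) (fromℕ b) (Catalan-coeff b b) ⟩
    ℚ.- (E ℚ.* Catalan-coeff b b) ∎
    where
    double : ∀ b → suc (b ℕ.+ suc b) ≡ 2 ℕ.* suc b
    double = ℕSolver.solve-∀

Catalan-sum : (b q : ℕ) → ℚ
Catalan-sum b q = ∑ℚ (suc b) (λ ℓ → Catalan-coeff b ℓ ℚ.* (b ∸ ℓ) Cℚ q)

Catalan-sum-raise : ∀ b q → (fromℕ q ℚ.* fromℕ (suc q)) ℚ.* Catalan-sum b (suc q) ≡
  (ℚ.- ((fromℕ b ℚ.- fromℕ q) ℚ.* (fromℕ (suc b) ℚ.- fromℕ q))) ℚ.* Catalan-sum b q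
Catalan-sum-raise b q = begin
  (fromℕ q ℚ.* fromℕ (suc q)) ℚ.* Catalan-sum b (suc q)
    ≡⟨ ℚ∑.sum<-*ˡ (suc b) (fromℕ q ℚ.* fromℕ (suc q)) (λ ℓ → d ℓ ℚ.* (b ∸ ℓ) Cℚ suc q) ⟩
  ∑ℚ (suc b) (λ ℓ → (fromℕ q ℚ.* fromℕ (suc q)) ℚ.* (d ℓ ℚ.* (b ∸ ℓ) Cℚ suc q))
    ≡⟨ ℚ∑.sum<-cong (suc b) {λ ℓ → (fromℕ q ℚ.* fromℕ (suc q)) ℚ.* (d ℓ ℚ.* (b ∸ ℓ) Cℚ suc q)}
         {λ ℓ → (v (suc ℓ) ℚ.- v ℓ) ℚ.+ W ℚ.* (d ℓ ℚ.* (b ∸ ℓ) Cℚ q)} (λ { ℓ (s≤s ℓ≤b) → term ℓ ℓ≤b }) ⟩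
  ∑ℚ (suc b) (λ ℓ → (v (suc ℓ) ℚ.- v ℓ) ℚ.+ W ℚ.* (d ℓ ℚ.* (b ∸ ℓ) Cℚ q))
    ≡⟨ ℚ∑.sum<-+ (suc b) (λ ℓ → v (suc ℓ) ℚ.- v ℓ) (λ ℓ → W ℚ.* (d ℓ ℚ.* (b ∸ ℓ) Cℚ q)) ⟩
  ∑ℚ (suc b) (λ ℓ → v (suc ℓ) ℚ.- v ℓ) ℚ.+ ∑ℚ (suc b) (λ ℓ → W ℚ.* (d ℓ ℚ.* (b ∸ ℓ) Cℚ q))
    ≡⟨ cong₂ ℚ._+_ (ℚ∑.sum<-telescope (suc b) v) (sym (ℚ∑.sum<-*ˡ (suc b) W (λ ℓ → d ℓ ℚ.* (b ∸ ℓ) Cℚ q))) ⟩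
  (v (suc b) ℚ.- v 0) ℚ.+ W ℚ.* Catalan-sum b q
    ≡⟨ cong (ℚ._+ W ℚ.* Catalan-sum b q) (cong₂ ℚ._-_ top bottom) ⟩
  (0ℚ ℚ.- 0ℚ) ℚ.+ W ℚ.* Catalan-sum b q
    ≡⟨ ℚ.+-identityˡ (W ℚ.* Catalan-sum b q) ⟩
  W ℚ.* Catalan-sum b q ∎
  where
  open ≡-Reasoning
  W : ℚ
  W = ℚ.- ((fromℕ b ℚ.- fromℕ q) ℚ.* (fromℕ (suc b) ℚ.- fromℕ q))
  d v : ℕ → ℚ
  d = Catalan-coeff b
  v ℓ = ℚ.- (((fromℕ ℓ ℚ.* fromℕ (suc ℓ)) ℚ.* d ℓ) ℚ.* (b ∸ ℓ) Cℚ q)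

  bottom : v 0 ≡ 0ℚ
  bottom = annihilate (d 0) (b Cℚ q)
    where
    annihilate : ∀ x y → ℚ.- (((0ℚ ℚ.* 1ℚ) ℚ.* x) ℚ.* y) ≡ 0ℚ
    annihilate = solve-∀ ℚ-ring

  v-suc : ∀ ℓ → ℓ ≤ b → v (suc ℓ) ≡ ((fromℕ (suc (b ℕ.+ ℓ)) ℚ.* (fromℕ b ℚ.- fromℕ ℓ)) ℚ.* d ℓ) ℚ.* (b ∸ ℓ ∸ 1) Cℚ q
  v-suc ℓ ℓ≤b = begin
    ℚ.- (((fromℕ (suc ℓ) ℚ.* fromℕ (suc (suc ℓ))) ℚ.* d (suc ℓ)) ℚ.* (b ∸ suc ℓ) Cℚ q)
      ≡⟨ cong₂ (λ x n → ℚ.- (x ℚ.* n Cℚ q)) (Catalan-coeff-raise b ℓ ℓ≤b) (sym (ℕ.pred[m∸n]≡m∸[1+n] b ℓ)) ⟩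
    ℚ.- ((ℚ.- e) ℚ.* (b ∸ ℓ ∸ 1) Cℚ q)
      ≡⟨ negate e _ ⟩
    e ℚ.* (b ∸ ℓ ∸ 1) Cℚ q ∎
    where
    e : ℚ
    e = (fromℕ (suc (b ℕ.+ ℓ)) ℚ.* (fromℕ b ℚ.- fromℕ ℓ)) ℚ.* d ℓ
    negate : ∀ e c → ℚ.- ((ℚ.- e) ℚ.* c) ≡ e ℚ.* c
    negate = solve-∀ ℚ-ring

  top : v (suc b) ≡ 0ℚ
  top = trans (v-suc b ℕ.≤-refl) (annihilate (fromℕ (suc (b ℕ.+ b))) (fromℕ b) (d b) _)
    where
    annihilate : ∀ m x y z → ((m ℚ.* (x ℚ.- x)) ℚ.* y) ℚ.* z ≡ 0ℚ
    annihilate = solve-∀ ℚ-ring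

  term : ∀ ℓ → ℓ ≤ b → (fromℕ q ℚ.* fromℕ (suc q)) ℚ.* (d ℓ ℚ.* (b ∸ ℓ) Cℚ suc q) ≡
         (v (suc ℓ) ℚ.- v ℓ) ℚ.+ W ℚ.* (d ℓ ℚ.* (b ∸ ℓ) Cℚ q)
  term ℓ ℓ≤b = begin
    (fromℕ q ℚ.* fromℕ (suc q)) ℚ.* (d ℓ ℚ.* k Cℚ suc q)
      ≡⟨ regroup (fromℕ q) (fromℕ (suc q)) (d ℓ) _ ⟩
    (fromℕ q ℚ.* d ℓ) ℚ.* (fromℕ (suc q) ℚ.* k Cℚ suc q)
      ≡⟨ cong ((fromℕ q ℚ.* d ℓ) ℚ.*_) (Cℚ-raise k q) ⟩
    (fromℕ q ℚ.* d ℓ) ℚ.* ((fromℕ k ℚ.- fromℕ q) ℚ.* k Cℚ q)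
      ≡⟨ regroup′ (fromℕ q) (d ℓ) (fromℕ k ℚ.- fromℕ q) _ ⟩
    (fromℕ q ℚ.* (fromℕ k ℚ.- fromℕ q)) ℚ.* (d ℓ ℚ.* k Cℚ q)
      ≡⟨ cong (ℚ._* (d ℓ ℚ.* k Cℚ q)) operator ⟩
    ((fromℕ (suc (b ℕ.+ ℓ)) ℚ.* (fromℕ k ℚ.- fromℕ q) ℚ.+ fromℕ ℓ ℚ.* fromℕ (suc ℓ)) ℚ.+ W) ℚ.* (d ℓ ℚ.* k Cℚ q)
      ≡⟨ regroup″ (fromℕ (suc (b ℕ.+ ℓ))) (fromℕ k ℚ.- fromℕ q) (fromℕ ℓ) (fromℕ (suc ℓ)) W (d ℓ) _ ⟩
    ((fromℕ (suc (b ℕ.+ ℓ)) ℚ.* d ℓ) ℚ.* ((fromℕ k ℚ.- fromℕ q) ℚ.* k Cℚ q) ℚ.- v ℓ) ℚ.+ W ℚ.* (d ℓ ℚ.* k Cℚ q)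
      ≡⟨ cong (λ x → ((fromℕ (suc (b ℕ.+ ℓ)) ℚ.* d ℓ) ℚ.* x ℚ.- v ℓ) ℚ.+ W ℚ.* (d ℓ ℚ.* k Cℚ q)) (Cℚ-lower k q) ⟨
    ((fromℕ (suc (b ℕ.+ ℓ)) ℚ.* d ℓ) ℚ.* (fromℕ k ℚ.* (k ∸ 1) Cℚ q) ℚ.- v ℓ) ℚ.+ W ℚ.* (d ℓ ℚ.* k Cℚ q)
      ≡⟨ cong (λ x → (x ℚ.- v ℓ) ℚ.+ W ℚ.* (d ℓ ℚ.* k Cℚ q)) (trans (regroup‴ (fromℕ (suc (b ℕ.+ ℓ))) (d ℓ) (fromℕ k) _)
           (trans (cong (λ x → ((fromℕ (suc (b ℕ.+ ℓ)) ℚ.* x) ℚ.* d ℓ) ℚ.* (k ∸ 1) Cℚ q) (fromℕ-∸ ℓ≤b)) (sym (v-suc ℓ ℓ≤b)))) ⟩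
    (v (suc ℓ) ℚ.- v ℓ) ℚ.+ W ℚ.* (d ℓ ℚ.* k Cℚ q) ∎
    where
    k : ℕ
    k = b ∸ ℓ
    regroup : ∀ q s d c → (q ℚ.* s) ℚ.* (d ℚ.* c) ≡ (q ℚ.* d) ℚ.* (s ℚ.* c)
    regroup = solve-∀ ℚ-ring
    regroup′ : ∀ q d e c → (q ℚ.* d) ℚ.* (e ℚ.* c) ≡ (q ℚ.* e) ℚ.* (d ℚ.* c)
    regroup′ = solve-∀ ℚ-ring
    regroup″ : ∀ m e l s w d c → ((m ℚ.* e ℚ.+ l ℚ.* s) ℚ.+ w) ℚ.* (d ℚ.* c) ≡
               ((m ℚ.* d) ℚ.* (e ℚ.* c) ℚ.- (ℚ.- (((l ℚ.* s) ℚ.* d) ℚ.* c))) ℚ.+ w ℚ.* (d ℚ.* c)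
    regroup″ = solve-∀ ℚ-ring
    regroup‴ : ∀ m d k c → (m ℚ.* d) ℚ.* (k ℚ.* c) ≡ ((m ℚ.* k) ℚ.* d) ℚ.* c
    regroup‴ = solve-∀ ℚ-ring
    identity : ∀ b l q → q ℚ.* ((b ℚ.- l) ℚ.- q) ≡
      ((1ℚ ℚ.+ (b ℚ.+ l)) ℚ.* ((b ℚ.- l) ℚ.- q) ℚ.+ l ℚ.* (1ℚ ℚ.+ l)) ℚ.+ ℚ.- ((b ℚ.- q) ℚ.* ((1ℚ ℚ.+ b) ℚ.- q))
    identity = solve-∀ ℚ-ring
    operator : fromℕ q ℚ.* (fromℕ k ℚ.- fromℕ q) ≡
               (fromℕ (suc (b ℕ.+ ℓ)) ℚ.* (fromℕ k ℚ.- fromℕ q) ℚ.+ fromℕ ℓ ℚ.* fromℕ (suc ℓ)) ℚ.+ W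
    operator = begin
      fromℕ q ℚ.* (fromℕ k ℚ.- fromℕ q)
        ≡⟨ cong (λ x → fromℕ q ℚ.* (x ℚ.- fromℕ q)) (fromℕ-∸ ℓ≤b) ⟩
      fromℕ q ℚ.* ((fromℕ b ℚ.- fromℕ ℓ) ℚ.- fromℕ q)
        ≡⟨ identity (fromℕ b) (fromℕ ℓ) (fromℕ q) ⟩
      _ ≡⟨ cong₂ ℚ._+_ (cong₂ ℚ._+_ (cong₂ (λ x y → x ℚ.* (y ℚ.- fromℕ q))
                                       (trans (fromℕ-suc (b ℕ.+ ℓ)) (cong (1ℚ ℚ.+_) (fromℕ-+ b ℓ))) (fromℕ-∸ ℓ≤b))
                                     (cong (fromℕ ℓ ℚ.*_) (fromℕ-suc ℓ)))
                       (cong (λ x → ℚ.- ((fromℕ b ℚ.- fromℕ q) ℚ.* (x ℚ.- fromℕ q))) (fromℕ-suc b)) ⟨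
      (fromℕ (suc (b ℕ.+ ℓ)) ℚ.* (fromℕ k ℚ.- fromℕ q) ℚ.+ fromℕ ℓ ℚ.* fromℕ (suc ℓ)) ℚ.+ W ∎

J-expansion : ∀ b q → 𝟙 (b ℕ.≟ 0) ℚ.* 1 Cℚ q ℚ.- Catalan-sum b q ≡ J b q
J-expansion zero zero          = refl
J-expansion zero (suc zero)    = refl
J-expansion zero (suc (suc q)) = trans
  (cong₂ (λ x y → 1ℚ ℚ.* x ℚ.- (1ℚ ℚ.* y ℚ.+ 0ℚ)) (Cℚ-zero {1} {suc (suc q)} (s≤s (s≤s z≤n))) (Cℚ-zero {0} {suc (suc q)} (s≤s z≤n)))
  (sym (J-zero q))
  where
  J-zero : ∀ q → J 0 (suc (suc q)) ≡ 0ℚ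
  J-zero q = fromℕ-cancelˡ (suc q) (fromℕ-cancelˡ (suc (suc q)) (begin
    fromℕ (suc (suc q)) ℚ.* (fromℕ (suc q) ℚ.* J 0 (suc (suc q)))
      ≡⟨ regroup (fromℕ (suc (suc q))) (fromℕ (suc q)) (J 0 (suc (suc q))) ⟩
    (fromℕ (suc q) ℚ.* fromℕ (suc (suc q))) ℚ.* J 0 (suc (suc q))   ≡⟨ J-raise 0 q ⟩
    W q ℚ.* J 0 (suc q)                                             ≡⟨ vanish q ⟩
    0ℚ
      ≡⟨ annihilate (fromℕ (suc (suc q))) (fromℕ (suc q)) ⟩
    fromℕ (suc (suc q)) ℚ.* (fromℕ (suc q) ℚ.* 0ℚ)                  ∎))
    where
    open ≡-Reasoning
    W : ℕ → ℚ
    W q = ℚ.- ((0ℚ ℚ.- fromℕ q) ℚ.* (0ℚ ℚ.- fromℕ q ℚ.- 1ℚ))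
    regroup : ∀ x y z → x ℚ.* (y ℚ.* z) ≡ (y ℚ.* x) ℚ.* z
    regroup = solve-∀ ℚ-ring
    annihilate : ∀ x y → 0ℚ ≡ x ℚ.* (y ℚ.* 0ℚ)
    annihilate = solve-∀ ℚ-ring
    vanish : ∀ q → W q ℚ.* J 0 (suc q) ≡ 0ℚ
    vanish zero    = refl
    vanish (suc q) = trans (cong (W (suc q) ℚ.*_) (J-zero q)) (ℚ.*-zeroʳ (W (suc q)))
J-expansion b@(suc b-1) q = trans (trans (cong (ℚ._- Catalan-sum b q) (ℚ.*-zeroˡ (1 Cℚ q))) (ℚ.+-identityˡ _)) (by-cases (q ℕ.≤? b))
  where
  open ≡-Reasoning
  S : ℕ → ℚ
  S q = ℚ.- Catalan-sum b q
  w : ℕ → ℕ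
  w q = (b ∸ q) ℕ.* (suc b ∸ q)
  z : ℕ → ℚ
  z q = ℚ.- (fromℕ q ℚ.* fromℕ (suc q))
  w-cast : ∀ q → q < b → (fromℕ b ℚ.- fromℕ q) ℚ.* (fromℕ (suc b) ℚ.- fromℕ q) ≡ fromℕ (w q)
  w-cast q q<b = sym (trans (fromℕ-* (b ∸ q) (suc b ∸ q)) (cong₂ ℚ._*_ (fromℕ-∸ (ℕ.<⇒≤ q<b)) (fromℕ-∸ (ℕ.<⇒≤ (ℕ.m≤n⇒m≤1+n q<b)))))
  S-raise : ∀ q → q < b → z q ℚ.* S (suc q) ≡ fromℕ (w q) ℚ.* S q
  S-raise q q<b = begin
    z q ℚ.* S (suc q)
      ≡⟨ negate₂ (fromℕ q ℚ.* fromℕ (suc q)) (Catalan-sum b (suc q)) ⟩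
    (fromℕ q ℚ.* fromℕ (suc q)) ℚ.* Catalan-sum b (suc q)            ≡⟨ Catalan-sum-raise b q ⟩
    (ℚ.- ((fromℕ b ℚ.- fromℕ q) ℚ.* (fromℕ (suc b) ℚ.- fromℕ q))) ℚ.* Catalan-sum b q
                                                                     ≡⟨ cong (λ x → (ℚ.- x) ℚ.* Catalan-sum b q) (w-cast q q<b) ⟩
    (ℚ.- fromℕ (w q)) ℚ.* Catalan-sum b q                            ≡⟨ negate (fromℕ (w q)) (Catalan-sum b q) ⟩
    fromℕ (w q) ℚ.* S q                                              ∎
    where
    negate₂ : ∀ x y → (ℚ.- x) ℚ.* (ℚ.- y) ≡ x ℚ.* y
    negate₂ = solve-∀ ℚ-ring
    negate : ∀ x y → (ℚ.- x) ℚ.* y ≡ x ℚ.* (ℚ.- y)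
    negate = solve-∀ ℚ-ring
  J-step : ∀ q → q < b → z q ℚ.* J b (suc q) ≡ fromℕ (w q) ℚ.* J b q
  J-step zero    _   = annihilate (J b 1) (fromℕ (w 0))
    where
    annihilate : ∀ x y → (ℚ.- (0ℚ ℚ.* 1ℚ)) ℚ.* x ≡ y ℚ.* 0ℚ
    annihilate = solve-∀ ℚ-ring
  J-step (suc q) q<b = begin
    (ℚ.- (fromℕ (suc q) ℚ.* fromℕ (suc (suc q)))) ℚ.* J b (suc (suc q))
      ≡⟨ negate (fromℕ (suc q) ℚ.* fromℕ (suc (suc q))) (J b (suc (suc q))) ⟩
    ℚ.- ((fromℕ (suc q) ℚ.* fromℕ (suc (suc q))) ℚ.* J b (suc (suc q)))
      ≡⟨ cong ℚ.-_ (J-raise b q) ⟩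
    ℚ.- ((ℚ.- ((fromℕ b ℚ.- fromℕ q) ℚ.* (fromℕ b ℚ.- fromℕ q ℚ.- 1ℚ))) ℚ.* J b (suc q))
      ≡⟨ regroup (fromℕ b) (fromℕ q) (J b (suc q)) ⟩
    ((fromℕ b ℚ.- (1ℚ ℚ.+ fromℕ q)) ℚ.* ((1ℚ ℚ.+ fromℕ b) ℚ.- (1ℚ ℚ.+ fromℕ q))) ℚ.* J b (suc q)
      ≡⟨ cong₂ (λ x y → ((fromℕ b ℚ.- x) ℚ.* (y ℚ.- x)) ℚ.* J b (suc q)) (fromℕ-suc q) (fromℕ-suc b) ⟨
    ((fromℕ b ℚ.- fromℕ (suc q)) ℚ.* (fromℕ (suc b) ℚ.- fromℕ (suc q))) ℚ.* J b (suc q)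
      ≡⟨ cong (ℚ._* J b (suc q)) (w-cast (suc q) q<b) ⟩
    fromℕ (w (suc q)) ℚ.* J b (suc q) ∎
    where
    negate : ∀ x y → (ℚ.- x) ℚ.* y ≡ ℚ.- (x ℚ.* y)
    negate = solve-∀ ℚ-ring
    regroup : ∀ b q j → ℚ.- ((ℚ.- ((b ℚ.- q) ℚ.* (b ℚ.- q ℚ.- 1ℚ))) ℚ.* j) ≡
              ((b ℚ.- (1ℚ ℚ.+ q)) ℚ.* ((1ℚ ℚ.+ b) ℚ.- (1ℚ ℚ.+ q))) ℚ.* j
    regroup = solve-∀ ℚ-ring
  S-top : S b ≡ J b b
  S-top = trans (cong ℚ.-_ (begin
    Catalan-coeff b 0 ℚ.* b Cℚ b ℚ.+ ∑ℚ b (λ ℓ → Catalan-coeff b (suc ℓ) ℚ.* (b ∸ suc ℓ) Cℚ b)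
      ≡⟨ cong₂ ℚ._+_ (cong (Catalan-coeff b 0 ℚ.*_) (Cℚ-diagonal b))
           (ℚ∑.sum<-zero b {λ ℓ → Catalan-coeff b (suc ℓ) ℚ.* (b ∸ suc ℓ) Cℚ b}
             (λ ℓ _ → zeroʳ (Catalan-coeff b (suc ℓ)) (Cℚ-zero (s≤s (ℕ.m∸n≤m b-1 ℓ))))) ⟩
    Catalan-coeff b 0 ℚ.* 1ℚ ℚ.+ 0ℚ
      ≡⟨ units (sign b) ⟩
    sign b ∎)) (sym (J-diagonal b-1))
    where
    units : ∀ s → s ℚ.* 1ℚ ℚ.* 1ℚ ℚ.* 1ℚ ℚ.+ 0ℚ ≡ s
    units = solve-∀ ℚ-ring
  S-zero : b < q → S q ≡ 0ℚ
  S-zero b<q = cong ℚ.-_ (ℚ∑.sum<-zero (suc b) {λ ℓ → Catalan-coeff b ℓ ℚ.* (b ∸ ℓ) Cℚ q}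
    (λ ℓ _ → zeroʳ (Catalan-coeff b ℓ) (Cℚ-zero (ℕ.≤-<-trans (ℕ.m∸n≤m b ℓ) b<q))))
  J-zero : ∀ q → b < q → J b q ≡ 0ℚ
  J-zero (suc q) b<q = fromℕ-cancelˡ b (begin
    fromℕ b ℚ.* J b (suc q)                                     ≡⟨ J-binomial b q ⟩
    sign (suc q ℕ.+ 1) ℚ.* (b Cℚ suc q ℚ.* b Cℚ q)
      ≡⟨ cong (λ x → sign (suc q ℕ.+ 1) ℚ.* (x ℚ.* b Cℚ q)) (Cℚ-zero b<q) ⟩
    sign (suc q ℕ.+ 1) ℚ.* (0ℚ ℚ.* b Cℚ q)                      ≡⟨ annihilate (sign (suc q ℕ.+ 1)) (b Cℚ q) (fromℕ b) ⟩
    fromℕ b ℚ.* 0ℚ                                              ∎)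
    where
    annihilate : ∀ x y z → x ℚ.* (0ℚ ℚ.* y) ≡ z ℚ.* 0ℚ
    annihilate = solve-∀ ℚ-ring
  by-cases : Dec (q ≤ b) → S q ≡ J b q
  by-cases (no q≰b)  = trans (S-zero (ℕ.≰⇒> q≰b)) (sym (J-zero q (ℕ.≰⇒> q≰b)))
  by-cases (yes q≤b) = descend b S (J b) w z
    (λ q q<b → ℕ.*-mono-≤ {1} {b ∸ q} {1} (ℕ.m<n⇒0<n∸m q<b) (ℕ.m<n⇒0<n∸m (ℕ.m≤n⇒m≤1+n q<b)))
    S-raise J-step S-top q q≤b

-- The ring of power series

cauchy-cong₂ : ∀ e {f f′ g g′} →
  (∀ u → length u ≡ length e → sum u ≤ sum e → f u ≡ f′ u) →
  (∀ v → length v ≡ length e → sum v ≤ sum e → g v ≡ g′ v) →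
  cauchy f g e ≡ cauchy f′ g′ e
cauchy-cong₂ []      hf hg = cong₂ ℚ._*_ (hf [] refl z≤n) (hg [] refl z≤n)
cauchy-cong₂ (n ∷ e) {f} {f′} {g} {g′} hf hg = ℚ∑.sum<-cong (suc n)
  {λ i → cauchy (f ∘ (i ∷_)) (g ∘ ((n ∸ i) ∷_)) e} {λ i → cauchy (f′ ∘ (i ∷_)) (g′ ∘ ((n ∸ i) ∷_)) e}
  λ { i (s≤s i≤n) → cauchy-cong₂ e
      (λ u |u| Σu → hf (i ∷ u) (cong suc |u|) (ℕ.+-mono-≤ i≤n Σu))
      (λ v |v| Σv → hg (n ∸ i ∷ v) (cong suc |v|) (ℕ.+-mono-≤ (ℕ.m∸n≤m n i) Σv)) }

cauchy-ext : ∀ e {f f′ g g′} → (∀ u → f u ≡ f′ u) → (∀ v → g v ≡ g′ v) → cauchy f g e ≡ cauchy f′ g′ e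
cauchy-ext e hf hg = cauchy-cong₂ e (λ u _ _ → hf u) (λ v _ _ → hg v)

cauchy-scale : ∀ c g e → cauchy (constCoeff c) g e ≡ c ℚ.* g e
cauchy-scale c g []      = refl
cauchy-scale c g (n ∷ e) = trans
  (cong₂ ℚ._+_ (cauchy-scale c (g ∘ (n ∷_)) e)
               (∑ℚ-zero n (λ i _ → cauchy-zero (λ _ → 0ℚ) (g ∘ ((n ∸ suc i) ∷_)) e
                 (λ _ v _ _ _ → ℚ.*-zeroˡ (g ((n ∸ suc i) ∷ v))))))
  (ℚ.+-identityʳ (c ℚ.* g (n ∷ e)))

cauchy-distribʳ : ∀ e f g h → cauchy (λ u → f u ℚ.+ g u) h e ≡ cauchy f h e ℚ.+ cauchy g h e
cauchy-distribʳ []      f g h = ℚ.*-distribʳ-+ (h []) (f []) (g [])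
cauchy-distribʳ (n ∷ e) f g h = trans
  (∑ℚ-cong (suc n) (λ i → cauchy-distribʳ e (f ∘ (i ∷_)) (g ∘ (i ∷_)) (h ∘ ((n ∸ i) ∷_))))
  (ℚ∑.sum<-+ (suc n) (λ i → cauchy (f ∘ (i ∷_)) (h ∘ ((n ∸ i) ∷_)) e) (λ i → cauchy (g ∘ (i ∷_)) (h ∘ ((n ∸ i) ∷_)) e))

shift : (Exponents → ℚ) → Exponents → ℚ
shift f []      = 0ℚ
shift f (n ∷ e) = f (suc n ∷ e)

cauchy-last : ∀ n e f g → cauchy f g (suc n ∷ e) ≡
              cauchy (f ∘ (suc n ∷_)) (g ∘ (0 ∷_)) e ℚ.+ cauchy f (shift g) (n ∷ e)
cauchy-last n e f g = begin
  ∑ℚ (suc (suc n)) F                                     ≡⟨ ℚ∑.sum<-last (suc n) F ⟩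
  ∑ℚ (suc n) F ℚ.+ F (suc n)                             ≡⟨ ℚ.+-comm (∑ℚ (suc n) F) (F (suc n)) ⟩
  F (suc n) ℚ.+ ∑ℚ (suc n) F                             ≡⟨ cong₂ ℚ._+_
    (cong (λ m → cauchy (f ∘ (suc n ∷_)) (g ∘ (m ∷_)) e) (ℕ.n∸n≡0 n))
    (ℚ∑.sum<-cong (suc n) {F} {λ i → cauchy (f ∘ (i ∷_)) (shift g ∘ ((n ∸ i) ∷_)) e}
      (λ { i (s≤s i≤n) → cong (λ m → cauchy (f ∘ (i ∷_)) (g ∘ (m ∷_)) e) (ℕ.+-∸-assoc 1 i≤n) })) ⟩
  cauchy (f ∘ (suc n ∷_)) (g ∘ (0 ∷_)) e ℚ.+ cauchy f (shift g) (n ∷ e) ∎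
  where
  open ≡-Reasoning
  F : ℕ → ℚ
  F i = cauchy (f ∘ (i ∷_)) (g ∘ ((suc n ∸ i) ∷_)) e

cauchy-comm : ∀ e f g → cauchy f g e ≡ cauchy g f e
cauchy-comm []          f g = ℚ.*-comm (f []) (g [])
cauchy-comm (zero ∷ e)  f g = cong (ℚ._+ 0ℚ) (cauchy-comm e (f ∘ (0 ∷_)) (g ∘ (0 ∷_)))
cauchy-comm (suc n ∷ e) f g = trans
  (cong₂ ℚ._+_ (cauchy-comm e (f ∘ (0 ∷_)) (g ∘ (suc n ∷_))) (cauchy-comm (n ∷ e) (shift f) g))
  (sym (cauchy-last n e g f))

cauchy-distribˡ : ∀ e f g h → cauchy f (λ v → g v ℚ.+ h v) e ≡ cauchy f g e ℚ.+ cauchy f h e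
cauchy-distribˡ e f g h = trans (cauchy-comm e f (λ v → g v ℚ.+ h v))
  (trans (cauchy-distribʳ e g h f) (cong₂ ℚ._+_ (cauchy-comm e g f) (cauchy-comm e h f)))

cauchy-∑ʳ : ∀ n e f (G : ℕ → Exponents → ℚ) →
            cauchy f (λ v → ∑ℚ n (λ i → G i v)) e ≡ ∑ℚ n (λ i → cauchy f (G i) e)
cauchy-∑ʳ zero    e f G = cauchy-zero f (λ _ → 0ℚ) e (λ u _ _ _ _ → ℚ.*-zeroʳ (f u))
cauchy-∑ʳ (suc n) e f G = trans (cauchy-distribˡ e f (G 0) (λ v → ∑ℚ n (λ i → G (suc i) v)))
  (cong (cauchy f (G 0) e ℚ.+_) (cauchy-∑ʳ n e f (G ∘ suc)))

cauchy-assoc : ∀ e f g h → cauchy (cauchy f g) h e ≡ cauchy f (cauchy g h) e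
cauchy-assoc []          f g h = ℚ.*-assoc (f []) (g []) (h [])
cauchy-assoc (zero ∷ e)  f g h = cong (ℚ._+ 0ℚ) (begin
  cauchy (λ u → cauchy f₀ g₀ u ℚ.+ 0ℚ) h₀ e    ≡⟨ cauchy-ext e (λ u → ℚ.+-identityʳ (cauchy f₀ g₀ u)) (λ _ → refl) ⟩
  cauchy (cauchy f₀ g₀) h₀ e                   ≡⟨ cauchy-assoc e f₀ g₀ h₀ ⟩
  cauchy f₀ (cauchy g₀ h₀) e                   ≡⟨ cauchy-ext e (λ _ → refl) (λ v → ℚ.+-identityʳ (cauchy g₀ h₀ v)) ⟨
  cauchy f₀ (λ v → cauchy g₀ h₀ v ℚ.+ 0ℚ) e    ∎)
  where
  open ≡-Reasoning
  f₀ g₀ h₀ : Exponents → ℚ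
  f₀ = f ∘ (0 ∷_)
  g₀ = g ∘ (0 ∷_)
  h₀ = h ∘ (0 ∷_)
cauchy-assoc (suc n ∷ e) f g h = begin
  cauchy (λ u → cauchy f₀ g₀ u ℚ.+ 0ℚ) h₊ e ℚ.+ cauchy (shift (cauchy f g)) h (n ∷ e)
    ≡⟨ cong₂ ℚ._+_ (trans (cauchy-ext e (λ u → ℚ.+-identityʳ (cauchy f₀ g₀ u)) (λ _ → refl)) (cauchy-assoc e f₀ g₀ h₊))
                   (cauchy-cong₂ (n ∷ e) {g = h} split (λ _ _ _ → refl)) ⟩
  cauchy f₀ (cauchy g₀ h₊) e ℚ.+ cauchy (λ u → P u ℚ.+ cauchy (shift f) g u) h (n ∷ e)
    ≡⟨ cong (cauchy f₀ (cauchy g₀ h₊) e ℚ.+_) (cauchy-distribʳ (n ∷ e) P (cauchy (shift f) g) h) ⟩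
  cauchy f₀ (cauchy g₀ h₊) e ℚ.+ (cauchy P h (n ∷ e) ℚ.+ cauchy (cauchy (shift f) g) h (n ∷ e))
    ≡⟨ cong₂ (λ x y → cauchy f₀ (cauchy g₀ h₊) e ℚ.+ (x ℚ.+ y)) P-assoc (cauchy-assoc (n ∷ e) (shift f) g h) ⟩
  cauchy f₀ (cauchy g₀ h₊) e ℚ.+ (cauchy f₀ (λ u → cauchy (shift g) h (n ∷ u)) e ℚ.+ cauchy (shift f) (cauchy g h) (n ∷ e))
    ≡⟨ ℚ.+-assoc (cauchy f₀ (cauchy g₀ h₊) e) _ _ ⟨
  (cauchy f₀ (cauchy g₀ h₊) e ℚ.+ cauchy f₀ (λ u → cauchy (shift g) h (n ∷ u)) e) ℚ.+ cauchy (shift f) (cauchy g h) (n ∷ e)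
    ≡⟨ cong (ℚ._+ cauchy (shift f) (cauchy g h) (n ∷ e)) (cauchy-distribˡ e f₀ (cauchy g₀ h₊) (λ u → cauchy (shift g) h (n ∷ u))) ⟨
  cauchy f (cauchy g h) (suc n ∷ e) ∎
  where
  open ≡-Reasoning
  f₀ g₀ h₊ P : Exponents → ℚ
  f₀ = f ∘ (0 ∷_)
  g₀ = g ∘ (0 ∷_)
  h₊ = h ∘ (suc n ∷_)
  P []      = 0ℚ
  P (i ∷ u) = cauchy f₀ (g ∘ (suc i ∷_)) u
  split : ∀ u → length u ≡ suc (length e) → sum u ≤ sum (n ∷ e) →
          shift (cauchy f g) u ≡ P u ℚ.+ cauchy (shift f) g u
  split (i ∷ u) _ _ = refl
  P-assoc : cauchy P h (n ∷ e) ≡ cauchy f₀ (λ u → cauchy (shift g) h (n ∷ u)) e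
  P-assoc = trans
    (∑ℚ-cong (suc n) (λ i → cauchy-assoc e f₀ (g ∘ (suc i ∷_)) (h ∘ ((n ∸ i) ∷_))))
    (sym (cauchy-∑ʳ (suc n) e f₀ (λ i → cauchy (g ∘ (suc i ∷_)) (h ∘ ((n ∸ i) ∷_)))))

constCoeff-0 : ∀ e → constCoeff 0ℚ e ≡ 0ℚ
constCoeff-0 = coeff-∑ 0 (λ _ → const 0ℚ)

-- Agreement modulo the variables v_L, v_{L+1}, … and modulo total degree D.
infix 4 _≈[_,_]_
record _≈[_,_]_ (f : Series) (L D : ℕ) (g : Series) : Set where
  constructor agree
  field
    coeff-agree : ∀ e → length e ≤ L → sum e < D → coeff f e ≡ coeff g e
open _≈[_,_]_ public

≈⇒≈[] : ∀ {f g L D} → f ≈ g → f ≈[ L , D ] g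
≈⇒≈[] f≈g = agree λ e _ _ → coeff-≡ f≈g e

≈[]⇒≈ : ∀ {f g} → (∀ n → f ≈[ 2 ℕ.+ n , 2 ℕ.+ n ] g) → f ≈ g
≈[]⇒≈ h = mk≈ λ e → coeff-agree (h (length e ℕ.+ sum e)) e
  (ℕ.≤-trans (ℕ.m≤m+n (length e) (sum e)) (ℕ.m≤n+m _ 2)) (s≤s (ℕ.m≤n⇒m≤1+n (ℕ.m≤n+m (sum e) (length e))))

seriesRing : (L D : ℕ) → CommutativeRing 0ℓ 0ℓ
seriesRing L D = record
  { Carrier = Series
  ; _≈_     = λ f g → f ≈[ L , D ] g
  ; _+_     = _+_
  ; _*_     = _*_
  ; -_      = -_
  ; 0#      = const 0ℚ
  ; 1#      = const 1ℚ
  ; isCommutativeRing = record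
    { isRing = record
      { +-isAbelianGroup = record
        { isGroup = record
          { isMonoid = record
            { isSemigroup = record
              { isMagma = record
                { isEquivalence = record
                  { refl  = agree λ _ _ _ → refl
                  ; sym   = λ p → agree λ e l d → sym (coeff-agree p e l d)
                  ; trans = λ p q → agree λ e l d → trans (coeff-agree p e l d) (coeff-agree q e l d)
                  }
                ; ∙-cong = λ p q → agree λ e l d → cong₂ ℚ._+_ (coeff-agree p e l d) (coeff-agree q e l d)
                }
              ; assoc = λ f g h → agree λ e _ _ → ℚ.+-assoc (coeff f e) (coeff g e) (coeff h e)
              }
            ; identity = (λ f → agree λ e _ _ → trans (cong (ℚ._+ coeff f e) (constCoeff-0 e)) (ℚ.+-identityˡ (coeff f e)))
                       , (λ f → agree λ e _ _ → trans (cong (coeff f e ℚ.+_) (constCoeff-0 e)) (ℚ.+-identityʳ (coeff f e)))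
            }
          ; inverse = (λ f → agree λ e _ _ → trans (ℚ.+-inverseˡ (coeff f e)) (sym (constCoeff-0 e)))
                    , (λ f → agree λ e _ _ → trans (ℚ.+-inverseʳ (coeff f e)) (sym (constCoeff-0 e)))
          ; ⁻¹-cong = λ p → agree λ e l d → cong ℚ.-_ (coeff-agree p e l d)
          }
        ; comm = λ f g → agree λ e _ _ → ℚ.+-comm (coeff f e) (coeff g e)
        }
      ; *-cong = λ {f} {f′} {g} {g′} p q → agree λ e l d → cauchy-cong₂ e {coeff f} {coeff f′} {coeff g} {coeff g′}
          (λ u |u| Σu → coeff-agree p u (subst (_≤ L) (sym |u|) l) (ℕ.≤-<-trans Σu d))
          (λ v |v| Σv → coeff-agree q v (subst (_≤ L) (sym |v|) l) (ℕ.≤-<-trans Σv d))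
      ; *-assoc = λ f g h → agree λ e _ _ → cauchy-assoc e (coeff f) (coeff g) (coeff h)
      ; *-identity = (λ f → agree λ e _ _ → cauchy-identityˡ (coeff f) e)
                   , (λ f → agree λ e _ _ → trans (cauchy-comm e (coeff f) (constCoeff 1ℚ)) (cauchy-identityˡ (coeff f) e))
      ; distrib = (λ f g h → agree λ e _ _ → cauchy-distribˡ e (coeff f) (coeff g) (coeff h))
                , (λ f g h → agree λ e _ _ → cauchy-distribʳ e (coeff g) (coeff h) (coeff f))
      }
    ; *-comm = λ f g → agree λ e _ _ → cauchy-comm e (coeff f) (coeff g)
    }
  }

-- Substitution

module TruncatedPolynomials (A : CommutativeRing 0ℓ 0ℓ) where
  open CommutativeRing A renaming (_+_ to _⊕_; _*_ to _⊛_; _≈_ to _≋_; refl to ≋-refl; sym to ≋-sym; trans to ≋-trans; zeroˡ to *-zeroˡ)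
  open RawSemiringDefinitions (Semiring.rawSemiring semiring) using () renaming (_^_ to _↑_)
  open FiniteSums A
  open SemiringSolver commutativeSemiring using (solve; _:=_; _:+_; _:*_; con)
  open SetoidReasoning setoid

  infixl 7 _⋆_
  _⋆_ : (a b : ℕ → Carrier) → ℕ → Carrier
  (a ⋆ b) k = sum< (suc k) (λ i → a i ⊛ b (k ∸ i))

  poly : ℕ → Carrier → (ℕ → Carrier) → Carrier
  poly d x a = sum< d (λ i → (x ↑ i) ⊛ a i)

  poly-suc : ∀ d x a → poly (suc d) x a ≋ a 0 ⊕ x ⊛ poly d x (a ∘ suc)
  poly-suc d x a = +-cong (*-identityˡ (a 0)) (≋-trans
    (sum<-cong d (λ i _ → *-assoc x (x ↑ i) (a (suc i))))
    (≋-sym (sum<-*ˡ d x (λ i → (x ↑ i) ⊛ a (suc i)))))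

  poly-linear : ∀ d x c a b → poly d x (λ i → c ⊛ a i ⊕ b i) ≋ c ⊛ poly d x a ⊕ poly d x b
  poly-linear d x c a b = begin
    sum< d (λ i → (x ↑ i) ⊛ (c ⊛ a i ⊕ b i))
      ≈⟨ sum<-cong d (λ i _ → solve 4 (λ x c a b → x :* (c :* a :+ b) := c :* (x :* a) :+ x :* b) ≋-refl (x ↑ i) c (a i) (b i)) ⟩
    sum< d (λ i → c ⊛ ((x ↑ i) ⊛ a i) ⊕ (x ↑ i) ⊛ b i)
      ≈⟨ sum<-+ d (λ i → c ⊛ ((x ↑ i) ⊛ a i)) (λ i → (x ↑ i) ⊛ b i) ⟩
    sum< d (λ i → c ⊛ ((x ↑ i) ⊛ a i)) ⊕ poly d x b       ≈⟨ +-congʳ (≋-sym (sum<-*ˡ d c (λ i → (x ↑ i) ⊛ a i))) ⟩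
    c ⊛ poly d x a ⊕ poly d x b                           ∎

  -- The factor y makes room for the induction, which trades a power of x for y.
  poly-⋆ : ∀ d x y a b → y ⊛ (x ↑ d) ≋ 0# → y ⊛ (poly d x a ⊛ poly d x b) ≋ y ⊛ poly d x (a ⋆ b)
  poly-⋆ zero    x y a b _ = *-congˡ (*-zeroˡ 0#)
  poly-⋆ (suc d) x y a b yx^ = begin
    y ⊛ (poly (suc d) x a ⊛ poly (suc d) x b)
      ≈⟨ *-congˡ (*-congʳ (poly-suc d x a)) ⟩
    y ⊛ ((a 0 ⊕ x ⊛ A′) ⊛ poly (suc d) x b)
      ≈⟨ solve 5 (λ y a x A p → y :* ((a :+ x :* A) :* p) := y :* (a :* p) :+ (y :* x) :* (A :* p)) ≋-refl y (a 0) x A′ (poly (suc d) x b) ⟩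
    y ⊛ (a 0 ⊛ poly (suc d) x b) ⊕ (y ⊛ x) ⊛ (A′ ⊛ poly (suc d) x b)
      ≈⟨ +-cong (*-congˡ (*-congˡ (poly-suc d x b))) tail ⟩
    y ⊛ (a 0 ⊛ (b 0 ⊕ x ⊛ poly d x (b ∘ suc))) ⊕ (y ⊛ x) ⊛ poly d x ((a ∘ suc) ⋆ b)
      ≈⟨ solve 6 (λ y a b x p q → y :* (a :* (b :+ x :* p)) :+ (y :* x) :* q := y :* ((a :* b :+ con 0) :+ x :* (a :* p :+ q))) ≋-refl y (a 0) (b 0) x (poly d x (b ∘ suc)) (poly d x ((a ∘ suc) ⋆ b)) ⟩
    y ⊛ ((a 0 ⊛ b 0 ⊕ 0#) ⊕ x ⊛ (a 0 ⊛ poly d x (b ∘ suc) ⊕ poly d x ((a ∘ suc) ⋆ b)))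
      ≈⟨ *-congˡ (+-congˡ (*-congˡ (poly-linear d x (a 0) (b ∘ suc) ((a ∘ suc) ⋆ b)))) ⟨
    y ⊛ ((a 0 ⊛ b 0 ⊕ 0#) ⊕ x ⊛ poly d x ((a ⋆ b) ∘ suc))
      ≈⟨ *-congˡ (poly-suc d x (a ⋆ b)) ⟨
    y ⊛ poly (suc d) x (a ⋆ b) ∎
    where
    A′ : Carrier
    A′ = poly d x (a ∘ suc)
    tail : (y ⊛ x) ⊛ (A′ ⊛ poly (suc d) x b) ≋ (y ⊛ x) ⊛ poly d x ((a ∘ suc) ⋆ b)
    tail = begin
      (y ⊛ x) ⊛ (A′ ⊛ poly (suc d) x b)
        ≈⟨ *-congˡ (*-congˡ (sum<-last d (λ i → (x ↑ i) ⊛ b i))) ⟩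
      (y ⊛ x) ⊛ (A′ ⊛ (poly d x b ⊕ (x ↑ d) ⊛ b d))
        ≈⟨ solve 6 (λ y x A B p c → (y :* x) :* (A :* (B :+ p :* c)) := (y :* x) :* (A :* B) :+ (y :* (x :* p)) :* (A :* c)) ≋-refl y x A′ (poly d x b) (x ↑ d) (b d) ⟩
      (y ⊛ x) ⊛ (A′ ⊛ poly d x b) ⊕ (y ⊛ (x ⊛ (x ↑ d))) ⊛ (A′ ⊛ b d)
        ≈⟨ +-cong (poly-⋆ d x (y ⊛ x) (a ∘ suc) b (≋-trans (*-assoc y x (x ↑ d)) yx^))
                                                                               (≋-trans (*-congʳ yx^) (*-zeroˡ _)) ⟩
      (y ⊛ x) ⊛ poly d x ((a ∘ suc) ⋆ b) ⊕ 0#                         ≈⟨ +-identityʳ _ ⟩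
      (y ⊛ x) ⊛ poly d x ((a ∘ suc) ⋆ b)                              ∎

module Modulo (L D : ℕ) where
  module Ring = CommutativeRing (seriesRing L D)
  open Ring public using (setoid; +-cong; +-congˡ; +-congʳ; *-cong; *-congˡ; *-congʳ; -‿cong)
    renaming (_≈_ to _≋_; refl to ≋-refl; sym to ≋-sym; trans to ≋-trans)
  open FiniteSums (seriesRing L D) public
  open TruncatedPolynomials (seriesRing L D) using (_⋆_; poly; poly-⋆)
  open RawSemiringDefinitions (Semiring.rawSemiring Ring.semiring) public using () renaming (_^_ to _↑_)
  open SemiringSolver Ring.commutativeSemiring public using (solve; _:=_; _:+_; _:*_; con)
  open SetoidReasoning setoid

  -- Both powers unfold alike, but they are computed in raw semirings whose
  -- equalities differ, so they only agree by induction.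
  ↑≡^ : ∀ f k → f ↑ k ≡ f ^ k
  ↑≡^ f zero    = refl
  ↑≡^ f (suc k) = cong (f *_) (↑≡^ f k)

  ^-congˡ : ∀ k {f g} → f ≋ g → f ^ k ≋ g ^ k
  ^-congˡ zero    f≋g = ≋-refl
  ^-congˡ (suc k) f≋g = *-cong f≋g (^-congˡ k f≋g)

  coeff-≋ : ∀ {f g} → (∀ e → coeff f e ≡ coeff g e) → f ≋ g
  coeff-≋ h = agree λ e _ _ → h e

  •-const : ∀ c f → c • f ≋ const c * f
  •-const c f = coeff-≋ λ e → sym (cauchy-scale c (coeff f) e)

  •-cong : ∀ c {f g} → f ≋ g → c • f ≋ c • g
  •-cong c f≋g = agree λ e l d → cong (c ℚ.*_) (coeff-agree f≋g e l d)

  const-* : ∀ c d → const (c ℚ.* d) ≋ const c * const d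
  const-* c d = coeff-≋ λ e → trans (const-coeff e) (sym (cauchy-scale c (constCoeff d) e))
    where
    const-coeff : ∀ e → constCoeff (c ℚ.* d) e ≡ c ℚ.* constCoeff d e
    const-coeff []          = refl
    const-coeff (zero ∷ e)  = const-coeff e
    const-coeff (suc _ ∷ e) = sym (ℚ.*-zeroʳ c)

  1•f≋f : ∀ f → 1ℚ • f ≋ f
  1•f≋f f = coeff-≋ λ e → ℚ.*-identityˡ (coeff f e)

  0•f≋0 : ∀ f → 0ℚ • f ≋ const 0ℚ
  0•f≋0 f = coeff-≋ λ e → trans (ℚ.*-zeroˡ (coeff f e)) (sym (constCoeff-0 e))

  •-*-assoc : ∀ c f g → c • (f * g) ≋ f * (c • g)
  •-*-assoc c f g = begin
    c • (f * g)           ≈⟨ •-const c (f * g) ⟩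
    const c * (f * g)     ≈⟨ solve 3 (λ c f g → c :* (f :* g) := f :* (c :* g)) ≋-refl (const c) f g ⟩
    f * (const c * g)     ≈⟨ *-congˡ (•-const c g) ⟨
    f * (c • g)           ∎

  order⇒≋0 : ∀ {k} f → D ≤ k → OrderAtLeast k f → f ≋ const 0ℚ
  order⇒≋0 f D≤k h = agree λ e _ Σe<D → trans (h e (ℕ.<-≤-trans Σe<D D≤k)) (sym (constCoeff-0 e))

  box∑ : (l d : ℕ) → (Exponents → Series) → Series
  box∑ = box (RawRing.+-rawMonoid rawRing)

  box-cong : ∀ l d {F G} → (∀ m → length m ≡ l → F m ≋ G m) → box∑ l d F ≋ box∑ l d G
  box-cong zero    d h = h [] refl
  box-cong (suc l) d h = sum<-cong d (λ k _ → box-cong l d (λ m |m| → h (k ∷ m) (cong suc |m|)))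

  box-vanish : ∀ l d {F} → (∀ m → F m ≋ const 0ℚ) → box∑ l d F ≋ const 0ℚ
  box-vanish zero    d h = h []
  box-vanish (suc l) d h = sum<-zero d (λ k _ → box-vanish l d (h ∘ (k ∷_)))

  box-+ : ∀ l d F G → box∑ l d (λ m → F m + G m) ≋ box∑ l d F + box∑ l d G
  box-+ zero    d F G = ≋-refl
  box-+ (suc l) d F G = ≋-trans (sum<-cong d (λ k _ → box-+ l d (F ∘ (k ∷_)) (G ∘ (k ∷_))))
    (sum<-+ d (λ k → box∑ l d (F ∘ (k ∷_))) (λ k → box∑ l d (G ∘ (k ∷_))))

  box-*ˡ : ∀ l d f F → f * box∑ l d F ≋ box∑ l d (λ m → f * F m)
  box-*ˡ zero    d f F = ≋-refl
  box-*ˡ (suc l) d f F = ≋-trans (sum<-*ˡ d f (λ k → box∑ l d (F ∘ (k ∷_))))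
    (sum<-cong d (λ k _ → box-*ˡ l d f (F ∘ (k ∷_))))

  infix 9 _↓_
  _↓_ : Series → ℕ → Series
  f ↓ k = record { coeff = coeff f ∘ (k ∷_) ; pad = pad f ∘ (k ∷_) }

  substBox : ℕ → (ℕ → Series) → Series → Series
  substBox l X f = box∑ l D (λ m → coeff f m • monomial X m)

  substBox-cong : ∀ l X {f g} → (∀ m → coeff f m ≡ coeff g m) → substBox l X f ≋ substBox l X g
  substBox-cong l X h = box-cong l D (λ m _ → coeff-≋ λ e → cong (ℚ._* coeff (monomial X m) e) (h m))

  substBox-zero : ∀ l X {f} → (∀ m → coeff f m ≡ 0ℚ) → substBox l X f ≋ const 0ℚ
  substBox-zero l X h = box-vanish l D (λ m → coeff-≋ λ e → trans (Defs.zeroˡ (coeff (monomial X m) e) (h m)) (sym (constCoeff-0 e)))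

  substBox-+ : ∀ l X f g → substBox l X (f + g) ≋ substBox l X f + substBox l X g
  substBox-+ l X f g = ≋-trans
    (box-cong l D (λ m _ → coeff-≋ λ e → ℚ.*-distribʳ-+ (coeff (monomial X m) e) (coeff f m) (coeff g m)))
    (box-+ l D (λ m → coeff f m • monomial X m) (λ m → coeff g m • monomial X m))

  substBox-• : ∀ l X c f → substBox l X (c • f) ≋ c • substBox l X f
  substBox-• l X c f = begin
    box∑ l D (λ m → (c ℚ.* coeff f m) • monomial X m)       ≈⟨ box-cong l D (λ m _ → ≋-trans
                                                                 (coeff-≋ λ e → ℚ.*-assoc c (coeff f m) (coeff (monomial X m) e))
                                                                 (•-const c (coeff f m • monomial X m))) ⟩
    box∑ l D (λ m → const c * (coeff f m • monomial X m))   ≈⟨ box-*ˡ l D (const c) (λ m → coeff f m • monomial X m) ⟨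
    const c * substBox l X f                                ≈⟨ •-const c (substBox l X f) ⟨
    c • substBox l X f                                      ∎

  substBox-neg : ∀ l X f → substBox l X (- f) ≋ - substBox l X f
  substBox-neg l X f = begin
    substBox l X (- f)             ≈⟨ substBox-cong l X {(ℚ.- 1ℚ) • f} { - f} (λ m → neg-one (coeff f m)) ⟨
    substBox l X ((ℚ.- 1ℚ) • f)    ≈⟨ substBox-• l X (ℚ.- 1ℚ) f ⟩
    (ℚ.- 1ℚ) • substBox l X f      ≈⟨ coeff-≋ (λ e → neg-one (coeff (substBox l X f) e)) ⟩
    - substBox l X f               ∎
    where
    neg-one : ∀ q → (ℚ.- 1ℚ) ℚ.* q ≡ ℚ.- q
    neg-one = solve-∀ ℚ-ring

  substBox-∑ : ∀ l X n F → substBox l X (∑ n F) ≋ ∑ n (λ i → substBox l X (F i))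
  substBox-∑ l X zero    F = substBox-zero l X {const 0ℚ} constCoeff-0
  substBox-∑ l X (suc n) F = ≋-trans (substBox-+ l X (F 0) (∑ n (F ∘ suc))) (+-congˡ (substBox-∑ l X n (F ∘ suc)))

  substBox-suc : ∀ l X f → substBox (suc l) X f ≋ poly D (X 0) (λ k → substBox l (X ∘ suc) (f ↓ k))
  substBox-suc l X f = sum<-cong D (λ k _ → ≋-trans
    (box-cong l D {λ m → coeff f (k ∷ m) • monomial X (k ∷ m)} (λ m _ → •-*-assoc (coeff f (k ∷ m)) (X 0 ^ k) (monomial (X ∘ suc) m)))
    (≋-trans (≋-sym (box-*ˡ l D (X 0 ^ k) (λ m → coeff f (k ∷ m) • monomial (X ∘ suc) m)))
             (*-congʳ (Ring.reflexive (sym (↑≡^ (X 0) k))))))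

  substBox-* : ∀ l X → (∀ i → X i ^ D ≋ const 0ℚ) → ∀ f g →
               substBox l X (f * g) ≋ substBox l X f * substBox l X g
  substBox-* zero    X nil f g = begin
    (coeff f [] ℚ.* coeff g []) • const 1ℚ
      ≈⟨ ≋-trans (•-const (coeff f [] ℚ.* coeff g []) (const 1ℚ)) (*-congʳ (const-* (coeff f []) (coeff g []))) ⟩
    (const (coeff f []) * const (coeff g [])) * const 1ℚ
      ≈⟨ solve 2 (λ c d → (c :* d) :* con 1 := (c :* con 1) :* (d :* con 1)) ≋-refl (const (coeff f [])) (const (coeff g [])) ⟩
    (const (coeff f []) * const 1ℚ) * (const (coeff g []) * const 1ℚ)
                                                              ≈⟨ *-cong (•-const (coeff f []) (const 1ℚ)) (•-const (coeff g []) (const 1ℚ)) ⟨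
    (coeff f [] • const 1ℚ) * (coeff g [] • const 1ℚ)           ∎
  substBox-* (suc l) X nil f g = begin
    substBox (suc l) X (f * g)                         ≈⟨ substBox-suc l X (f * g) ⟩
    poly D (X 0) (λ k → S ((f * g) ↓ k))
      ≈⟨ sum<-cong D {λ k → X 0 ↑ k * S ((f * g) ↓ k)} {λ k → X 0 ↑ k * (a ⋆ b) k} (λ k _ → *-congˡ (coefficient k)) ⟩
    poly D (X 0) (a ⋆ b)                               ≈⟨ Ring.*-identityˡ (poly D (X 0) (a ⋆ b)) ⟨
    const 1ℚ * poly D (X 0) (a ⋆ b)
      ≈⟨ poly-⋆ D (X 0) (const 1ℚ) a b (≋-trans (Ring.*-identityˡ (X 0 ↑ D)) (≋-trans (Ring.reflexive (↑≡^ (X 0) D)) (nil 0))) ⟨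
    const 1ℚ * (poly D (X 0) a * poly D (X 0) b)       ≈⟨ Ring.*-identityˡ (poly D (X 0) a * poly D (X 0) b) ⟩
    poly D (X 0) a * poly D (X 0) b                    ≈⟨ *-cong (substBox-suc l X f) (substBox-suc l X g) ⟨
    substBox (suc l) X f * substBox (suc l) X g        ∎
    where
    S : Series → Series
    S = substBox l (X ∘ suc)
    a b : ℕ → Series
    a k = S (f ↓ k)
    b k = S (g ↓ k)
    coefficient : ∀ k → S ((f * g) ↓ k) ≋ (a ⋆ b) k
    coefficient k = begin
      S ((f * g) ↓ k)
        ≈⟨ substBox-cong l (X ∘ suc) {(f * g) ↓ k} {∑ (suc k) (λ i → f ↓ i * g ↓ (k ∸ i))} (λ m → sym (coeff-∑ (suc k) (λ i → f ↓ i * g ↓ (k ∸ i)) m)) ⟩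
      S (∑ (suc k) (λ i → f ↓ i * g ↓ (k ∸ i)))         ≈⟨ substBox-∑ l (X ∘ suc) (suc k) (λ i → f ↓ i * g ↓ (k ∸ i)) ⟩
      ∑ (suc k) (λ i → S (f ↓ i * g ↓ (k ∸ i)))
        ≈⟨ sum<-cong (suc k) {λ i → S (f ↓ i * g ↓ (k ∸ i))} {λ i → a i * b (k ∸ i)} (λ i _ → substBox-* l (X ∘ suc) (nil ∘ suc) (f ↓ i) (g ↓ (k ∸ i))) ⟩
      (a ⋆ b) k                                         ∎

module ModuloFacts (L D : ℕ) where
  open Modulo L D
  open SetoidReasoning setoid

  ∑∞-≋ : ∀ F h N → (∀ e → length e ≤ L → sum e < D → proj₁ (h e) ≤ N) → ∑∞ F h ≋ ∑ N F
  ∑∞-≋ F h N bound = agree λ e l d → sym (proj₂ (summable⇒convergent F h e) N (bound e l d))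

  eval : ℕ → Series → (ℕ → ℚ) → Series
  eval N f a = ∑ N (λ p → a p • f ^ p)

  evalAt-≋ : ∀ a f f₀ N → D ≤ N → evalAt a f f₀ ≋ eval N f a
  evalAt-≋ a f f₀ N D≤N = ∑∞-≋ (λ p → a p • f ^ p) _ N (λ e _ Σe<D → ℕ.≤-trans Σe<D D≤N)

  coeff-eval : ∀ N f a e → coeff (eval N f a) e ≡ ∑ℚ N (λ p → a p ℚ.* coeff (f ^ p) e)
  coeff-eval N f a e = coeff-∑ N (λ p → a p • f ^ p) e

  eval-cong : ∀ N f {a b} → (∀ q → a q ≡ b q) → eval N f a ≋ eval N f b
  eval-cong N f {a} {b} h = sum<-cong N {λ p → a p • f ^ p} {λ p → b p • f ^ p}
    (λ p _ → coeff-≋ λ e → cong (ℚ._* coeff (f ^ p) e) (h p))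

  eval-congʳ : ∀ N a {f g} → f ≋ g → eval N f a ≋ eval N g a
  eval-congʳ N a {f} {g} f≋g = sum<-cong N {λ p → a p • f ^ p} {λ p → a p • g ^ p}
    (λ p _ → •-cong (a p) (^-congˡ p f≋g))

  eval-• : ∀ N f c a → eval N f (λ q → c ℚ.* a q) ≋ c • eval N f a
  eval-• N f c a = coeff-≋ λ e → trans (coeff-eval N f (λ q → c ℚ.* a q) e)
    (trans (∑ℚ-cong N (λ p → ℚ.*-assoc c (a p) (coeff (f ^ p) e)))
    (trans (sym (ℚ∑.sum<-*ˡ N c (λ p → a p ℚ.* coeff (f ^ p) e))) (cong (c ℚ.*_) (sym (coeff-eval N f a e)))))

  eval-+ : ∀ N f a b → eval N f (λ q → a q ℚ.+ b q) ≋ eval N f a + eval N f b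
  eval-+ N f a b = coeff-≋ λ e → trans (coeff-eval N f (λ q → a q ℚ.+ b q) e)
    (trans (∑ℚ-cong N (λ p → ℚ.*-distribʳ-+ (coeff (f ^ p) e) (a p) (b p)))
    (trans (ℚ∑.sum<-+ N (λ p → a p ℚ.* coeff (f ^ p) e) (λ p → b p ℚ.* coeff (f ^ p) e))
           (sym (cong₂ ℚ._+_ (coeff-eval N f a e) (coeff-eval N f b e)))))

  eval-zero : ∀ N f {a} → (∀ q → a q ≡ 0ℚ) → eval N f a ≋ const 0ℚ
  eval-zero N f {a} h = coeff-≋ λ e → trans (coeff-eval N f a e)
    (trans (∑ℚ-zero N (λ p _ → zeroˡ (coeff (f ^ p) e) (h p))) (sym (constCoeff-0 e)))

  eval-- : ∀ N f a b → eval N f (λ q → a q ℚ.- b q) ≋ eval N f a - eval N f b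
  eval-- N f a b = ≋-trans (eval-+ N f a (ℚ.-_ ∘ b)) (+-congˡ (begin
    eval N f (ℚ.-_ ∘ b)                    ≈⟨ eval-cong N f {λ q → (ℚ.- 1ℚ) ℚ.* b q} {ℚ.-_ ∘ b} (λ q → neg-one (b q)) ⟨
    eval N f (λ q → (ℚ.- 1ℚ) ℚ.* b q)      ≈⟨ eval-• N f (ℚ.- 1ℚ) b ⟩
    (ℚ.- 1ℚ) • eval N f b                  ≈⟨ coeff-≋ (λ e → neg-one (coeff (eval N f b) e)) ⟩
    - eval N f b                           ∎))
    where
    neg-one : ∀ q → (ℚ.- 1ℚ) ℚ.* q ≡ ℚ.- q
    neg-one = solve-∀ ℚ-ring

  eval-∑ : ∀ N f M (A : ℕ → ℕ → ℚ) → eval N f (λ q → ∑ℚ M (λ i → A i q)) ≋ ∑ M (λ i → eval N f (A i))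
  eval-∑ N f zero    A = eval-zero N f {λ _ → 0ℚ} (λ _ → refl)
  eval-∑ N f (suc M) A = ≋-trans (eval-+ N f (A 0) (λ q → ∑ℚ M (λ i → A (suc i) q))) (+-congˡ (eval-∑ N f M (A ∘ suc)))

  eval-unit : ∀ {N} f {a} → 0 < N → a 0 ≡ 1ℚ → (∀ q → a (suc q) ≡ 0ℚ) → eval N f a ≋ const 1ℚ
  eval-unit {suc N} f {a} _ a₀ a₊ = begin
    a 0 • const 1ℚ + eval⁺
      ≈⟨ +-cong (≋-trans (coeff-≋ λ e → cong (ℚ._* constCoeff 1ℚ e) a₀) (1•f≋f (const 1ℚ)))
                                                     (sum<-zero N {λ p → a (suc p) • f ^ suc p} (λ p _ → coeff-≋ λ e → trans (zeroˡ (coeff (f ^ suc p) e) (a₊ p)) (sym (constCoeff-0 e)))) ⟩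
    const 1ℚ + const 0ℚ                    ≈⟨ Ring.+-identityʳ (const 1ℚ) ⟩
    const 1ℚ                               ∎
    where
    eval⁺ : Series
    eval⁺ = ∑ N (λ p → a (suc p) • f ^ suc p)

  eval-binomial : ∀ {N} f → 0 < N → f ^ N ≋ const 0ℚ → ∀ k → eval N f (k Cℚ_) ≋ (const 1ℚ + f) ^ k
  eval-binomial         f 0<N nil zero    = eval-unit f {0 Cℚ_} 0<N refl (λ q → Cℚ-zero {0} {suc q} (s≤s z≤n))
  eval-binomial {suc N} f 0<N nil (suc k) = begin
    1ℚ • const 1ℚ + ∑ N (λ q → suc k Cℚ suc q • f ^ suc q)
      ≈⟨ +-congˡ (sum<-cong N {λ q → suc k Cℚ suc q • f ^ suc q} {λ q → k Cℚ suc q • f ^ suc q + k Cℚ q • f ^ suc q}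
           (λ q _ → coeff-≋ λ e → trans (cong (ℚ._* coeff (f ^ suc q) e) (trans (Cℚ-pascal k q) (ℚ.+-comm (k Cℚ q) (k Cℚ suc q))))
                                        (ℚ.*-distribʳ-+ (coeff (f ^ suc q) e) (k Cℚ suc q) (k Cℚ q)))) ⟩
    1ℚ • const 1ℚ + ∑ N (λ q → k Cℚ suc q • f ^ suc q + k Cℚ q • f ^ suc q)
      ≈⟨ +-congˡ (sum<-+ N (λ q → k Cℚ suc q • f ^ suc q) (λ q → k Cℚ q • f ^ suc q)) ⟩
    1ℚ • const 1ℚ + (∑ N (λ q → k Cℚ suc q • f ^ suc q) + ∑ N (λ q → k Cℚ q • f ^ suc q))
      ≈⟨ Ring.+-assoc (1ℚ • const 1ℚ) _ _ ⟨
    E + ∑ N (λ q → k Cℚ q • f ^ suc q)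
      ≈⟨ +-congˡ raised ⟩
    E + f * E
      ≈⟨ solve 2 (λ f E → E :+ f :* E := (con 1 :+ f) :* E) ≋-refl f E ⟩
    (const 1ℚ + f) * E
      ≈⟨ *-congˡ (eval-binomial f 0<N nil k) ⟩
    (const 1ℚ + f) ^ suc k ∎
    where
    E : Series
    E = eval (suc N) f (k Cℚ_)
    G : ℕ → Series
    G q = k Cℚ q • f ^ suc q
    raised : ∑ N G ≋ f * E
    raised = ≋-sym (begin
      f * E                            ≈⟨ sum<-*ˡ (suc N) f (λ q → k Cℚ q • f ^ q) ⟩
      ∑ (suc N) (λ q → f * (k Cℚ q • f ^ q))
                                       ≈⟨ sum<-cong (suc N) {λ q → f * (k Cℚ q • f ^ q)} {G} (λ q _ → ≋-sym (•-*-assoc (k Cℚ q) f (f ^ q))) ⟩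
      ∑ (suc N) G                      ≈⟨ sum<-last N G ⟩
      ∑ N G + G N                      ≈⟨ +-congˡ (≋-trans (•-cong (k Cℚ N) nil) (coeff-≋ λ e → zeroʳ-const e)) ⟩
      ∑ N G + const 0ℚ                 ≈⟨ Ring.+-identityʳ (∑ N G) ⟩
      ∑ N G                            ∎)
      where
      zeroʳ-const : ∀ e → (k Cℚ N) ℚ.* constCoeff 0ℚ e ≡ constCoeff 0ℚ e
      zeroʳ-const e = trans (zeroʳ (k Cℚ N) (constCoeff-0 e)) (sym (constCoeff-0 e))

  order-^ : ∀ f → constantTerm f ≡ 0ℚ → f ^ D ≋ const 0ℚ
  order-^ f f₀ = order⇒≋0 (f ^ D) ℕ.≤-refl (^-order f (order-1 f f₀) D)

-- Stated for an abstract S, since substBox would unfold whenever two terms are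
-- compared.
record IsSubstitution (n : ℕ) (X : ℕ → Series) (S : Series → Series) : Set where
  open Modulo n n using (_≋_)
  field
    S-cong : ∀ {f g} → f ≋ g → S f ≋ S g
    S--    : ∀ f g → S (f - g) ≋ S f - S g
    S-•    : ∀ c f → S (c • f) ≋ c • S f
    S-∑    : ∀ k F → S (∑ k F) ≋ ∑ k (λ i → S (F i))
    S-*    : ∀ f g → S (f * g) ≋ S f * S g
    S-^    : ∀ f k → S (f ^ k) ≋ S f ^ k
    S-var  : ∀ i → S (var i) ≋ X i

module SubstitutionModulo (m : ℕ) where
  n : ℕ
  n = suc (suc m)

  open Modulo n n
  open ModuloFacts n n
  open SetoidReasoning setoid

  substBox-skip : ∀ l X f → (∀ k e → coeff f (suc k ∷ e) ≡ 0ℚ) →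
                  substBox (suc l) X f ≋ substBox l (X ∘ suc) (f ↓ 0)
  substBox-skip l X f h = begin
    substBox (suc l) X f                          ≈⟨ substBox-suc l X f ⟩
    const 1ℚ * S (f ↓ 0) + ∑ (suc m) G
      ≈⟨ +-cong (Ring.*-identityˡ (S (f ↓ 0))) (sum<-zero (suc m) {G} (λ k _ →
                                                       ≋-trans (*-congˡ (substBox-zero l (X ∘ suc) {f ↓ suc k} (h k))) (Ring.zeroʳ (X 0 ↑ suc k)))) ⟩
    S (f ↓ 0) + const 0ℚ                          ≈⟨ Ring.+-identityʳ (S (f ↓ 0)) ⟩
    S (f ↓ 0)                                     ∎
    where
    S : Series → Series
    S = substBox l (X ∘ suc)
    G : ℕ → Series
    G k = X 0 ↑ suc k * S (f ↓ suc k)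

  substBox-const : ∀ l X c → substBox l X (const c) ≋ const c
  substBox-const zero    X c = ≋-trans (•-const c (const 1ℚ)) (Ring.*-identityʳ (const c))
  substBox-const (suc l) X c = ≋-trans (substBox-skip l X (const c) (λ _ _ → refl)) (substBox-const l (X ∘ suc) c)

  substBox-var : ∀ l X → (∀ i → l ≤ i → X i ≋ const 0ℚ) → ∀ i → substBox l X (var i) ≋ X i
  substBox-var zero    X small i       = ≋-trans
    (≋-trans (Ring.reflexive (cong (_• const 1ℚ) (constant i))) (0•f≋0 (const 1ℚ))) (≋-sym (small i z≤n))
    where
    constant : ∀ i → varCoeff i [] ≡ 0ℚ
    constant zero    = refl
    constant (suc i) = refl
  substBox-var (suc l) X small zero    = begin
    substBox (suc l) X (var 0)                     ≈⟨ substBox-suc l X (var 0) ⟩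
    const 1ℚ * S (var 0 ↓ 0) + ((X 0 * const 1ℚ) * S (var 0 ↓ 1) + ∑ m rest)
                                                   ≈⟨ +-cong (*-congˡ (substBox-zero l (X ∘ suc) {var 0 ↓ 0} (λ _ → refl)))
                                                        (+-cong (*-congˡ (substBox-const l (X ∘ suc) 1ℚ)) (sum<-zero m {rest} (λ k _ →
                                                          ≋-trans (*-congˡ (substBox-zero l (X ∘ suc) {var 0 ↓ suc (suc k)} (λ _ → refl))) (Ring.zeroʳ (X 0 ↑ suc (suc k)))))) ⟩
    const 1ℚ * const 0ℚ + ((X 0 * const 1ℚ) * const 1ℚ + const 0ℚ)
                                                   ≈⟨ solve 1 (λ x → con 1 :* con 0 :+ ((x :* con 1) :* con 1 :+ con 0) := x) ≋-refl (X 0) ⟩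
    X 0                                            ∎
    where
    S : Series → Series
    S = substBox l (X ∘ suc)
    rest : ℕ → Series
    rest k = X 0 ↑ suc (suc k) * S (var 0 ↓ suc (suc k))
  substBox-var (suc l) X small (suc i) = ≋-trans (substBox-skip l X (var (suc i)) (λ _ _ → refl))
    (substBox-var l (X ∘ suc) (λ i l≤i → small (suc i) (s≤s l≤i)) i)

  module _ (X : ℕ → Series) (X-tri : Triangular X) where
    private
      S : Series → Series
      S = substBox n X

      X-nilpotent : ∀ i → X i ^ n ≋ const 0ℚ
      X-nilpotent i = order-^ (X i) (X-tri i 0 z≤n [] refl)

      X-small : ∀ i → n ≤ i → X i ≋ const 0ℚ
      X-small i n≤i = agree λ e l _ → trans (X-tri i (length e) (ℕ.≤-trans l n≤i) e refl) (sym (constCoeff-0 e))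

      S-^ : ∀ f k → S (f ^ k) ≋ S f ^ k
      S-^ f zero    = substBox-const n X 1ℚ
      S-^ f (suc k) = ≋-trans (substBox-* n X X-nilpotent f (f ^ k)) (*-congˡ (S-^ f k))

      S-cong : ∀ {f g} → f ≋ g → S f ≋ S g
      S-cong {f} {g} f≋g = box-cong n n λ m |m| → term m |m| (sum m ℕ.<? n)
        where
        term : ∀ m → length m ≡ n → Dec (sum m < n) → coeff f m • monomial X m ≋ coeff g m • monomial X m
        term m |m| (yes Σm<n) = Ring.reflexive (cong (_• monomial X m) (coeff-agree f≋g m (ℕ.≤-reflexive |m|) Σm<n))
        term m |m| (no  Σm≮n) = ≋-trans (vanish (coeff f m)) (≋-sym (vanish (coeff g m)))
          where
          vanish : ∀ c → c • monomial X m ≋ const 0ℚ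
          vanish c = ≋-trans (•-const c (monomial X m)) (≋-trans
            (*-congˡ (order⇒≋0 (monomial X m) (ℕ.≮⇒≥ Σm≮n)
              (monomial-order X (λ i → order-1 (X i) (X-tri i 0 z≤n [] refl)) m)))
            (Ring.zeroʳ (const c)))

    substBox-isSubstitution : IsSubstitution n X (substBox n X)
    substBox-isSubstitution = record
      { S-cong = S-cong
      ; S--    = λ f g → ≋-trans (substBox-+ n X f (- g)) (+-congˡ (substBox-neg n X g))
      ; S-•    = substBox-• n X
      ; S-∑    = substBox-∑ n X
      ; S-*    = substBox-* n X X-nilpotent
      ; S-^    = S-^
      ; S-var  = substBox-var n X X-small
      }

    substitute-≋ : ∀ f → substitute f X X-tri ≋ substBox n X f
    substitute-≋ f = agree λ e l d → sym (proj₂ (substUpTo-convergent f X X-tri e) n (ℕ.⊔-lub l d))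

-- Existence

I-diagonal : ∀ b q → I b (b ℕ.+ 0) (suc q) ≡ 0ℚ
I-diagonal b q = trans
  (cong (λ z → (z ℤ.* ∏ℤ q (f ∘ suc) ℚ./ (suc q ! ℕ.* suc q !)) {{ℕ._!*_!≢0 (suc q) (suc q)}})
    (ℤ.+-inverseʳ ((+ (b ℕ.+ 0)) ℤ.^ 2)))
  (ℚ.0/n≡0 (suc q ! ℕ.* suc q !) {{ℕ._!*_!≢0 (suc q) (suc q)}})
  where
  f : ℕ → ℤ
  f m = (+ (b ℕ.+ 0)) ℤ.^ 2 ℤ.- (+ b ℤ.- + m) ℤ.^ 2

hat-constantTerm : ∀ b R → constantTerm R ≡ 1ℚ → constantTerm (hat b R) ≡ 0ℚ
hat-constantTerm b R R₀ = cong (λ c → (c ℚ.* 1ℚ ℚ.+ 0ℚ) ℚ.- 1ℚ) (trans (pad R []) R₀)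

module HatEquation (b : ℕ) (R : Series) (isR : IsR b R) (n : ℕ) (0<n : 0 < n)
                   (S : Series → Series) (S-isSubstitution : IsSubstitution n (X b) S)
                   (substitute-S : substitute R (X b) (X-triangular b) ≈[ n , n ] S R) where
  open Modulo n n
  open ModuloFacts n n
  open IsSubstitution S-isSubstitution
  open SetoidReasoning setoid

  h ρ : Series
  h = hat b R
  ρ = const 1ℚ + h

  h₀ : constantTerm h ≡ 0ℚ
  h₀ = hat-constantTerm b R (IsR.constantTerm-1 isR)

  y : ℕ → Series
  y s = x b (b ℕ.+ s)

  k : ℕ → ℕ
  k i = b ℕ.+ (b ℕ.+ suc i)

  c : ℕ → ℕ → ℚ
  c s i = Z-coeff b i ℚ.* B b (b ℕ.+ s) (b ℕ.+ suc i)

  S-R : S R ≋ ρ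
  S-R = ≋-trans (≋-sym substitute-S)
    (coeff-≋ λ e → cancel (coeff (substitute R (X b) (X-triangular b)) e) (constCoeff 1ℚ e))
    where
    cancel : ∀ s u → s ≡ u ℚ.+ (s ℚ.- u)
    cancel = solve-∀ ℚ-ring

  S-R^ : ∀ i → S (R ^ i) ≋ ρ ^ i
  S-R^ i = ≋-trans (S-^ R i) (^-congˡ i S-R)

  ρ^ : ∀ i → ρ ^ i ≋ eval n h (i Cℚ_)
  ρ^ i = ≋-sym (eval-binomial h 0<n (order-^ h h₀) i)

  y-small : ∀ s → n ≤ s → y s ≋ const 0ℚ
  y-small s n≤s = agree λ e l _ → trans (x-vanishes b s (ℕ.≤-trans l n≤s) e refl) (sym (constCoeff-0 e))

  X-expansion : ∀ i → X b i ≋ ∑ n (λ s → B b (b ℕ.+ s) (b ℕ.+ i) • y s)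
  X-expansion i = begin
    X b i                                  ≈⟨ ∑∞-≋ (X-term b i) (X-summable b i) n (λ _ l _ → l) ⟩
    ∑ n (X-term b i)                       ≈⟨ sum<-cong n {X-term b i} {λ k → F (i ℕ.+ k)} (λ k _ →
                                                Ring.reflexive (cong (λ p → B b p (b ℕ.+ i) • x b p) (ℕ.+-assoc b i k))) ⟩
    ∑ n (λ k → F (i ℕ.+ k))                ≈⟨ Ring.+-identityˡ _ ⟨
    const 0ℚ + ∑ n (λ k → F (i ℕ.+ k))     ≈⟨ +-congʳ (sum<-zero i {F} (λ s s<i →
                                                ≋-trans (Ring.reflexive (cong (_• y s) (B-below b s i s<i))) (0•f≋0 (y s)))) ⟨
    ∑ i F + ∑ n (λ k → F (i ℕ.+ k))        ≈⟨ sum<-append i n F ⟨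
    ∑ (i ℕ.+ n) F                          ≈⟨ sum<-truncate F (ℕ.m≤n+m n i) (λ s n≤s _ →
                                                ≋-trans (•-cong (B b (b ℕ.+ s) (b ℕ.+ i)) (y-small s n≤s))
                                                        (coeff-≋ λ e → trans (zeroʳ (B b (b ℕ.+ s) (b ℕ.+ i)) (constCoeff-0 e)) (sym (constCoeff-0 e)))) ⟩
    ∑ n F                                  ∎
    where
    F : ℕ → Series
    F s = B b (b ℕ.+ s) (b ℕ.+ i) • y s

  sum<-first : ∀ {N} F → 0 < N → (∀ i → F (suc i) ≋ const 0ℚ) → ∑ N F ≋ F 0
  sum<-first {suc N} F _ h = ≋-trans (+-congˡ (sum<-zero N {F ∘ suc} (λ i _ → h i))) (Ring.+-identityʳ (F 0))

  X-base : X b 0 ≋ y 0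
  X-base = begin
    X b 0                             ≈⟨ X-expansion 0 ⟩
    ∑ n (λ s → B b (b ℕ.+ s) (b ℕ.+ 0) • y s)
                                      ≈⟨ sum<-first (λ s → B b (b ℕ.+ s) (b ℕ.+ 0) • y s) 0<n (λ s → ≋-trans (Ring.reflexive (cong (_• y (suc s))
                                           (trans (cong (B b (b ℕ.+ suc s)) (ℕ.+-identityʳ b)) (B-base b s)))) (0•f≋0 (y (suc s)))) ⟩
    B b (b ℕ.+ 0) (b ℕ.+ 0) • y 0
      ≈⟨ Ring.reflexive (cong (_• y 0) (trans (cong (λ l → B b l l) (ℕ.+-identityʳ b)) (B-corner b))) ⟩
    1ℚ • y 0                          ≈⟨ 1•f≋f (y 0) ⟩
    y 0                               ∎

  J-part : 𝟙 (b ℕ.≟ 0) • ρ - ∑ (suc b) (λ ℓ → Catalan-coeff b ℓ • ρ ^ (b ∸ ℓ)) ≋ eval n h (J b)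
  J-part = ≋-sym (begin
    eval n h (J b)
      ≈⟨ eval-cong n h {λ q → 𝟙 (b ℕ.≟ 0) ℚ.* 1 Cℚ q ℚ.- Catalan-sum b q} {J b} (J-expansion b) ⟨
    eval n h (λ q → 𝟙 (b ℕ.≟ 0) ℚ.* 1 Cℚ q ℚ.- Catalan-sum b q)
      ≈⟨ eval-- n h (λ q → 𝟙 (b ℕ.≟ 0) ℚ.* 1 Cℚ q) (Catalan-sum b) ⟩
    eval n h (λ q → 𝟙 (b ℕ.≟ 0) ℚ.* 1 Cℚ q) - eval n h (Catalan-sum b)
      ≈⟨ +-cong (≋-trans (eval-• n h (𝟙 (b ℕ.≟ 0)) (1 Cℚ_))
                  (•-cong (𝟙 (b ℕ.≟ 0)) (≋-trans (≋-sym (ρ^ 1)) (Ring.*-identityʳ ρ))))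
                (-‿cong (≋-trans (eval-∑ n h (suc b) (λ ℓ q → Catalan-coeff b ℓ ℚ.* (b ∸ ℓ) Cℚ q))
                  (sum<-cong (suc b) {λ ℓ → eval n h (λ q → Catalan-coeff b ℓ ℚ.* (b ∸ ℓ) Cℚ q)} {λ ℓ → Catalan-coeff b ℓ • ρ ^ (b ∸ ℓ)}
                    (λ ℓ _ → ≋-trans (eval-• n h (Catalan-coeff b ℓ) ((b ∸ ℓ) Cℚ_))
                                     (•-cong (Catalan-coeff b ℓ) (≋-sym (ρ^ (b ∸ ℓ)))))))) ⟩
    𝟙 (b ℕ.≟ 0) • ρ - ∑ (suc b) (λ ℓ → Catalan-coeff b ℓ • ρ ^ (b ∸ ℓ)) ∎)

  G : ℕ → Series
  G s = ∑ n (λ i → c s i • ρ ^ k i)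

  G-zero : G 0 ≋ const 0ℚ
  G-zero = sum<-zero n {λ i → c 0 i • ρ ^ k i} (λ i _ →
    ≋-trans (Ring.reflexive (cong (_• ρ ^ k i) (zeroʳ (Z-coeff b i) (B-below b 0 (suc i) (s≤s z≤n))))) (0•f≋0 (ρ ^ k i)))

  G-suc : ∀ s → suc s < n → G (suc s) ≋ eval n h (I b (b ℕ.+ suc s))
  G-suc s s+1<n = begin
    ∑ n (λ i → c (suc s) i • ρ ^ k i)
      ≈⟨ sum<-cong n {λ i → c (suc s) i • ρ ^ k i} {λ i → eval n h (λ q → c (suc s) i ℚ.* k i Cℚ q)} (λ i _ →
           ≋-trans (•-cong (c (suc s) i) (ρ^ (k i))) (≋-sym (eval-• n h (c (suc s) i) (k i Cℚ_)))) ⟩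
    ∑ n (λ i → eval n h (λ q → c (suc s) i ℚ.* k i Cℚ q))
      ≈⟨ eval-∑ n h n (λ i q → c (suc s) i ℚ.* k i Cℚ q) ⟨
    eval n h (λ q → ∑ℚ n (λ i → c (suc s) i ℚ.* k i Cℚ q))
      ≈⟨ eval-cong n h {λ q → ∑ℚ n (λ i → c (suc s) i ℚ.* k i Cℚ q)} {I b (b ℕ.+ suc s)} (λ q → trans
           (∑ℚ-truncate {suc s} {n} {λ i → c (suc s) i ℚ.* k i Cℚ q} (λ i s<i → zeroˡ (k i Cℚ q)
             (zeroʳ (Z-coeff b i) (B-below b (suc s) (suc i) (s≤s s<i)))) (ℕ.<⇒≤ s+1<n))
           (I-expansion b s q)) ⟩
    eval n h (I b (b ℕ.+ suc s)) ∎

  I-part : ∑ n (λ i → Z-coeff b i • (X b (suc i) * ρ ^ k i)) ≋ ∑ n (λ s → G s * y s)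
  I-part = begin
    ∑ n (λ i → Z-coeff b i • (X b (suc i) * ρ ^ k i))
      ≈⟨ sum<-cong n {λ i → Z-coeff b i • (X b (suc i) * ρ ^ k i)} {λ i → ∑ n (λ s → (c s i • ρ ^ k i) * y s)} (λ i _ → distribute i) ⟩
    ∑ n (λ i → ∑ n (λ s → (c s i • ρ ^ k i) * y s))
      ≈⟨ sum<-comm n n (λ i s → (c s i • ρ ^ k i) * y s) ⟩
    ∑ n (λ s → ∑ n (λ i → (c s i • ρ ^ k i) * y s))
      ≈⟨ sum<-cong n {λ s → ∑ n (λ i → (c s i • ρ ^ k i) * y s)} {λ s → G s * y s} (λ s _ → ≋-sym (sum<-*ʳ n (y s) (λ i → c s i • ρ ^ k i))) ⟩
    ∑ n (λ s → G s * y s) ∎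
    where
    distribute : ∀ i → Z-coeff b i • (X b (suc i) * ρ ^ k i) ≋ ∑ n (λ s → (c s i • ρ ^ k i) * y s)
    distribute i = begin
      Z-coeff b i • (X b (suc i) * ρ ^ k i)                       ≈⟨ •-const (Z-coeff b i) (X b (suc i) * ρ ^ k i) ⟩
      const (Z-coeff b i) * (X b (suc i) * ρ ^ k i)
        ≈⟨ *-congˡ (≋-trans (*-congʳ (X-expansion (suc i))) (sum<-*ʳ n (ρ ^ k i) (λ s → β s • y s))) ⟩
      const (Z-coeff b i) * ∑ n (λ s → (β s • y s) * ρ ^ k i)
        ≈⟨ sum<-*ˡ n (const (Z-coeff b i)) (λ s → (β s • y s) * ρ ^ k i) ⟩
      ∑ n (λ s → const (Z-coeff b i) * ((β s • y s) * ρ ^ k i))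
        ≈⟨ sum<-cong n {λ s → const (Z-coeff b i) * ((β s • y s) * ρ ^ k i)} {λ s → (c s i • ρ ^ k i) * y s} (λ s _ → term s) ⟩
      ∑ n (λ s → (c s i • ρ ^ k i) * y s)                         ∎
      where
      β : ℕ → ℚ
      β s = B b (b ℕ.+ s) (b ℕ.+ suc i)
      term : ∀ s → const (Z-coeff b i) * ((β s • y s) * ρ ^ k i) ≋ (c s i • ρ ^ k i) * y s
      term s = begin
        const (Z-coeff b i) * ((β s • y s) * ρ ^ k i)             ≈⟨ *-congˡ (*-congʳ (•-const (β s) (y s))) ⟩
        const (Z-coeff b i) * ((const (β s) * y s) * ρ ^ k i)
          ≈⟨ solve 4 (λ a c y p → a :* ((c :* y) :* p) := ((a :* c) :* p) :* y) ≋-refl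
                                                                       (const (Z-coeff b i)) (const (β s)) (y s) (ρ ^ k i) ⟩
        ((const (Z-coeff b i) * const (β s)) * ρ ^ k i) * y s     ≈⟨ *-congʳ (*-congʳ (const-* (Z-coeff b i) (β s))) ⟨
        (const (c s i) * ρ ^ k i) * y s                           ≈⟨ *-congʳ (•-const (c s i) (ρ ^ k i)) ⟨
        (c s i • ρ ^ k i) * y s                                   ∎

  U V : Series
  U = 𝟙 (b ℕ.≟ 0) • R
  V = ∑ (suc b) (λ ℓ → Catalan-coeff b ℓ • R ^ (b ∸ ℓ))

  ζ : ℕ → Series
  ζ i = Z-term b R (b ℕ.+ suc i)

  S-V : S V ≋ ∑ (suc b) (λ ℓ → Catalan-coeff b ℓ • ρ ^ (b ∸ ℓ))
  S-V = ≋-trans (S-∑ (suc b) (λ ℓ → Catalan-coeff b ℓ • R ^ (b ∸ ℓ)))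
    (sum<-cong (suc b) {λ ℓ → S (Catalan-coeff b ℓ • R ^ (b ∸ ℓ))} {λ ℓ → Catalan-coeff b ℓ • ρ ^ (b ∸ ℓ)} (λ ℓ _ →
      ≋-trans (S-• (Catalan-coeff b ℓ) (R ^ (b ∸ ℓ))) (•-cong (Catalan-coeff b ℓ) (S-R^ (b ∸ ℓ)))))

  S-ζ : ∀ i → S (ζ i) ≋ Z-coeff b i • (X b (suc i) * ρ ^ k i)
  S-ζ i = begin
    S (ζ i)                                                ≈⟨ S-• (Z-coeff b i) (x b (b ℕ.+ suc i) * R ^ k i) ⟩
    Z-coeff b i • S (x b (b ℕ.+ suc i) * R ^ k i)          ≈⟨ •-cong (Z-coeff b i) (S-* (x b (b ℕ.+ suc i)) (R ^ k i)) ⟩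
    Z-coeff b i • (S (x b (b ℕ.+ suc i)) * S (R ^ k i))    ≈⟨ •-cong (Z-coeff b i) (*-cong
      (≋-trans (S-var (b ℕ.+ suc i ∸ b)) (Ring.reflexive (cong (X b) (ℕ.m+n∸m≡n b (suc i))))) (S-R^ (k i))) ⟩
    Z-coeff b i • (X b (suc i) * ρ ^ k i)                  ∎

  S-∑ζ : S (∑ n ζ) ≋ ∑ n (λ s → G s * y s)
  S-∑ζ = begin
    S (∑ n ζ)                                              ≈⟨ S-∑ n ζ ⟩
    ∑ n (λ i → S (ζ i))
      ≈⟨ sum<-cong n {λ i → S (ζ i)} {λ i → Z-coeff b i • (X b (suc i) * ρ ^ k i)} (λ i _ → S-ζ i) ⟩
    ∑ n (λ i → Z-coeff b i • (X b (suc i) * ρ ^ k i))      ≈⟨ I-part ⟩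
    ∑ n (λ s → G s * y s)                                  ∎

  Z-truncate : Z b R ≋ (U - V) - ∑ n ζ
  Z-truncate = +-congˡ {U - V} (-‿cong (∑∞-≋ ζ (Z-summable b R) n (λ _ l _ → l)))

  S-UV : S U - S V ≋ eval n h (J b)
  S-UV = ≋-trans (+-cong (≋-trans (S-• (𝟙 (b ℕ.≟ 0)) R) (•-cong (𝟙 (b ℕ.≟ 0)) S-R)) (-‿cong S-V)) J-part

  S-Z : S (Z b R) ≋ eval n h (J b) - ∑ n (λ s → G s * y s)
  S-Z = begin
    S (Z b R)                                   ≈⟨ S-cong Z-truncate ⟩
    S ((U - V) - ∑ n ζ)                         ≈⟨ S-- (U - V) (∑ n ζ) ⟩
    S (U - V) - S (∑ n ζ)                       ≈⟨ +-cong (≋-trans (S-- U V) S-UV) (-‿cong S-∑ζ) ⟩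
    eval n h (J b) - ∑ n (λ s → G s * y s)      ∎

  S-x : S (x b b) ≋ y 0
  S-x = begin
    S (x b b)     ≈⟨ S-var (b ∸ b) ⟩
    X b (b ∸ b)   ≈⟨ Ring.reflexive (cong (X b) (ℕ.n∸n≡0 b)) ⟩
    X b 0         ≈⟨ X-base ⟩
    y 0           ∎

  J-G : eval n h (J b) - ∑ n (λ s → G s * y s) ≋ y 0
  J-G = ≋-trans (≋-sym S-Z) (≋-trans (S-cong (≈⇒≈[] (IsR.equation isR))) S-x)

  δ : ℕ → Series
  δ zero    = const 1ℚ
  δ (suc _) = const 0ℚ

  I-G : ∀ s → s < n → eval n h (I b (b ℕ.+ s)) ≋ δ s + G s
  I-G zero    _     = begin
    eval n h (I b (b ℕ.+ 0))   ≈⟨ eval-unit h {I b (b ℕ.+ 0)} 0<n refl (I-diagonal b) ⟩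
    const 1ℚ                   ≈⟨ Ring.+-identityʳ (const 1ℚ) ⟨
    const 1ℚ + const 0ℚ        ≈⟨ +-congˡ G-zero ⟨
    const 1ℚ + G 0             ∎
  I-G (suc s) s+1<n = ≋-trans (≋-sym (G-suc s s+1<n)) (≋-sym (Ring.+-identityˡ (G (suc s))))

  I-sum : ∑ n (λ s → eval n h (I b (b ℕ.+ s)) * y s) ≋ y 0 + ∑ n (λ s → G s * y s)
  I-sum = begin
    ∑ n (λ s → eval n h (I b (b ℕ.+ s)) * y s)
      ≈⟨ sum<-cong n {λ s → eval n h (I b (b ℕ.+ s)) * y s} {λ s → δ s * y s + G s * y s}
                                                           (λ s s<n → ≋-trans (*-congʳ (I-G s s<n)) (Ring.distribʳ (y s) (δ s) (G s))) ⟩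
    ∑ n (λ s → δ s * y s + G s * y s)                 ≈⟨ sum<-+ n (λ s → δ s * y s) (λ s → G s * y s) ⟩
    ∑ n (λ s → δ s * y s) + ∑ n (λ s → G s * y s)     ≈⟨ +-congʳ (≋-trans
                                                           (sum<-first (λ s → δ s * y s) 0<n (λ s → Ring.zeroˡ (y (suc s)))) (Ring.*-identityˡ (y 0))) ⟩
    y 0 + ∑ n (λ s → G s * y s)                       ∎

  Ẑ-truncate : Ẑ b h h₀ ≋ eval n h (J b) - ∑ n (λ s → eval n h (I b (b ℕ.+ s)) * y s)
  Ẑ-truncate = +-cong (evalAt-≋ (J b) h h₀ n ℕ.≤-refl) (-‿cong (≋-trans
    (∑∞-≋ (λ i → Ẑ-term b h h₀ (b ℕ.+ i)) (Ẑ-summable b h h₀) n (λ _ l _ → l))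
    (sum<-cong n {λ i → Ẑ-term b h h₀ (b ℕ.+ i)} {λ i → eval n h (I b (b ℕ.+ i)) * y i} (λ i _ →
      *-congʳ (evalAt-≋ (I b (b ℕ.+ i)) h h₀ n ℕ.≤-refl)))))

  equation : Ẑ b h h₀ ≋ const 0ℚ
  equation = begin
    Ẑ b h h₀                                                             ≈⟨ Ẑ-truncate ⟩
    eval n h (J b) - ∑ n (λ s → eval n h (I b (b ℕ.+ s)) * y s)          ≈⟨ +-congˡ (-‿cong I-sum) ⟩
    eval n h (J b) - (y 0 + T)
      ≈⟨ coeff-≋ (λ e → regroup (coeff (eval n h (J b)) e) (coeff (y 0) e) (coeff T e)) ⟩
    (eval n h (J b) - T) - y 0                                           ≈⟨ +-congʳ J-G ⟩
    y 0 - y 0                                                            ≈⟨ Ring.-‿inverseʳ (y 0) ⟩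
    const 0ℚ                                                             ∎
    where
    T : Series
    T = ∑ n (λ s → G s * y s)
    regroup : ∀ a y t → a ℚ.- (y ℚ.+ t) ≡ (a ℚ.- t) ℚ.- y
    regroup = solve-∀ ℚ-ring

hat-isSolution : ∀ b R → IsR b R → IsSolution b (hat b R)
hat-isSolution b R isR = hat-constantTerm b R (IsR.constantTerm-1 isR) , ≈[]⇒≈ λ m →
  let open SubstitutionModulo m in
  HatEquation.equation b R isR n (s≤s z≤n) (Modulo.substBox n n n (X b))
    (substBox-isSubstitution (X b) (X-triangular b)) (substitute-≋ (X b) (X-triangular b) R)

-- Uniqueness

*-lift : ∀ {L D} u {f g} → constantTerm u ≡ 0ℚ → f ≈[ L , D ] g → u * f ≈[ L , suc D ] u * g
*-lift {L} {D} u {f} {g} u₀ f≈g = agree λ e l d → begin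
  cauchy (coeff u) (coeff f) e
    ≡⟨ cauchy-ext e (λ _ → refl) (λ v → split (coeff f v) (coeff g v)) ⟩
  cauchy (coeff u) (λ v → (coeff f v ℚ.- coeff g v) ℚ.+ coeff g v) e
    ≡⟨ cauchy-distribˡ e (coeff u) (λ v → coeff f v ℚ.- coeff g v) (coeff g) ⟩
  cauchy (coeff u) (λ v → coeff f v ℚ.- coeff g v) e ℚ.+ cauchy (coeff u) (coeff g) e
    ≡⟨ cong (ℚ._+ cauchy (coeff u) (coeff g) e) (cauchy-zero (coeff u) (λ v → coeff f v ℚ.- coeff g v) e (difference e l d)) ⟩
  0ℚ ℚ.+ cauchy (coeff u) (coeff g) e
    ≡⟨ ℚ.+-identityˡ _ ⟩
  cauchy (coeff u) (coeff g) e ∎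
  where
  open ≡-Reasoning
  split : ∀ x y → x ≡ (x ℚ.- y) ℚ.+ y
  split = solve-∀ ℚ-ring
  difference : ∀ e → length e ≤ L → sum e < suc D → ∀ a v → length a ≡ length e → length v ≡ length e →
               sum a ℕ.+ sum v ≡ sum e → coeff u a ℚ.* (coeff f v ℚ.- coeff g v) ≡ 0ℚ
  difference e l (s≤s Σe≤D) a v _ |v| Σ≡ = by-cases (sum a ℕ.<? 1)
    where
    by-cases : Dec (sum a < 1) → coeff u a ℚ.* (coeff f v ℚ.- coeff g v) ≡ 0ℚ
    by-cases (yes a<1) = zeroˡ (coeff f v ℚ.- coeff g v) (order-1 u u₀ a a<1)
    by-cases (no  a≮1) = zeroʳ (coeff u a) (trans
      (cong (ℚ._- coeff g v) (coeff-agree f≈g v (subst (_≤ L) (sym |v|) l)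
        (ℕ.<-≤-trans (ℕ.+-monoˡ-≤ (sum v) (ℕ.≮⇒≥ a≮1)) (ℕ.≤-trans (ℕ.≤-reflexive Σ≡) Σe≤D))))
      (ℚ.+-inverseʳ (coeff g v)))

module Uniqueness (b : ℕ) (s t : Series) (s₀ : constantTerm s ≡ 0ℚ) (t₀ : constantTerm t ≡ 0ℚ)
                  (s-solves : Ẑ b s s₀ ≈ const 0ℚ) (t-solves : Ẑ b t t₀ ≈ const 0ℚ) where

  module Step (L D : ℕ) (s≈t : s ≈[ L , D ] t) where
    module Low = Modulo L D
    module LowFacts = ModuloFacts L D
    open Modulo L (suc D)
    open ModuloFacts L (suc D)
    open SetoidReasoning setoid

    power : ∀ p → s ^ suc (suc p) ≋ t ^ suc (suc p)
    power p = begin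
      s * s ^ suc p       ≈⟨ *-lift s s₀ (Low.^-congˡ (suc p) s≈t) ⟩
      s * t ^ suc p       ≈⟨ Ring.*-comm s (t ^ suc p) ⟩
      t ^ suc p * s       ≈⟨ *-lift (t ^ suc p) (zeroˡ (constantTerm (t ^ p)) t₀) s≈t ⟩
      t ^ suc p * t       ≈⟨ Ring.*-comm (t ^ suc p) t ⟩
      t * t ^ suc p       ∎

    tail : Series → Series
    tail f = ∑ D (λ p → J b (suc (suc p)) • f ^ suc (suc p))

    J-linear : ∀ f f₀ → evalAt (J b) f f₀ ≋ f + tail f
    J-linear f f₀ = begin
      evalAt (J b) f f₀                                        ≈⟨ evalAt-≋ (J b) f f₀ (suc (suc D)) (ℕ.n≤1+n (suc D)) ⟩
      0ℚ • const 1ℚ + (J b 1 • (f * const 1ℚ) + tail f)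
        ≈⟨ +-cong (0•f≋0 (const 1ℚ)) (+-congʳ (≋-trans (1•f≋f (f * const 1ℚ)) (Ring.*-identityʳ f))) ⟩
      const 0ℚ + (f + tail f)                                  ≈⟨ Ring.+-identityˡ (f + tail f) ⟩
      f + tail f                                               ∎

    x-sum : (f : Series) → constantTerm f ≡ 0ℚ → Series
    x-sum f f₀ = ∑ L (λ i → Ẑ-term b f f₀ (b ℕ.+ i))

    x-sum-cong : x-sum s s₀ ≋ x-sum t t₀
    x-sum-cong = sum<-cong L {λ i → Ẑ-term b s s₀ (b ℕ.+ i)} {λ i → Ẑ-term b t t₀ (b ℕ.+ i)} (λ i _ → begin
      evalAt (I b (b ℕ.+ i)) s s₀ * x b (b ℕ.+ i)    ≈⟨ Ring.*-comm (evalAt (I b (b ℕ.+ i)) s s₀) (x b (b ℕ.+ i)) ⟩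
      x b (b ℕ.+ i) * evalAt (I b (b ℕ.+ i)) s s₀    ≈⟨ *-lift (x b (b ℕ.+ i)) (x-vanishes b i z≤n [] refl) (I-cong i) ⟩
      x b (b ℕ.+ i) * evalAt (I b (b ℕ.+ i)) t t₀    ≈⟨ Ring.*-comm (x b (b ℕ.+ i)) (evalAt (I b (b ℕ.+ i)) t t₀) ⟩
      evalAt (I b (b ℕ.+ i)) t t₀ * x b (b ℕ.+ i)    ∎)
      where
      I-cong : ∀ i → evalAt (I b (b ℕ.+ i)) s s₀ ≈[ L , D ] evalAt (I b (b ℕ.+ i)) t t₀
      I-cong i = Low.≋-trans (LowFacts.evalAt-≋ (I b (b ℕ.+ i)) s s₀ D ℕ.≤-refl)
        (Low.≋-trans (LowFacts.eval-congʳ D (I b (b ℕ.+ i)) s≈t) (Low.≋-sym (LowFacts.evalAt-≋ (I b (b ℕ.+ i)) t t₀ D ℕ.≤-refl)))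

    J≋x-sum : ∀ f f₀ → Ẑ b f f₀ ≈ const 0ℚ → f + tail f ≋ x-sum f f₀
    J≋x-sum f f₀ f-solves = begin
      f + tail f                                          ≈⟨ J-linear f f₀ ⟨
      evalAt (J b) f f₀
        ≈⟨ coeff-≋ (λ e → split (coeff (evalAt (J b) f f₀) e) (coeff Σ∞ e)) ⟩
      Ẑ b f f₀ + Σ∞
        ≈⟨ +-cong (≈⇒≈[] f-solves) (∑∞-≋ (λ i → Ẑ-term b f f₀ (b ℕ.+ i)) (Ẑ-summable b f f₀) L (λ _ l _ → l)) ⟩
      const 0ℚ + x-sum f f₀                               ≈⟨ Ring.+-identityˡ (x-sum f f₀) ⟩
      x-sum f f₀                                          ∎
      where
      Σ∞ : Series
      Σ∞ = ∑∞ (λ i → Ẑ-term b f f₀ (b ℕ.+ i)) (Ẑ-summable b f f₀)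
      split : ∀ x y → x ≡ (x ℚ.- y) ℚ.+ y
      split = solve-∀ ℚ-ring

    next : s ≋ t
    next = begin
      s                          ≈⟨ coeff-≋ (λ e → split (coeff s e) (coeff (tail s) e)) ⟩
      (s + tail s) - tail s
        ≈⟨ +-cong (≋-trans (J≋x-sum s s₀ s-solves) (≋-trans x-sum-cong (≋-sym (J≋x-sum t t₀ t-solves))))
                                           (-‿cong (sum<-cong D {λ p → J b (suc (suc p)) • s ^ suc (suc p)} {λ p → J b (suc (suc p)) • t ^ suc (suc p)}
                                             (λ p _ → •-cong (J b (suc (suc p))) (power p)))) ⟩
      (t + tail t) - tail t      ≈⟨ coeff-≋ (λ e → split (coeff t e) (coeff (tail t) e)) ⟨
      t                          ∎
      where
      split : ∀ x y → x ≡ (x ℚ.+ y) ℚ.- y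
      split = solve-∀ ℚ-ring

  s≈t-upTo : ∀ L D → s ≈[ L , D ] t
  s≈t-upTo L zero    = agree λ _ _ ()
  s≈t-upTo L (suc D) = Step.next L D (s≈t-upTo L D)

solution-unique : ∀ b s t → IsSolution b s → IsSolution b t → s ≈ t
solution-unique b s t (s₀ , s-solves) (t₀ , t-solves) =
  ≈[]⇒≈ λ n → Uniqueness.s≈t-upTo b s t s₀ t₀ s-solves t-solves (2 ℕ.+ n) (2 ℕ.+ n)

proposition11 : (b : ℕ) (R : Series) → IsR b R → IsUnique (IsSolution b) (hat b R)
proposition11 b R isR = hat-isSolution b R isR , λ s s-solves → solution-unique b s (hat b R) s-solves (hat-isSolution b R isR)
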